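{- Let $q$ be a prime power. Then $\mathbb{P}_{Q_q^+}\cong\mathrm{GF}(q)$; that is, the universal partial field of the matroid $Q_q^+$ is isomorphic to $\mathrm{GF}(q)$, regarded as the partial field $(\mathrm{GF}(q),\mathrm{GF}(q)^*)$.
   Context: $Q_q$ is the rank-3 matroid consisting of the points of three distinct $(q+1)$-point lines $L_1,L_2,L_3\subset\mathrm{PG}(2,q)$ with $L_1\cap L_2\cap L_3=\emptyset$. $Q_q^+$ is the matroid (restriction of $\mathrm{PG}(2,q)$) obtained from $Q_q$ by adding a point $e\in\mathrm{PG}(2,q)\setminus(L_1\cup L_2\cup L_3)$. A partial field is a pair $(R,G)$ with $R$ a commutative ring with identity and $G$ a subgroup of $R^*$ with $-1\in G$; as a set it is $G\cup\{0\}$. A partial-field homomorphism is a map $\phi:\mathbb{P}_1\to\mathbb{P}_2$ with $\phi(1)=1$, $\phi(pq)=\phi(p)\phi(q)$, and $\phi(p)+\phi(q)=\phi(p+q)$ whenever $p,q,p+q\in\mathbb{P}_1$. An isomorphism is a bijective homomorphism such that $\phi(p)+\phi(q)\in\mathbb{P}_2$ if and only if $p+q\in\mathbb{P}_1$. $\langle S\rangle$ is the multiplicative group generated by the nonzero elements of $S$. Universal partial field. Let $M=(E,\mathcal{B})$ be a matroid of rank $r$. For every $Z\in E^r$ introduce a symbol $[Z]$, and for every $Z\in E^r$ whose set of entries $\{Z\}$ is a basis, a symbol $\overline{[Z]}$. Let $I_M$ be the ideal, in the polynomial ring over $\mathbb{Z}$ in these symbols, generated by: (1) $[Z]$ for all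 $Z$ with $\{Z\}\notin\mathcal{B}$; (2) $[Z]-\mathrm{sgn}(\sigma)[Z^\sigma]$ for all $Z$ and permutations $\sigma$; (3) $[x_1,x_2,W][y_1,y_2,W]-[y_1,x_2,W][x_1,y_2,W]-[y_2,x_2,W][y_1,x_1,W]$ for all $x_1,x_2,y_1,y_2\in E$, $W\in E^{r-2}$; (4) $[Z]\overline{[Z]}-1$ for all $Z$ with $\{Z\}\in\mathcal{B}$. Let $\mathbb{B}_M$ be the quotient ring. For $B\in E^r$ with $\{B\}$ a basis, $A_{M,B}$ is the $\{B\}\times(E\setminus\{B\})$ matrix over $\mathbb{B}_M$ with $(A_{M,B})_{uv}=[B/u\to v]/[B]$, where $B/u\to v$ is $B$ with $u$ replaced by $v$; all its subdeterminants are zero or units. For an $X\times Y$ matrix $A$ all of whose subdeterminants are zero or units, $A'\preceq A$ means that $A'$ is obtained from $A$ by scaling rows or columns by units, deleting or permuting rows or columns, and pivoting (for $A_{xy}\neq0$, $A^{xy}$ is the $((X\setminus x)\cup y)\times((Y\setminus y)\cup x)$ matrix with $(A^{xy})_{yx}=A_{xy}^{ -1}$, $(A^{xy})_{yv}=A_{xy}^{ -1}A_{xv}$ for $v\neq x$, $(A^{xy})_{ux}=-A_{xy}^{ -1}A_{uy}$ for $u\ne y$, $(A^{xy})_{uv}=A_{uv}-A_{xy}^{ -1}A_{uy}A_{xv}$ otherwise). Put $\mathrm{Cr}(A)=\{p\mid\left[\begin{smallmatrix}1 & 1 \\ p & 1\end{smallmatrix}\right]\preceq A\}$ and $\mathrm{Cr}(M)=\mathrm{Cr}(A_{M,B})$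 (independent of $B$). Let $R_M=\mathbb{Z}[\mathrm{Cr}(M)]\subseteq\mathbb{B}_M$. The universal partial field of $M$ is $\mathbb{P}_M=(R_M,\langle\mathrm{Cr}(M)\cup\{ -1\}\rangle)$. -}

module Defs where

open import Algebra.Apartness.Bundles using (HeytingField)
open import Algebra.Bundles using (CommutativeRing; RawRing)
open import Algebra.Morphism.Structures using (IsRingMonomorphism)
import Algebra.Definitions as AlgebraDefinitions
import Algebra.Properties.Semiring.Sum as SemiringSum
import Algebra.Properties.Semiring.Exp as SemiringExp
import Algebra.Consequences.Setoid as Consequences
import Algebra.Morphism.RingMonomorphism as RingMonomorphism
import Algebra.Properties.Ring as RingProperties
open import Data.Bool.Base using (if_then_else_)
open import Data.Fin.Base using (Fin; zero; suc)
open import Data.Fin.Properties using (_≟_; _<?_)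
open import Data.Fin.Permutation using (Permutation′; _⟨$⟩ʳ_)
open import Data.Fin.Subset using (Subset; _∈_; _∉_; _⊆_; _∪_; ⁅_⁆; ∣_∣; ⊥)
import Data.Fin.Subset as Subset
open import Data.Fin.Subset.Properties using (_∈?_)
open import Data.List.Base using (List; length; lookup; filter; allFin; cartesianProduct)
open import Data.Nat.Base using (ℕ; suc; NonZero; _^_)
open import Data.Nat.Primality using (Prime)
open import Data.Product.Base using (Σ; ∃; ∃-syntax; _×_; _,_; proj₁; proj₂)
open import Data.Sum.Base using (_⊎_; inj₁; inj₂)
open import Data.Vec.Base using (Vec; []; _∷_; _[_]≔_; cast; tabulate)
import Data.Vec.Base as Vec
open import Data.Vec.Functional using (Vector)
open import Function.Bundles using (_⇔_; Inverse)
open import Function.Definitions using (Bijective; Congruent; Injective)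
open import Level using (Level; _⊔_; 0ℓ) renaming (suc to lsuc)
open import Relation.Binary.Bundles using (Setoid)
open import Relation.Binary.PropositionalEquality using (_≡_; refl; setoid)
open import Relation.Nullary.Decidable using (does; ¬?; _×-dec_)
open import Relation.Nullary.Negation using (¬_)
open import Relation.Unary using (Pred; Decidable)
import Relation.Binary.Reasoning.Setoid as SetoidReasoning

------------------------------------------------------------------------
-- Partial fields

record PartialField (c ℓ g : Level) : Set (lsuc (c ⊔ ℓ ⊔ g)) where
  field
    ring : CommutativeRing c ℓ

  open CommutativeRing ring public hiding (ring)

  field
    G        : Pred Carrier g
    G-resp   : ∀ {x y} → x ≈ y → G x → G y
    1∈G      : G 1#
    G-*      : ∀ {x y} → G x → G y → G (x * y)
    G-inv    : ∀ {x} → G x → ∃[ y ] G y × x * y ≈ 1#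
    -1∈G     : G (- 1#)

  -- The underlying set G ∪ {0}.
  Member : Pred Carrier (ℓ ⊔ g)
  Member x = x ≈ 0# ⊎ G x

  Element : Set (c ⊔ ℓ ⊔ g)
  Element = Σ Carrier Member

  _≈ᴱ_ : Element → Element → Set ℓ
  p ≈ᴱ q = proj₁ p ≈ proj₁ q

module _ {c₁ ℓ₁ g₁ c₂ ℓ₂ g₂ : Level}
         (P₁ : PartialField c₁ ℓ₁ g₁) (P₂ : PartialField c₂ ℓ₂ g₂) where

  private
    module P₁ = PartialField P₁
    module P₂ = PartialField P₂

  record IsPartialFieldHom (φ : P₁.Element → P₂.Element)
                           : Set (c₁ ⊔ ℓ₁ ⊔ g₁ ⊔ ℓ₂) where
    field
      φ-cong : Congruent P₁._≈ᴱ_ P₂._≈ᴱ_ φ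
      φ-1    : proj₁ (φ (P₁.1# , inj₂ P₁.1∈G)) P₂.≈ P₂.1#
      φ-*    : ∀ p q (pq∈ : P₁.Member (proj₁ p P₁.* proj₁ q)) →
               proj₁ (φ (proj₁ p P₁.* proj₁ q , pq∈)) P₂.≈ proj₁ (φ p) P₂.* proj₁ (φ q)
      φ-+    : ∀ p q (p+q∈ : P₁.Member (proj₁ p P₁.+ proj₁ q)) →
               proj₁ (φ p) P₂.+ proj₁ (φ q) P₂.≈ proj₁ (φ (proj₁ p P₁.+ proj₁ q , p+q∈))

  record IsPartialFieldIso (φ : P₁.Element → P₂.Element)
                           : Set (c₁ ⊔ ℓ₁ ⊔ g₁ ⊔ c₂ ⊔ ℓ₂ ⊔ g₂) where
    field
      isHom     : IsPartialFieldHom φ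
      bijective : Bijective P₁._≈ᴱ_ P₂._≈ᴱ_ φ
      +-defined : ∀ p q → P₂.Member (proj₁ (φ p) P₂.+ proj₁ (φ q)) ⇔
                          P₁.Member (proj₁ p P₁.+ proj₁ q)

  infix 4 _≅_

  _≅_ : Set (c₁ ⊔ ℓ₁ ⊔ g₁ ⊔ c₂ ⊔ ℓ₂ ⊔ g₂)
  _≅_ = ∃ IsPartialFieldIso

module Units {c ℓ : Level} (R : CommutativeRing c ℓ) where
  open CommutativeRing R
  open RingProperties (CommutativeRing.ring R) using (-‿distribˡ-*; -‿involutive)
  open SetoidReasoning (CommutativeRing.setoid R)

  Unit : Pred Carrier (c ⊔ ℓ)
  Unit = AlgebraDefinitions.Invertible _≈_ 1# _*_

  *-interchange : ∀ a b d e → (a * b) * (d * e) ≈ (a * d) * (b * e)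
  *-interchange a b d e = begin
    (a * b) * (d * e) ≈⟨ *-assoc a b (d * e) ⟩
    a * (b * (d * e)) ≈⟨ *-congˡ (*-assoc b d e) ⟨
    a * ((b * d) * e) ≈⟨ *-congˡ (*-congʳ (*-comm b d)) ⟩
    a * ((d * b) * e) ≈⟨ *-congˡ (*-assoc d b e) ⟩
    a * (d * (b * e)) ≈⟨ *-assoc a d (b * e) ⟨
    (a * d) * (b * e) ∎

  *-inverses : ∀ {x x′ y y′} → x * x′ ≈ 1# → y * y′ ≈ 1# → (x * y) * (x′ * y′) ≈ 1#
  *-inverses {x} {x′} {y} {y′} p q =
    trans (*-interchange x y x′ y′) (trans (*-cong p q) (*-identityˡ 1#))

  -1*-1≈1 : (- 1#) * (- 1#) ≈ 1#
  -1*-1≈1 = begin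
    (- 1#) * (- 1#)  ≈⟨ -‿distribˡ-* 1# (- 1#) ⟨
    - (1# * (- 1#))  ≈⟨ -‿cong (*-identityˡ (- 1#)) ⟩
    - (- 1#)         ≈⟨ -‿involutive 1# ⟩
    1#               ∎

  -- For a field F this is (F , F*).
  unitsPartialField : PartialField c ℓ (c ⊔ ℓ)
  unitsPartialField = record
    { ring   = R
    ; G      = Unit
    ; G-resp = λ { x≈y (t , tx , xt) →
                   t , trans (*-congˡ (sym x≈y)) tx , trans (*-congʳ (sym x≈y)) xt }
    ; 1∈G    = 1# , *-identityˡ 1# , *-identityˡ 1#
    ; G-*    = λ { (s , sx , xs) (t , ty , yt) → s * t , *-inverses sx ty , *-inverses xs yt }
    ; G-inv  = λ { {x} (t , tx , xt) → t , (x , xt , tx) , xt }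
    ; -1∈G   = - 1# , -1*-1≈1 , -1*-1≈1
    }

open Units public using (unitsPartialField)

------------------------------------------------------------------------
-- Generated subrings and groups of units

module Generated {c ℓ s : Level} (R : CommutativeRing c ℓ) (S : Pred (CommutativeRing.Carrier R) s) where
  open CommutativeRing R
  open Units R using (Unit)

  data ℤ[_] : Pred Carrier (c ⊔ ℓ ⊔ s) where
    gen  : ∀ {x} → S x → ℤ[_] x
    0∈   : ℤ[_] 0#
    1∈   : ℤ[_] 1#
    +∈   : ∀ {x y} → ℤ[_] x → ℤ[_] y → ℤ[_] (x + y)
    *∈   : ∀ {x y} → ℤ[_] x → ℤ[_] y → ℤ[_] (x * y)
    -∈   : ∀ {x} → ℤ[_] x → ℤ[_] (- x)
    resp : ∀ {x y} → x ≈ y → ℤ[_] x → ℤ[_] y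

  -- The subgroup of the unit group generated by the units in S.  It is used for
  -- sets S whose nonzero elements are all units; then, as 0 is not a unit unless
  -- 1 ≈ 0, this is the group generated by the nonzero elements of S.
  data ⟨_⟩ : Pred Carrier (c ⊔ ℓ ⊔ s) where
    gen  : ∀ {x} → S x → Unit x → ⟨_⟩ x
    1∈   : ⟨_⟩ 1#
    *∈   : ∀ {x y} → ⟨_⟩ x → ⟨_⟩ y → ⟨_⟩ (x * y)
    inv∈ : ∀ {x y} → ⟨_⟩ x → x * y ≈ 1# → ⟨_⟩ y
    resp : ∀ {x y} → x ≈ y → ⟨_⟩ x → ⟨_⟩ y

  private
    rawSubring : RawRing (c ⊔ ℓ ⊔ s) ℓ
    rawSubring = record
      { Carrier = Σ Carrier ℤ[_]
      ; _≈_     = λ x y → proj₁ x ≈ proj₁ y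
      ; _+_     = λ { (x , p) (y , q) → x + y , +∈ p q }
      ; _*_     = λ { (x , p) (y , q) → x * y , *∈ p q }
      ; -_      = λ { (x , p) → - x , -∈ p }
      ; 0#      = 0# , 0∈
      ; 1#      = 1# , 1∈
      }

    inclusion : IsRingMonomorphism rawSubring rawRing proj₁
    inclusion = record
      { isRingHomomorphism = record
        { isSemiringHomomorphism = record
          { isNearSemiringHomomorphism = record
            { +-isMonoidHomomorphism = record
              { isMagmaHomomorphism = record
                { isRelHomomorphism = record { cong = λ e → e }
                ; homo = λ _ _ → CommutativeRing.refl R
                }
              ; ε-homo = CommutativeRing.refl R
              }
            ; *-homo = λ _ _ → CommutativeRing.refl R
            }
          ; 1#-homo = CommutativeRing.refl R
          }
        ; -‿homo = λ _ → CommutativeRing.refl R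
        }
      ; injective = λ e → e
      }

  subring : CommutativeRing (c ⊔ ℓ ⊔ s) ℓ
  subring = record
    { isCommutativeRing = RingMonomorphism.isCommutativeRing inclusion isCommutativeRing }

------------------------------------------------------------------------
-- Polynomial rings over ℤ and quotients by ideals

-- ℤ[X] as the free commutative ring on X: ring expressions modulo the
-- consequences of the commutative ring axioms.  Integer constants are sums
-- of 1ᵖ and -ᵖ 1ᵖ.
module Polynomial {x : Level} (X : Set x) where

  infixl 6 _+ᵖ_
  infixl 7 _*ᵖ_
  infix  8 -ᵖ_
  infix  4 _≈ᵖ_

  data Poly : Set x where
    var  : X → Poly
    0ᵖ   : Poly
    1ᵖ   : Poly
    _+ᵖ_ : Poly → Poly → Poly
    _*ᵖ_ : Poly → Poly → Poly
    -ᵖ_  : Poly → Poly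

  data _≈ᵖ_ : Poly → Poly → Set x where
    ≈-refl  : ∀ {f} → f ≈ᵖ f
    ≈-sym   : ∀ {f g} → f ≈ᵖ g → g ≈ᵖ f
    ≈-trans : ∀ {f g h} → f ≈ᵖ g → g ≈ᵖ h → f ≈ᵖ h
    +-cong  : ∀ {f f′ g g′} → f ≈ᵖ f′ → g ≈ᵖ g′ → f +ᵖ g ≈ᵖ f′ +ᵖ g′
    *-cong  : ∀ {f f′ g g′} → f ≈ᵖ f′ → g ≈ᵖ g′ → f *ᵖ g ≈ᵖ f′ *ᵖ g′
    -‿cong  : ∀ {f f′} → f ≈ᵖ f′ → -ᵖ f ≈ᵖ -ᵖ f′
    +-assoc : ∀ f g h → (f +ᵖ g) +ᵖ h ≈ᵖ f +ᵖ (g +ᵖ h)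
    +-comm  : ∀ f g → f +ᵖ g ≈ᵖ g +ᵖ f
    +-idˡ   : ∀ f → 0ᵖ +ᵖ f ≈ᵖ f
    -‿invˡ  : ∀ f → (-ᵖ f) +ᵖ f ≈ᵖ 0ᵖ
    *-assoc : ∀ f g h → (f *ᵖ g) *ᵖ h ≈ᵖ f *ᵖ (g *ᵖ h)
    *-comm  : ∀ f g → f *ᵖ g ≈ᵖ g *ᵖ f
    *-idˡ   : ∀ f → 1ᵖ *ᵖ f ≈ᵖ f
    distˡ   : ∀ f g h → f *ᵖ (g +ᵖ h) ≈ᵖ (f *ᵖ g) +ᵖ (f *ᵖ h)

  setoidᵖ : Setoid x x
  setoidᵖ = record
    { _≈_ = _≈ᵖ_
    ; isEquivalence = record { refl = ≈-refl ; sym = ≈-sym ; trans = ≈-trans }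
    }

  private
    module C = Consequences setoidᵖ

  ℤ[X] : CommutativeRing x x
  ℤ[X] = record
    { Carrier = Poly ; _≈_ = _≈ᵖ_ ; _+_ = _+ᵖ_ ; _*_ = _*ᵖ_ ; -_ = -ᵖ_ ; 0# = 0ᵖ ; 1# = 1ᵖ
    ; isCommutativeRing = record
      { isRing = record
        { +-isAbelianGroup = record
          { isGroup = record
            { isMonoid = record
              { isSemigroup = record
                { isMagma = record { isEquivalence = Setoid.isEquivalence setoidᵖ ; ∙-cong = +-cong }
                ; assoc = +-assoc
                }
              ; identity = C.comm∧idˡ⇒id +-comm +-idˡ
              }
            ; inverse = C.comm∧invˡ⇒inv +-comm -‿invˡ
            ; ⁻¹-cong = -‿cong
            }
          ; comm = +-comm
          }
        ; *-cong = *-cong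
        ; *-assoc = *-assoc
        ; *-identity = C.comm∧idˡ⇒id *-comm *-idˡ
        ; distrib = C.comm∧distrˡ⇒distr +-cong *-comm distˡ
        }
      ; *-comm = *-comm
      }
    }

module Quotient {c ℓ s : Level} (R : CommutativeRing c ℓ) (S : Pred (CommutativeRing.Carrier R) s) where
  open CommutativeRing R
  open RingProperties (CommutativeRing.ring R)
    using (-‿distribʳ-*; -‿distribˡ-*; -‿involutive; -‿+-comm)
  open SetoidReasoning (CommutativeRing.setoid R)

  data Ideal : Pred Carrier (c ⊔ ℓ ⊔ s) where
    gen  : ∀ {x} → S x → Ideal x
    0∈   : Ideal 0#
    +∈   : ∀ {x y} → Ideal x → Ideal y → Ideal (x + y)
    *∈   : ∀ r {x} → Ideal x → Ideal (r * x)
    resp : ∀ {x y} → x ≈ y → Ideal x → Ideal y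

  infix 4 _∼_
  _∼_ : Carrier → Carrier → Set (c ⊔ ℓ ⊔ s)
  x ∼ y = Ideal (x - y)

  private
    -∈ : ∀ {x} → Ideal x → Ideal (- x)
    -∈ {x} p = resp (trans (sym (-‿distribˡ-* 1# x)) (-‿cong (*-identityˡ x))) (*∈ (- 1#) p)

    +-interchange : ∀ a b d e → (a + b) + (d + e) ≈ (a + d) + (b + e)
    +-interchange a b d e = begin
      (a + b) + (d + e) ≈⟨ +-assoc a b (d + e) ⟩
      a + (b + (d + e)) ≈⟨ +-congˡ (+-assoc b d e) ⟨
      a + ((b + d) + e) ≈⟨ +-congˡ (+-congʳ (+-comm b d)) ⟩
      a + ((d + b) + e) ≈⟨ +-congˡ (+-assoc d b e) ⟩
      a + (d + (b + e)) ≈⟨ +-assoc a d (b + e) ⟨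
      (a + d) + (b + e) ∎

    telescope : ∀ a b d → (a - b) + (b - d) ≈ a - d
    telescope a b d = begin
      (a - b) + (b - d)     ≈⟨ +-assoc a (- b) (b - d) ⟩
      a + (- b + (b - d))   ≈⟨ +-congˡ (+-assoc (- b) b (- d)) ⟨
      a + ((- b + b) - d)   ≈⟨ +-congˡ (+-congʳ (-‿inverseˡ b)) ⟩
      a + (0# - d)          ≈⟨ +-congˡ (+-identityˡ (- d)) ⟩
      a - d                 ∎

    neg-diff : ∀ a b → - (a - b) ≈ - a - - b
    neg-diff a b = sym (-‿+-comm a (- b))

    neg-swap : ∀ a b → - (a - b) ≈ b - a
    neg-swap a b = begin
      - (a - b)  ≈⟨ neg-diff a b ⟩
      - a - - b  ≈⟨ +-congˡ (-‿involutive b) ⟩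
      - a + b    ≈⟨ +-comm (- a) b ⟩
      b - a      ∎

    lift : ∀ {x y} → x ≈ y → x ∼ y
    lift {x} {y} e = resp (sym (trans (+-congʳ e) (-‿inverseʳ y))) 0∈

    ∼-sym : ∀ {x y} → x ∼ y → y ∼ x
    ∼-sym {x} {y} p = resp (neg-swap x y) (-∈ p)

    ∼-trans : ∀ {x y z} → x ∼ y → y ∼ z → x ∼ z
    ∼-trans {x} {y} {z} p q = resp (telescope x y z) (+∈ p q)

    ∼-+-cong : ∀ {x x′ y y′} → x ∼ x′ → y ∼ y′ → (x + y) ∼ (x′ + y′)
    ∼-+-cong {x} {x′} {y} {y′} p q =
      resp (trans (+-interchange x (- x′) y (- y′)) (+-congˡ (-‿+-comm x′ y′))) (+∈ p q)

    *-diffˡ : ∀ r a b → r * (a - b) ≈ r * a - r * b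
    *-diffˡ r a b = trans (distribˡ r a (- b)) (+-congˡ (sym (-‿distribʳ-* r b)))

    ∼-*-congˡ : ∀ r {x y} → x ∼ y → (r * x) ∼ (r * y)
    ∼-*-congˡ r {x} {y} p = resp (*-diffˡ r x y) (*∈ r p)

    ∼-*-cong : ∀ {x x′ y y′} → x ∼ x′ → y ∼ y′ → (x * y) ∼ (x′ * y′)
    ∼-*-cong {x} {x′} {y} {y′} p q =
      ∼-trans (∼-*-congˡ x q)
        (∼-trans (lift (*-comm x y′)) (∼-trans (∼-*-congˡ y′ p) (lift (*-comm y′ x′))))

    ∼-neg-cong : ∀ {x y} → x ∼ y → (- x) ∼ (- y)
    ∼-neg-cong {x} {y} p = resp (neg-diff x y) (-∈ p)

  quotient : CommutativeRing c (c ⊔ ℓ ⊔ s)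
  quotient = record
    { Carrier = Carrier ; _≈_ = _∼_ ; _+_ = _+_ ; _*_ = _*_ ; -_ = -_ ; 0# = 0# ; 1# = 1#
    ; isCommutativeRing = record
      { isRing = record
        { +-isAbelianGroup = record
          { isGroup = record
            { isMonoid = record
              { isSemigroup = record
                { isMagma = record
                  { isEquivalence = record { refl = lift (CommutativeRing.refl R) ; sym = ∼-sym ; trans = ∼-trans }
                  ; ∙-cong = ∼-+-cong
                  }
                ; assoc = λ x y z → lift (+-assoc x y z)
                }
              ; identity = (λ x → lift (+-identityˡ x)) , (λ x → lift (+-identityʳ x))
              }
            ; inverse = (λ x → lift (-‿inverseˡ x)) , (λ x → lift (-‿inverseʳ x))
            ; ⁻¹-cong = ∼-neg-cong
            }
          ; comm = λ x y → lift (+-comm x y)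
          }
        ; *-cong = ∼-*-cong
        ; *-assoc = λ x y z → lift (*-assoc x y z)
        ; *-identity = (λ x → lift (*-identityˡ x)) , (λ x → lift (*-identityʳ x))
        ; distrib = (λ x y z → lift (distribˡ x y z)) , (λ x y z → lift (distribʳ x y z))
        }
      ; *-comm = λ x y → lift (*-comm x y)
      }
    }

------------------------------------------------------------------------
-- Matrices, the order ⪯ and cross ratios

module Matrices {c ℓ : Level} (R : CommutativeRing c ℓ) where
  open CommutativeRing R hiding (zero; refl)
  open Units R using (Unit)

  Matrix : ℕ → ℕ → Set c
  Matrix m n = Fin m → Fin n → Carrier

  infix 4 _≋_
  _≋_ : ∀ {m n} → Matrix m n → Matrix m n → Set ℓ
  A ≋ B = ∀ i j → A i j ≈ B i j

  scaleRow : ∀ {m n} → Fin m → Carrier → Matrix m n → Matrix m n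
  scaleRow x u A i j = if does (i ≟ x) then u * A i j else A i j

  scaleColumn : ∀ {m n} → Fin n → Carrier → Matrix m n → Matrix m n
  scaleColumn y u A i j = if does (j ≟ y) then u * A i j else A i j

  -- A^{xy}, where a is the inverse of A x y.  The labels x and y are exchanged
  -- by letting row position x stand for the new row y, and column position y
  -- for the new column x.
  pivot : ∀ {m n} → Matrix m n → Fin m → Fin n → Carrier → Matrix m n
  pivot A x y a i j =
    if does (i ≟ x)
    then (if does (j ≟ y) then a             else a * A x j)
    else (if does (j ≟ y) then - (a * A i y) else A i j - a * A i y * A x j)

  infix 4 _⪯_

  -- Selecting rows and columns along injections is the same as deleting and
  -- permuting them.
  data _⪯_ {m n : ℕ} : ∀ {m′ n′} → Matrix m′ n′ → Matrix m n → Set (c ⊔ ℓ) where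
    done     : ∀ {A B} → B ≋ A → B ⪯ A
    row      : ∀ {A m′ n′} {A′ B : Matrix m′ n′} → A′ ⪯ A →
               (x : Fin m′) (u : Carrier) → Unit u → B ≋ scaleRow x u A′ → B ⪯ A
    column   : ∀ {A m′ n′} {A′ B : Matrix m′ n′} → A′ ⪯ A →
               (y : Fin n′) (u : Carrier) → Unit u → B ≋ scaleColumn y u A′ → B ⪯ A
    select   : ∀ {A m′ n′ m″ n″} {A′ : Matrix m′ n′} {B : Matrix m″ n″} → A′ ⪯ A →
               (f : Fin m″ → Fin m′) (g : Fin n″ → Fin n′) →
               Injective _≡_ _≡_ f → Injective _≡_ _≡_ g →
               B ≋ (λ i j → A′ (f i) (g j)) → B ⪯ A
    pivoting : ∀ {A m′ n′} {A′ B : Matrix m′ n′} → A′ ⪯ A →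
               (x : Fin m′) (y : Fin n′) (a : Carrier) →
               ¬ (A′ x y ≈ 0#) → A′ x y * a ≈ 1# → B ≋ pivot A′ x y a → B ⪯ A

  -- The matrix with rows (1 , 1) and (p , 1).
  crossMatrix : Carrier → Matrix 2 2
  crossMatrix p (suc zero) zero = p
  crossMatrix p _          _    = 1#

  Cr : ∀ {m n} → Matrix m n → Pred Carrier (c ⊔ ℓ)
  Cr A p = crossMatrix p ⪯ A

  Cr-inverse : ∀ {m n} (A : Matrix m n) {p t} → Cr A p → p * t ≈ 1# → Cr A t
  Cr-inverse A {p} {t} p∈ pt =
    select (row p∈ (suc zero) t (p , pt , trans (*-comm t p) pt)
                (λ i j → CommutativeRing.refl R))
           (λ i → i) swap (λ e → e) swap-injective entries
    where
    swap : Fin 2 → Fin 2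
    swap zero       = suc zero
    swap (suc zero) = zero

    swap-injective : Injective _≡_ _≡_ swap
    swap-injective {zero}     {zero}     _ = refl
    swap-injective {suc zero} {suc zero} _ = refl
    swap-injective {zero}     {suc zero} ()
    swap-injective {suc zero} {zero}     ()

    entries : crossMatrix t ≋ (λ i j → scaleRow (suc zero) t (crossMatrix p) i (swap j))
    entries zero       zero       = CommutativeRing.refl R
    entries zero       (suc zero) = CommutativeRing.refl R
    entries (suc zero) zero       = sym (*-identityʳ t)
    entries (suc zero) (suc zero) = trans (sym pt) (*-comm p t)

------------------------------------------------------------------------
-- Matroids

record Matroid (n r : ℕ) : Set₁ where
  field
    IsBasis  : Pred (Subset n) 0ℓ
    isBasis? : Decidable IsBasis
    nonEmpty : ∃ IsBasis
    size     : ∀ {B} → IsBasis B → ∣ B ∣ ≡ r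
    exchange : ∀ {B₁ B₂} → IsBasis B₁ → IsBasis B₂ → ∀ {x} → x ∈ B₁ → x ∉ B₂ →
               ∃[ y ] y ∈ B₂ × y ∉ B₁ × IsBasis ((B₁ Subset.- x) ∪ ⁅ y ⁆)

  Independent : Pred (Subset n) 0ℓ
  Independent I = ∃[ B ] IsBasis B × I ⊆ B

entries : ∀ {n k} → Vec (Fin n) k → Subset n
entries []      = ⊥
entries (x ∷ Z) = ⁅ x ⁆ ∪ entries Z

inversions : ∀ {k} → Permutation′ k → ℕ
inversions {k} σ =
  length (filter (λ ij → (proj₁ ij <? proj₂ ij) ×-dec ((σ ⟨$⟩ʳ proj₂ ij) <? (σ ⟨$⟩ʳ proj₁ ij)))
                 (cartesianProduct (allFin k) (allFin k)))

------------------------------------------------------------------------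
-- The universal partial field

module Universal {n r : ℕ} (M : Matroid n r) where
  open Matroid M

  -- The basis proof is irrelevant, so there is one symbol bar Z for each Z.
  data Symbol : Set where
    bracket : Vec (Fin n) r → Symbol
    bar     : (Z : Vec (Fin n) r) → .(IsBasis (entries Z)) → Symbol

  open Polynomial Symbol public using (var; ℤ[X])

  private
    module Z = CommutativeRing ℤ[X]

  [_] : Vec (Fin n) r → Z.Carrier
  [ Z ] = var (bracket Z)

  sgn : Permutation′ r → Z.Carrier
  sgn σ = SemiringExp._^_ Z.semiring (Z.- Z.1#) (inversions σ)

  permute : Permutation′ r → Vec (Fin n) r → Vec (Fin n) r
  permute σ Z = tabulate (λ i → Vec.lookup Z (σ ⟨$⟩ʳ i))

  data Generator : Pred Z.Carrier 0ℓ where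
    nonBasis  : ∀ Z → ¬ IsBasis (entries Z) → Generator [ Z ]
    alternate : ∀ Z σ → Generator ([ Z ] Z.- sgn σ Z.* [ permute σ Z ])
    plücker   : ∀ {k} (eq : suc (suc k) ≡ r) x₁ x₂ y₁ y₂ (W : Vec (Fin n) k) →
                let ⟦_,_⟧ = λ x y → [ cast eq (x ∷ y ∷ W) ] in
                Generator (⟦ x₁ , x₂ ⟧ Z.* ⟦ y₁ , y₂ ⟧
                           Z.- ⟦ y₁ , x₂ ⟧ Z.* ⟦ x₁ , y₂ ⟧
                           Z.- ⟦ y₂ , x₂ ⟧ Z.* ⟦ y₁ , x₁ ⟧)
    inverse   : ∀ Z (b : IsBasis (entries Z)) →
                Generator ([ Z ] Z.* var (bar Z b) Z.- Z.1#)

  𝔹 : CommutativeRing 0ℓ 0ℓ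
  𝔹 = Quotient.quotient ℤ[X] Generator

  private
    module 𝔹 = CommutativeRing 𝔹

  open Matrices 𝔹 public using (Matrix; _⪯_; Cr; Cr-inverse)

  module _ (B : Vec (Fin n) r) (b : IsBasis (entries B)) where

    -- E ∖ {B}, in increasing order.
    nonbasic : List (Fin n)
    nonbasic = filter (λ v → ¬? (v ∈? entries B)) (allFin n)

    -- Row i is labelled by the i-th entry of B, which the column label replaces.
    representation : Matrix r (length nonbasic)
    representation i j = [ B [ i ]≔ lookup nonbasic j ] 𝔹.* var (bar B b)

    CrossRatio : Pred 𝔹.Carrier 0ℓ
    CrossRatio = Cr representation

    CrossRatioOr-1 : Pred 𝔹.Carrier 0ℓ
    CrossRatioOr-1 p = CrossRatio p ⊎ p 𝔹.≈ 𝔹.- 𝔹.1#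

    private
      module R = Generated 𝔹 CrossRatio
      module G = Generated 𝔹 CrossRatioOr-1
      open Units 𝔹 using (*-inverses; -1*-1≈1)

      Invertibleᴳ : Pred 𝔹.Carrier 0ℓ
      Invertibleᴳ x = ∃[ y ] R.ℤ[_] y × G.⟨_⟩ y × x 𝔹.* y 𝔹.≈ 𝔹.1#

      group : ∀ {x} → G.⟨_⟩ x → R.ℤ[_] x × Invertibleᴳ x
      group g@(G.gen (inj₁ p∈) (t , _ , pt)) =
        R.gen p∈ , t , R.gen (Cr-inverse representation p∈ pt) , G.inv∈ g pt , pt
      group g@(G.gen {x} (inj₂ x≈-1) _) =
        x∈R , x , x∈R , g , 𝔹.trans (𝔹.*-cong x≈-1 x≈-1) -1*-1≈1
        where x∈R = R.resp (𝔹.sym x≈-1) (R.-∈ R.1∈)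
      group G.1∈ = R.1∈ , 𝔹.1# , R.1∈ , G.1∈ , 𝔹.*-identityˡ 𝔹.1#
      group (G.*∈ g h) with group g | group h
      ... | x∈ , x′ , x′∈ , g′ , e | y∈ , y′ , y′∈ , h′ , f =
        R.*∈ x∈ y∈ , x′ 𝔹.* y′ , R.*∈ x′∈ y′∈ , G.*∈ g′ h′ , *-inverses e f
      group (G.inv∈ {x} {y} g xy) with group g
      ... | x∈ , x′ , x′∈ , _ , xx′ = R.resp x′≈y x′∈ , x , x∈ , g , 𝔹.trans (𝔹.*-comm y x) xy
        where
        x′≈y : x′ 𝔹.≈ y
        x′≈y = begin
          x′                ≈⟨ 𝔹.*-identityʳ x′ ⟨
          x′ 𝔹.* 𝔹.1#       ≈⟨ 𝔹.*-congˡ xy ⟨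
          x′ 𝔹.* (x 𝔹.* y)  ≈⟨ 𝔹.*-assoc x′ x y ⟨
          (x′ 𝔹.* x) 𝔹.* y  ≈⟨ 𝔹.*-congʳ (𝔹.trans (𝔹.*-comm x′ x) xx′) ⟩
          𝔹.1# 𝔹.* y        ≈⟨ 𝔹.*-identityˡ y ⟩
          y                 ∎
          where open SetoidReasoning 𝔹.setoid
      group (G.resp e g) with group g
      ... | x∈ , x′ , x′∈ , g′ , f = R.resp e x∈ , x′ , x′∈ , g′ , 𝔹.trans (𝔹.*-congʳ (𝔹.sym e)) f

    universalPartialField : PartialField 0ℓ 0ℓ 0ℓ
    universalPartialField = record
      { ring   = R.subring
      ; G      = λ x → G.⟨_⟩ (proj₁ x)
      ; G-resp = G.resp
      ; 1∈G    = G.1∈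
      ; G-*    = G.*∈
      ; G-inv  = λ g → let (_ , y , y∈ , g′ , e) = group g in (y , y∈) , g′ , e
      ; -1∈G   = G.gen (inj₂ 𝔹.refl) (𝔹.- 𝔹.1# , -1*-1≈1 , -1*-1≈1)
      }

------------------------------------------------------------------------
-- Finite fields, PG(2,F) and its restrictions

IsPrimePower : ℕ → Set
IsPrimePower q = ∃[ p ] ∃[ k ] Prime p × NonZero k × q ≡ p ^ k

module _ {c ℓ₁ ℓ₂ : Level} (F : HeytingField c ℓ₁ ℓ₂) where

  fieldRing : CommutativeRing c ℓ₁
  fieldRing = record { isCommutativeRing = HeytingField.isCommutativeRing F }

  HasOrder : ℕ → Set (c ⊔ ℓ₁)
  HasOrder q = Inverse (CommutativeRing.setoid fieldRing) (setoid (Fin q))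

  fieldPartialField : PartialField c ℓ₁ (c ⊔ ℓ₁)
  fieldPartialField = unitsPartialField fieldRing

module ProjectivePlane {c ℓ₁ ℓ₂ : Level} (F : HeytingField c ℓ₁ ℓ₂) where
  open HeytingField F using (Carrier; _≈_; _*_; 0#)
  open SemiringSum (CommutativeRing.semiring (fieldRing F)) using (sum)

  record HomogeneousCoordinates : Set (c ⊔ ℓ₁) where
    field
      coord   : Vector Carrier 3
      nonzero : ¬ (∀ k → coord k ≈ 0#)

  open HomogeneousCoordinates public

  Point : Set (c ⊔ ℓ₁)
  Point = HomogeneousCoordinates

  -- ℓ is the line with equation ℓ₀x₀ + ℓ₁x₁ + ℓ₂x₂ = 0.
  Line : Set (c ⊔ ℓ₁)
  Line = HomogeneousCoordinates

  infix 4 _≈ₚ_ _on_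

  _≈ₚ_ : Point → Point → Set (c ⊔ ℓ₁)
  p ≈ₚ p′ = ∃[ a ] ¬ (a ≈ 0#) × (∀ k → coord p k ≈ a * coord p′ k)

  _on_ : Point → Line → Set ℓ₁
  p on L = sum (λ k → coord L k * coord p k) ≈ 0#

  SameLine : Line → Line → Set (c ⊔ ℓ₁)
  SameLine L L′ = ∀ p → p on L ⇔ p on L′

  LinearlyIndependent : ∀ {n} → (Fin n → Point) → Subset n → Set (c ⊔ ℓ₁)
  LinearlyIndependent {n} v S =
    (a : Vector Carrier n) → (∀ i → i ∉ S → a i ≈ 0#) →
    (∀ k → sum (λ i → a i * coord (v i) k) ≈ 0#) → ∀ i → a i ≈ 0#

  -- M is the restriction of PG(2,F) to the points satisfying P, its ground set
  -- being numbered by `point`.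
  record IsRestriction {n r : ℕ} {s : Level} (M : Matroid n r) (P : Pred Point s)
                       : Set (c ⊔ ℓ₁ ⊔ s) where
    field
      point       : Fin n → Point
      injective   : ∀ {i j} → point i ≈ₚ point j → i ≡ j
      member      : ∀ i → P (point i)
      exhaustive  : ∀ p → P p → ∃[ i ] point i ≈ₚ p
      independent : ∀ S → Matroid.Independent M S ⇔ LinearlyIndependent point S

  OnQ : Line → Line → Line → Pred Point ℓ₁
  OnQ L₁ L₂ L₃ p = p on L₁ ⊎ p on L₂ ⊎ p on L₃

  record IsQ⁺ {n r : ℕ} (M : Matroid n r) : Set (c ⊔ ℓ₁) where
    field
      L₁ L₂ L₃      : Line
      L₁≢L₂         : ¬ SameLine L₁ L₂
      L₁≢L₃         : ¬ SameLine L₁ L₃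
      L₂≢L₃         : ¬ SameLine L₂ L₃
      nonConcurrent : ∀ p → ¬ (p on L₁ × p on L₂ × p on L₃)
      e             : Point
      e∉            : ¬ OnQ L₁ L₂ L₃ e
      restriction   : IsRestriction M (λ p → OnQ L₁ L₂ L₃ p ⊎ p ≈ₚ e)

{-# OPTIONS --safe #-}

-- The brackets [x,y,z] of 𝔹 and the determinants of the coordinates over F = GF(q) satisfy the same
-- three-term Plücker relations, and a bracket is 0 or a unit according to whether the determinant is 0.
-- So, with the vertices a, b, c of the triangle L₁L₂L₃ and e as a projective frame, the elements get
-- homogeneous coordinates over 𝔹 as well, whose determinants are the brackets up to a unit.  Let α(t), β(t), γ(t)
-- be the coordinates over 𝔹 of the elements (1,t,0), (0,1,t), (t,0,1) of the sides.  Collinearities give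
-- α(s)β(t)γ(u) = −1 if stu = −1 (Menelaus), α(s)β(t) = β(t) − 1 if st = t − 1 (a line through e), and
-- α(1) = β(1) = γ(1) = 1; hence α = β = γ =: θ is a ring homomorphism F → 𝔹, and
-- [x,y,z] = k s(x) s(y) s(z) θ(det(x,y,z)) for units k and s(x).  Thus A_{M,B} arises from the image under θ of a
-- matrix over F by scaling, a property inherited along ⪯, and all cross ratios lie in θ(F).  Conversely every line
-- through a point of B contains another element, so each θ(t) with t ≠ 0, 1 is the cross ratio of a 2 × 2
-- submatrix of A_{M,B}.  The inverse of θ is the evaluation of brackets as determinants.
module Submission where

open import Defs
open import Algebra.Apartness.Bundles using (HeytingField)
open import Algebra.Bundles using (CommutativeRing)
import Algebra.Properties.Ring as RingProperties
import Algebra.Properties.Semiring.Exp as SemiringExp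
import Algebra.Properties.Semiring.Mult.TCOptimised as SemiringMult
import Algebra.Properties.Semiring.Sum as SemiringSum
import Algebra.Solver.Ring as RingSolver
open import Algebra.Solver.Ring.AlmostCommutativeRing using (_-Raw-AlmostCommutative⟶_; fromCommutativeRing)
open import Data.Bool.Base using (if_then_else_; true; false)
open import Data.Fin.Base as Fin using (Fin; zero; suc)
open import Data.Fin.Patterns using (0F; 1F; 2F)
open import Data.Fin.Permutation using (Permutation′; _⟨$⟩ʳ_; _⟨$⟩ˡ_; inverseˡ; transpose)
open import Data.Fin.Properties using (_≟_; _<?_; any?; punchInᵢ≢i)
open import Data.Fin.Subset using (Subset; inside; outside; _∈_; _∉_; _⊆_; _∪_; ⁅_⁆; ∣_∣; ⊥)
open import Data.Fin.Subset.Properties using (_∈?_; x∈⁅x⁆; x∈⁅y⁆⇒x≡y; x∈p∪q⁻; x∈p∪q⁺; p⊂q⇒∣p∣<∣q∣; ⊆-antisym; ⊆-refl; ∪-identityˡ; ∣⊥∣≡0; ∉⊥)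
open import Data.Integer.Base as ℤ using (ℤ; +_; -[1+_]; _⊖_)
import Data.Integer.Properties as ℤ
open import Data.List.Base as List using (length; filter; cartesianProduct; allFin)
open import Data.List.Membership.Propositional.Properties using (∈-filter⁺; ∈-allFin)
open import Data.List.Properties using (filter-≐)
import Data.List.Relation.Unary.Any as Any
open import Data.List.Relation.Unary.Any.Properties using (lookup-index)
open import Data.Maybe.Base using (Maybe; just; nothing)
open import Data.Nat.Base as ℕ using (ℕ; zero; suc; _≤_; s≤s)
import Data.Nat.Properties as ℕₚ
open import Data.Product.Base using (∃-syntax; _×_; _,_; proj₁; proj₂)
open import Data.Sum.Base using (_⊎_; inj₁; inj₂; [_,_]′)
open import Data.Vec.Base as Vec using (Vec; []; _∷_; here; there)
open import Data.Vec.Functional using (Vector; removeAt) renaming (_∷_ to _∷ᶠ_; [] to []ᶠ)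
open import Function.Base using (_∘_; id)
open import Function.Bundles using (Inverse; Equivalence; _⇔_; mk⇔)
open import Function.Definitions using (Injective)
open import Level using (Level; _⊔_)
open import Relation.Binary.Definitions using (Decidable)
open import Relation.Binary.PropositionalEquality as ≡ using (_≡_; _≢_)
import Relation.Binary.Reasoning.Setoid as SetoidReasoning
open import Relation.Nullary.Decidable as Dec using (Dec; yes; no; does; dec-true; dec-false; ¬?; _×-dec_)
open import Relation.Nullary.Negation using (¬_; contradiction)

-- Ring solver with integer coefficients

-- Nothing excludes zero divisors in 𝔹 beforehand, so equations over it can be divided only by
-- units, and these are supplied by the invertible brackets of the bases. Every geometric fact is
-- therefore phrased as the vanishing of a determinant over F and transferred to 𝔹, where the
-- determinant is factored into units and one difference. For the same reason the expansion of a
-- bracket as a determinant follows from the Plücker relations only up to a coordinate of its last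
-- element as a factor, and an invertible coordinate has to be selected. The sides alone relate the
-- ratios only multiplicatively. The point e brings in addition: the lines through it give α(t - 1)
-- = α(t) - 1, and general sums are reduced to this by multiplication. Additivity of θ then forces
-- the characteristic of F on 𝔹. That evaluation inverts θ is not computed from the construction of
-- θ but read off from a cross ratio identity in A_{M,B}. Evaluation also shows that 𝔹 is
-- nontrivial, which the treatment of pivots requires.

module IntegerSolver {c ℓ} (R : CommutativeRing c ℓ) where
  open CommutativeRing R
  open RingProperties ring
  open SemiringMult semiring using (×-homo-+; ×1-homo-*; 1+×) renaming (_×_ to _·_)
  open SetoidReasoning setoid

  -- The optimised multiple makes `fromℕ 1` equal to `1#` by computation, so `con (+ 1)` stands for
  -- `1#` itself in the equations to be solved.
  fromℕ : ℕ → Carrier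
  fromℕ n = n · 1#

  fromℤ : ℤ → Carrier
  fromℤ (+ n)    = fromℕ n
  fromℤ -[1+ n ] = - fromℕ (suc n)

  fromℤ-⊖ : ∀ m n → fromℤ (m ⊖ n) ≈ fromℕ m - fromℕ n
  fromℤ-⊖ m       zero    = begin
    fromℕ m       ≈⟨ +-identityʳ _ ⟨
    fromℕ m + 0#  ≈⟨ +-congˡ -0#≈0# ⟨
    fromℕ m - 0#  ∎
  fromℤ-⊖ zero    (suc n) = sym (+-identityˡ _)
  fromℤ-⊖ (suc m) (suc n) = begin
    fromℤ (suc m ⊖ suc n)                   ≡⟨ ≡.cong fromℤ (ℤ.[1+m]⊖[1+n]≡m⊖n m n) ⟩
    fromℤ (m ⊖ n)                           ≈⟨ fromℤ-⊖ m n ⟩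
    fromℕ m - fromℕ n                       ≈⟨ +-congʳ (+-identityʳ _) ⟨
    -- Inserting 1# - 1# supplies the successors that `⊖` has removed from both arguments.
    (fromℕ m + 0#) - fromℕ n                ≈⟨ +-congʳ (+-congˡ (-‿inverseʳ 1#)) ⟨
    (fromℕ m + (1# - 1#)) - fromℕ n         ≈⟨ +-congʳ (+-assoc _ _ _) ⟨
    ((fromℕ m + 1#) - 1#) - fromℕ n         ≈⟨ +-assoc _ _ _ ⟩
    (fromℕ m + 1#) + (- 1# - fromℕ n)       ≈⟨ +-cong (+-comm _ _) (-‿+-comm _ _) ⟩
    (1# + fromℕ m) - (1# + fromℕ n)         ≈⟨ +-cong (1+× m 1#) (-‿cong (1+× n 1#)) ⟨
    fromℕ (suc m) - fromℕ (suc n)           ∎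

  fromℤ-neg : ∀ i → fromℤ (ℤ.- i) ≈ - fromℤ i
  fromℤ-neg (+ zero)  = sym -0#≈0#
  fromℤ-neg (+ suc n) = refl
  fromℤ-neg -[1+ n ]  = sym (-‿involutive _)

  fromℤ-+ : ∀ i j → fromℤ (i ℤ.+ j) ≈ fromℤ i + fromℤ j
  fromℤ-+ (+ m)    (+ n)    = ×-homo-+ 1# m n
  fromℤ-+ (+ m)    -[1+ n ] = fromℤ-⊖ m (suc n)
  fromℤ-+ -[1+ m ] (+ n)    = trans (fromℤ-⊖ n (suc m)) (+-comm _ _)
  fromℤ-+ -[1+ m ] -[1+ n ] = begin
    - fromℕ (suc (suc (m ℕ.+ n)))      ≡⟨ ≡.cong (λ k → - fromℕ (suc k)) (ℕₚ.+-suc m n) ⟨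
    - fromℕ (suc m ℕ.+ suc n)          ≈⟨ -‿cong (×-homo-+ 1# (suc m) (suc n)) ⟩
    - (fromℕ (suc m) + fromℕ (suc n))  ≈⟨ -‿+-comm _ _ ⟨
    - fromℕ (suc m) - fromℕ (suc n)    ∎

  fromℤ-+* : ∀ m j → fromℤ (+ m ℤ.* j) ≈ fromℕ m * fromℤ j
  fromℤ-+* m (+ n)    = trans (reflexive (≡.cong fromℤ (≡.sym (ℤ.pos-* m n)))) (×1-homo-* m n)
  fromℤ-+* m -[1+ n ] = begin
    fromℤ (+ m ℤ.* -[1+ n ])         ≡⟨ ≡.cong fromℤ (ℤ.neg-distribʳ-* (+ m) (+ suc n)) ⟨
    fromℤ (ℤ.- (+ m ℤ.* + suc n))    ≈⟨ fromℤ-neg (+ m ℤ.* + suc n) ⟩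
    - fromℤ (+ m ℤ.* + suc n)        ≈⟨ -‿cong (fromℤ-+* m (+ suc n)) ⟩
    - (fromℕ m * fromℕ (suc n))      ≈⟨ -‿distribʳ-* _ _ ⟩
    fromℕ m * - fromℕ (suc n)        ∎

  fromℤ-* : ∀ i j → fromℤ (i ℤ.* j) ≈ fromℤ i * fromℤ j
  fromℤ-* (+ m)    j = fromℤ-+* m j
  fromℤ-* -[1+ m ] j = begin
    fromℤ (-[1+ m ] ℤ.* j)           ≡⟨ ≡.cong fromℤ (ℤ.neg-distribˡ-* (+ suc m) j) ⟨
    fromℤ (ℤ.- (+ suc m ℤ.* j))      ≈⟨ fromℤ-neg (+ suc m ℤ.* j) ⟩
    - fromℤ (+ suc m ℤ.* j)          ≈⟨ -‿cong (fromℤ-+* (suc m) j) ⟩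
    - (fromℕ (suc m) * fromℤ j)      ≈⟨ -‿distribˡ-* _ _ ⟩
    - fromℕ (suc m) * fromℤ j        ∎

  morphism : ℤ.+-*-rawRing -Raw-AlmostCommutative⟶ fromCommutativeRing R
  morphism = record
    { ⟦_⟧    = fromℤ
    ; +-homo = fromℤ-+
    ; *-homo = fromℤ-*
    ; -‿homo = fromℤ-neg
    ; 0-homo = refl
    ; 1-homo = refl
    }

  -- Unequal integers may still agree in R, whose characteristic can be positive; `nothing` merely
  -- leaves their equality undecided.
  coefficient≟ : ∀ i j → Maybe (fromℤ i ≈ fromℤ j)
  coefficient≟ i j with i ℤ.≟ j
  ... | yes i≡j = just (reflexive (≡.cong fromℤ i≡j))
  ... | no  _   = nothing

  open RingSolver ℤ.+-*-rawRing (fromCommutativeRing R) morphism coefficient≟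
    public using (Polynomial; solve; _:=_; _:+_; _:*_; :-_; _:-_; con)

-- Determinants and brackets

module Determinant {c ℓ} (R : CommutativeRing c ℓ) where
  open CommutativeRing R
  open IntegerSolver R

  det : (u v w : Vector Carrier 3) → Carrier
  det u v w = u 0F * (v 1F * w 2F - v 2F * w 1F)
            - u 1F * (v 0F * w 2F - v 2F * w 0F)
            + u 2F * (v 0F * w 1F - v 1F * w 0F)

  detₚ : ∀ {n} (u₀ u₁ u₂ v₀ v₁ v₂ w₀ w₁ w₂ : Polynomial n) → Polynomial n
  detₚ u₀ u₁ u₂ v₀ v₁ v₂ w₀ w₁ w₂ =
    u₀ :* (v₁ :* w₂ :- v₂ :* w₁) :- u₁ :* (v₀ :* w₂ :- v₂ :* w₀) :+ u₂ :* (v₀ :* w₁ :- v₁ :* w₀)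

  det-cong : ∀ {u u′ v v′ w w′} → (∀ k → u k ≈ u′ k) → (∀ k → v k ≈ v′ k) → (∀ k → w k ≈ w′ k) →
             det u v w ≈ det u′ v′ w′
  det-cong p q r =
    +-cong (+-cong (*-cong (p 0F) (+-cong (*-cong (q 1F) (r 2F)) (-‿cong (*-cong (q 2F) (r 1F)))))
                   (-‿cong (*-cong (p 1F) (+-cong (*-cong (q 0F) (r 2F)) (-‿cong (*-cong (q 2F) (r 0F)))))))
           (*-cong (p 2F) (+-cong (*-cong (q 0F) (r 1F)) (-‿cong (*-cong (q 1F) (r 0F)))))

  HasInverse : Carrier → Set (c ⊔ ℓ)
  HasInverse x = ∃[ y ] x * y ≈ 1#

  -- The substitute for cancellation in an integral domain, as R may have zero divisors.
  *-cancelˡ-inverse : ∀ {u x y} → HasInverse u → u * x ≈ u * y → x ≈ y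
  *-cancelˡ-inverse {u} {x} {y} (t , ut) e = begin
    x            ≈⟨ *-identityˡ x ⟨
    1# * x       ≈⟨ *-congʳ ut ⟨
    (u * t) * x  ≈⟨ solve 3 (λ u t x → (u :* t) :* x := t :* (u :* x)) refl u t x ⟩
    t * (u * x)  ≈⟨ *-congˡ e ⟩
    t * (u * y)  ≈⟨ solve 3 (λ u t x → (u :* t) :* x := t :* (u :* x)) refl u t y ⟨
    (u * t) * y  ≈⟨ *-congʳ ut ⟩
    1# * y       ≈⟨ *-identityˡ y ⟩
    y            ∎
    where open SetoidReasoning setoid

  HasInverse-resp : ∀ {x y} → x ≈ y → HasInverse x → HasInverse y
  HasInverse-resp e (t , xt) = t , trans (*-congʳ (sym e)) xt

  HasInverse-* : ∀ {x y} → HasInverse x → HasInverse y → HasInverse (x * y)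
  HasInverse-* {x} {y} (s , xs) (t , yt) = s * t , (begin
    (x * y) * (s * t)  ≈⟨ solve 4 (λ x y s t → (x :* y) :* (s :* t) := (x :* s) :* (y :* t)) refl x y s t ⟩
    (x * s) * (y * t)  ≈⟨ *-cong xs yt ⟩
    1# * 1#            ≈⟨ *-identityˡ 1# ⟩
    1#                 ∎)
    where open SetoidReasoning setoid

  HasInverse-sym : ∀ {x y} → x * y ≈ 1# → HasInverse y
  HasInverse-sym {x} {y} xy = x , trans (*-comm y x) xy

-- Common interface of the determinants over F and the symbols of 𝔹, so that expansion in a frame is
-- proved once for both. The swaps alone give only 2⟦x,x,y⟧ = 0, which says nothing in
-- characteristic 2; the vanishing itself is a field of `Configuration`.
record Brackets {c ℓ} (R : CommutativeRing c ℓ) (E : Set) : Set (c ⊔ ℓ) where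
  open CommutativeRing R
  field
    ⟦_,_,_⟧ : E → E → E → Carrier
    swap₁₂  : ∀ x y z → ⟦ y , x , z ⟧ ≈ - ⟦ x , y , z ⟧
    swap₂₃  : ∀ x y z → ⟦ x , z , y ⟧ ≈ - ⟦ x , y , z ⟧
    plücker : ∀ x₁ x₂ y₁ y₂ w →
              ⟦ x₁ , x₂ , w ⟧ * ⟦ y₁ , y₂ , w ⟧ ≈
              ⟦ y₁ , x₂ , w ⟧ * ⟦ x₁ , y₂ , w ⟧ + ⟦ y₂ , x₂ , w ⟧ * ⟦ y₁ , x₁ , w ⟧

module BracketExpansion {c ℓ} {R : CommutativeRing c ℓ} {E : Set} (brackets : Brackets R E) where
  open CommutativeRing R
  open Brackets brackets
  open IntegerSolver R
  open Determinant R
  open SetoidReasoning setoid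

  cycle : ∀ x y z → ⟦ y , z , x ⟧ ≈ ⟦ x , y , z ⟧
  cycle x y z = begin
    ⟦ y , z , x ⟧      ≈⟨ swap₂₃ y x z ⟩
    - ⟦ y , x , z ⟧    ≈⟨ -‿cong (swap₁₂ x y z) ⟩
    - - ⟦ x , y , z ⟧  ≈⟨ solve 1 (λ x → :- (:- x) := x) refl _ ⟩
    ⟦ x , y , z ⟧      ∎

  -- Cramer's numerators: ⟦a,b,c⟧ times the coordinates of x in the basis a, b, c.
  coordinates : (a b c x : E) → Vector Carrier 3
  coordinates a b c x 0F = ⟦ x , b , c ⟧
  coordinates a b c x 1F = ⟦ a , x , c ⟧
  coordinates a b c x 2F = ⟦ a , b , x ⟧

  -- With c fixed in all brackets, the Plücker relation is the expansion of a 2 by 2 determinant in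
  -- the basis a, b.
  minor : ∀ a b c x y → ⟦ x , y , c ⟧ * ⟦ a , b , c ⟧ ≈
          ⟦ x , b , c ⟧ * ⟦ a , y , c ⟧ - ⟦ a , x , c ⟧ * ⟦ y , b , c ⟧
  minor a b c x y = begin
    ⟦ x , y , c ⟧ * ⟦ a , b , c ⟧                                      ≈⟨ plücker x y a b c ⟩
    ⟦ a , y , c ⟧ * ⟦ x , b , c ⟧ + ⟦ b , y , c ⟧ * ⟦ a , x , c ⟧      ≈⟨ +-congˡ (*-congʳ (swap₁₂ y b c)) ⟩
    ⟦ a , y , c ⟧ * ⟦ x , b , c ⟧ + - ⟦ y , b , c ⟧ * ⟦ a , x , c ⟧    ≈⟨ solve 4 (λ p q r s → p :* q :+ :- r :* s := q :* p :- s :* r) refl _ _ _ _ ⟩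
    ⟦ x , b , c ⟧ * ⟦ a , y , c ⟧ - ⟦ a , x , c ⟧ * ⟦ y , b , c ⟧      ∎

  module _ (a b c : E) where
    private
      D = ⟦ a , b , c ⟧
      ξ = coordinates a b c

    minor-a : ∀ x y → ⟦ x , y , a ⟧ * D ≈ ξ x 1F * ξ y 2F - ξ x 2F * ξ y 1F
    minor-a x y = begin
      ⟦ x , y , a ⟧ * D                ≈⟨ *-congˡ (cycle a b c) ⟨
      ⟦ x , y , a ⟧ * ⟦ b , c , a ⟧    ≈⟨ minor b c a x y ⟩
      ⟦ x , c , a ⟧ * ⟦ b , y , a ⟧ - ⟦ b , x , a ⟧ * ⟦ y , c , a ⟧
        ≈⟨ +-cong (*-cong (cycle a x c) (cycle a b y)) (-‿cong (*-cong (cycle a b x) (cycle a y c))) ⟩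
      ξ x 1F * ξ y 2F - ξ x 2F * ξ y 1F  ∎

    minor-b : ∀ x y → ⟦ x , y , b ⟧ * D ≈ ξ x 2F * ξ y 0F - ξ x 0F * ξ y 2F
    minor-b x y = begin
      ⟦ x , y , b ⟧ * D                ≈⟨ *-congˡ (cycle c a b) ⟩
      ⟦ x , y , b ⟧ * ⟦ c , a , b ⟧    ≈⟨ minor c a b x y ⟩
      ⟦ x , a , b ⟧ * ⟦ c , y , b ⟧ - ⟦ c , x , b ⟧ * ⟦ y , a , b ⟧
        ≈⟨ +-cong (*-cong (sym (cycle x a b)) (sym (cycle c y b)))
                  (-‿cong (*-cong (sym (cycle c x b)) (sym (cycle y a b)))) ⟩
      ξ x 2F * ξ y 0F - ξ x 0F * ξ y 2F  ∎

    -- The aim is det (ξ x) (ξ y) (ξ z) = D²⟦x,y,z⟧. The Plücker relation on x, y, a, b, z rewrites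
    -- ⟦x,y,z⟧⟦a,b,z⟧ by brackets that contain a or b, and each of these times D is a 2 by 2 minor
    -- of coordinates. The factor ⟦a,b,z⟧ = ξ z 2F stays, since it need not be cancellable.
    expansion₂ : ∀ x y z → ξ z 2F * (D * D * ⟦ x , y , z ⟧) ≈ ξ z 2F * det (ξ x) (ξ y) (ξ z)
    expansion₂ x y z = begin
      z₂ * (D * D * ⟦ x , y , z ⟧)
        ≈⟨ solve 3 (λ z d b → z :* (d :* d :* b) := d :* d :* (b :* z)) refl _ _ _ ⟩
      D * D * (⟦ x , y , z ⟧ * z₂)
        ≈⟨ *-congˡ (plücker x y a b z) ⟩
      D * D * (⟦ a , y , z ⟧ * ⟦ x , b , z ⟧ + ⟦ b , y , z ⟧ * ⟦ a , x , z ⟧)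
        ≈⟨ *-congˡ (+-cong (*-cong (sym (cycle a y z)) (swap₂₃ x z b))
                           (*-cong (sym (cycle b y z)) (sym (cycle a x z)))) ⟩
      D * D * (⟦ y , z , a ⟧ * - ⟦ x , z , b ⟧ + ⟦ y , z , b ⟧ * ⟦ x , z , a ⟧)
        ≈⟨ solve 5 (λ d p q r s → d :* d :* (p :* (:- q) :+ r :* s) :=
                      (p :* d) :* (:- (q :* d)) :+ (r :* d) :* (s :* d)) refl _ _ _ _ _ ⟩
      (⟦ y , z , a ⟧ * D) * - (⟦ x , z , b ⟧ * D) + (⟦ y , z , b ⟧ * D) * (⟦ x , z , a ⟧ * D)
        ≈⟨ +-cong (*-cong (minor-a y z) (-‿cong (minor-b x z))) (*-cong (minor-b y z) (minor-a x z)) ⟩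
      (y₁ * z₂ - y₂ * z₁) * - (x₂ * z₀ - x₀ * z₂) + (y₂ * z₀ - y₀ * z₂) * (x₁ * z₂ - x₂ * z₁)
        ≈⟨ solve 9 (λ x₀ x₁ x₂ y₀ y₁ y₂ z₀ z₁ z₂ →
             (y₁ :* z₂ :- y₂ :* z₁) :* (:- (x₂ :* z₀ :- x₀ :* z₂))
               :+ (y₂ :* z₀ :- y₀ :* z₂) :* (x₁ :* z₂ :- x₂ :* z₁)
             := z₂ :* detₚ x₀ x₁ x₂ y₀ y₁ y₂ z₀ z₁ z₂) refl x₀ x₁ x₂ y₀ y₁ y₂ z₀ z₁ z₂ ⟩
      z₂ * det (ξ x) (ξ y) (ξ z) ∎
      where
      x₀ = ξ x 0F
      x₁ = ξ x 1F
      x₂ = ξ x 2F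
      y₀ = ξ y 0F
      y₁ = ξ y 1F
      y₂ = ξ y 2F
      z₀ = ξ z 0F
      z₁ = ξ z 1F
      z₂ = ξ z 2F

  module _ (a b c : E) where
    private
      D = ⟦ a , b , c ⟧
      ξ = coordinates a b c
      bca = coordinates b c a

      rotated : ∀ x y z → det (bca x) (bca y) (bca z) ≈ det (ξ x) (ξ y) (ξ z)
      rotated x y z = trans (det-cong (turn x) (turn y) (turn z))
        (solve 9 (λ x₀ x₁ x₂ y₀ y₁ y₂ z₀ z₁ z₂ →
            detₚ x₁ x₂ x₀ y₁ y₂ y₀ z₁ z₂ z₀ := detₚ x₀ x₁ x₂ y₀ y₁ y₂ z₀ z₁ z₂)
          refl _ _ _ _ _ _ _ _ _)
        where
        ξ′ : E → Vector Carrier 3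
        ξ′ x 0F = ξ x 1F
        ξ′ x 1F = ξ x 2F
        ξ′ x 2F = ξ x 0F

        turn : ∀ x k → bca x k ≈ ξ′ x k
        turn x 0F = cycle a x c
        turn x 1F = cycle a b x
        turn x 2F = cycle x b c

    expansion-rotate : ∀ x y z {u v} → u ≈ v →
      u * (⟦ b , c , a ⟧ * ⟦ b , c , a ⟧ * ⟦ x , y , z ⟧) ≈ u * det (bca x) (bca y) (bca z) →
      v * (D * D * ⟦ x , y , z ⟧) ≈ v * det (ξ x) (ξ y) (ξ z)
    expansion-rotate x y z {u} {v} e rot = begin
      v * (D * D * ⟦ x , y , z ⟧)
        ≈⟨ *-cong e (*-congʳ (*-cong (cycle a b c) (cycle a b c))) ⟨
      u * (⟦ b , c , a ⟧ * ⟦ b , c , a ⟧ * ⟦ x , y , z ⟧)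
        ≈⟨ rot ⟩
      u * det (bca x) (bca y) (bca z)
        ≈⟨ *-cong e (rotated x y z) ⟩
      v * det (ξ x) (ξ y) (ξ z) ∎

  -- A cyclic shift of the frame permutes the coordinates cyclically and preserves determinants, so
  -- the case of the last coordinate yields the others.
  expansion : ∀ a b c x y z k → let D = ⟦ a , b , c ⟧ ; ξ = coordinates a b c in
              ξ z k * (D * D * ⟦ x , y , z ⟧) ≈ ξ z k * det (ξ x) (ξ y) (ξ z)
  expansion a b c x y z 2F = expansion₂ a b c x y z
  expansion a b c x y z 0F = expansion-rotate a b c x y z (cycle z b c) (expansion₂ b c a x y z)
  expansion a b c x y z 1F = expansion-rotate a b c x y z (cycle a z c)
    (expansion-rotate b c a x y z (cycle z c a) (expansion₂ c a b x y z))

  module Frame (a b c e : E) (D-inverse : HasInverse ⟦ a , b , c ⟧)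
               (e-inverse : ∀ k → HasInverse (coordinates a b c e k)) where
    private
      D   = ⟦ a , b , c ⟧
      D⁻¹ = proj₁ D-inverse
      ε = coordinates a b c e
      ι : Vector Carrier 3
      ι k = proj₁ (e-inverse k)
      ξ = coordinates a b c

    -- Division by the coordinates of e makes e the unit point (1,1,1) of the frame.
    normalised : E → Vector Carrier 3
    normalised x k = ξ x k * ι k

    -- D²⟦x,y,z⟧ is the determinant of the ξ, and passing to `normalised` divides the coordinates at
    -- k by ε k; this constant collects both effects.
    scale : Carrier
    scale = D⁻¹ * D⁻¹ * (ε 0F * ε 1F * ε 2F)

    normalised-* : ∀ x k → normalised x k * ε k ≈ ξ x k
    normalised-* x k = begin
      ξ x k * ι k * ε k    ≈⟨ solve 3 (λ x i e → x :* i :* e := x :* (e :* i)) refl _ _ _ ⟩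
      ξ x k * (ε k * ι k)  ≈⟨ *-congˡ (proj₂ (e-inverse k)) ⟩
      ξ x k * 1#           ≈⟨ *-identityʳ _ ⟩
      ξ x k                ∎

    scale-inverse : HasInverse scale
    scale-inverse = HasInverse-* (HasInverse-* i i)
      (HasInverse-* (HasInverse-* (e-inverse 0F) (e-inverse 1F)) (e-inverse 2F))
      where i = HasInverse-sym (proj₂ D-inverse)

    -- `expansion` carries the factor ξ z k, which can be cancelled only when it is a unit.
    bracket-normalised : ∀ x y z k → HasInverse (ξ z k) →
      ⟦ x , y , z ⟧ ≈ scale * det (normalised x) (normalised y) (normalised z)
    bracket-normalised x y z k inv = *-cancelˡ-inverse (HasInverse-* D-inverse D-inverse)
      (*-cancelˡ-inverse inv (begin
        ξ z k * (D * D * ⟦ x , y , z ⟧)       ≈⟨ expansion a b c x y z k ⟩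
        ξ z k * det (ξ x) (ξ y) (ξ z)         ≈⟨ *-congˡ (det-cong (normalised-* x) (normalised-* y) (normalised-* z)) ⟨
        ξ z k * det (λ k → normalised x k * ε k) (λ k → normalised y k * ε k) (λ k → normalised z k * ε k)
          ≈⟨ *-congˡ pull-out ⟩
        ξ z k * (ε 0F * ε 1F * ε 2F * Δ)      ≈⟨ *-congˡ rescale ⟩
        ξ z k * (D * D * (scale * Δ))         ∎))
      where
      Δ = det (normalised x) (normalised y) (normalised z)

      pull-out : det (λ k → normalised x k * ε k) (λ k → normalised y k * ε k) (λ k → normalised z k * ε k) ≈
                 ε 0F * ε 1F * ε 2F * Δ
      pull-out = solve 12 (λ x₀ x₁ x₂ y₀ y₁ y₂ z₀ z₁ z₂ e₀ e₁ e₂ →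
          detₚ (x₀ :* e₀) (x₁ :* e₁) (x₂ :* e₂) (y₀ :* e₀) (y₁ :* e₁) (y₂ :* e₂)
               (z₀ :* e₀) (z₁ :* e₁) (z₂ :* e₂)
          := e₀ :* e₁ :* e₂ :* detₚ x₀ x₁ x₂ y₀ y₁ y₂ z₀ z₁ z₂) refl _ _ _ _ _ _ _ _ _ _ _ _

      rescale : ε 0F * ε 1F * ε 2F * Δ ≈ D * D * (scale * Δ)
      rescale = begin
        ε 0F * ε 1F * ε 2F * Δ                   ≈⟨ *-identityˡ _ ⟨
        1# * (ε 0F * ε 1F * ε 2F * Δ)            ≈⟨ *-congʳ (trans (*-cong (proj₂ D-inverse) (proj₂ D-inverse)) (*-identityˡ 1#)) ⟨
        (D * D⁻¹) * (D * D⁻¹) * (ε 0F * ε 1F * ε 2F * Δ)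
          ≈⟨ solve 4 (λ d i e Δ → d :* i :* (d :* i) :* (e :* Δ) := d :* d :* (i :* i :* e :* Δ)) refl _ _ _ _ ⟩
        D * D * (scale * Δ)                      ∎

-- Fields with decidable equality

record IsDecidableField {c ℓ} (F : CommutativeRing c ℓ) : Set (c ⊔ ℓ) where
  open CommutativeRing F
  open Determinant F using (HasInverse)
  infix 4 _≈?_
  field
    _≈?_    : Decidable _≈_
    inverse : ∀ {x} → ¬ x ≈ 0# → HasInverse x
    1≉0     : ¬ 1# ≈ 0#

module FieldProperties {c ℓ} {F : CommutativeRing c ℓ} (isField : IsDecidableField F) where
  open CommutativeRing F
  open IsDecidableField isField
  open Determinant F
  open SetoidReasoning setoid

  *-zero-factor : ∀ {x y} → ¬ x ≈ 0# → x * y ≈ 0# → y ≈ 0#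
  *-zero-factor {x} x≉0 xy≈0 = *-cancelˡ-inverse (inverse x≉0) (trans xy≈0 (sym (zeroʳ x)))

  *-nonzero : ∀ {x y} → ¬ x ≈ 0# → ¬ y ≈ 0# → ¬ x * y ≈ 0#
  *-nonzero x≉0 y≉0 xy≈0 = y≉0 (*-zero-factor x≉0 xy≈0)

  HasInverse⇒≉0 : ∀ {x} → HasInverse x → ¬ x ≈ 0#
  HasInverse⇒≉0 (t , xt) x≈0 = 1≉0 (trans (sym xt) (trans (*-congʳ x≈0) (zeroˡ t)))

-- Coordinates over a ring of the points of a triangle

next : Fin 3 → Fin 3
next 0F = 1F
next 1F = 2F
next 2F = 0F

next-injective : ∀ {i j} → next i ≡ next j → i ≡ j
next-injective {0F} {0F} _ = ≡.refl
next-injective {0F} {1F} ()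
next-injective {0F} {2F} ()
next-injective {1F} {0F} ()
next-injective {1F} {1F} _ = ≡.refl
next-injective {1F} {2F} ()
next-injective {2F} {0F} ()
next-injective {2F} {1F} ()
next-injective {2F} {2F} _ = ≡.refl

det-rotate : ∀ {c ℓ} (R : CommutativeRing c ℓ) → let open Determinant R in ∀ u v w →
             CommutativeRing._≈_ R (det (u ∘ next) (v ∘ next) (w ∘ next)) (det u v w)
det-rotate R u v w = solve 9 (λ x₀ x₁ x₂ y₀ y₁ y₂ z₀ z₁ z₂ →
    detₚ x₁ x₂ x₀ y₁ y₂ y₀ z₁ z₂ z₀ := detₚ x₀ x₁ x₂ y₀ y₁ y₂ z₀ z₁ z₂)
  (CommutativeRing.refl R) _ _ _ _ _ _ _ _ _
  where
  open IntegerSolver R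
  open Determinant R

-- For a field F, nonzero elements go to units by `θ-inverse`, so the map is injective as soon as R
-- is nontrivial; hence the name.
record IsFieldEmbedding {c ℓ c′ ℓ′} (F : CommutativeRing c ℓ) (R : CommutativeRing c′ ℓ′)
  (θ : CommutativeRing.Carrier F → CommutativeRing.Carrier R) : Set (c ⊔ ℓ ⊔ ℓ′) where
  private
    module F = CommutativeRing F
    open CommutativeRing R
  field
    θ-cong : ∀ {s t} → s F.≈ t → θ s ≈ θ t
    θ-0    : θ F.0# ≈ 0#
    θ-1    : θ F.1# ≈ 1#
    θ-+    : ∀ s t → θ (s F.+ t) ≈ θ s + θ t
    θ-*    : ∀ s t → θ (s F.* t) ≈ θ s * θ t

  θ-inverse : ∀ {s t} → s F.* t F.≈ F.1# → θ s * θ t ≈ 1#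
  θ-inverse {s} {t} st = trans (sym (θ-* s t)) (trans (θ-cong st) θ-1)

  θ-neg : ∀ t → θ (F.- t) ≈ - θ t
  θ-neg t = RingProperties.+-inverseˡ-unique ring _ _
    (trans (sym (θ-+ (F.- t) t)) (trans (θ-cong (F.-‿inverseˡ t)) θ-0))

-- The same points in homogeneous coordinates x over F and X over R, with respect to the frame given by the
-- vertices and the unit point e.
record Triangle {c ℓ c′ ℓ′} (F : CommutativeRing c ℓ) (R : CommutativeRing c′ ℓ′) (E : Set)
                : Set (c ⊔ ℓ ⊔ c′ ⊔ ℓ′) where
  private
    module F = CommutativeRing F
    module R = CommutativeRing R
  field
    x           : E → Vector F.Carrier 3
    X           : E → Vector R.Carrier 3
    zero-X      : ∀ {p k} → x p k F.≈ F.0# → X p k R.≈ R.0#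
    inverse-X   : ∀ {p k} → ¬ x p k F.≈ F.0# → Determinant.HasInverse R (X p k)
    collinear   : ∀ p q r → Determinant.det F (x p) (x q) (x r) F.≈ F.0# →
                  Determinant.det R (X p) (X q) (X r) R.≈ R.0#
    vertex      : Fin 3 → E
    vertex-zero : ∀ {j k} → j ≢ k → x (vertex j) k F.≈ F.0#
    vertex-one  : ∀ j → ¬ x (vertex j) j F.≈ F.0#
    e           : E
    x-e         : ∀ k → x e k F.≈ F.1#
    X-e         : ∀ k → X e k R.≈ R.1#
    side        : ∀ k t → ∃[ p ] ¬ x p k F.≈ F.0# × x p (next k) F.≈ t F.* x p k ×
                  x p (next (next k)) F.≈ F.0#
    nonzero     : ∀ p → ¬ (∀ k → x p k F.≈ F.0#)
    off-sides   : ∀ {p} → (∀ k → ¬ x p k F.≈ F.0#) → p ≡ e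

-- `SideRatio` treats a single side; the cyclic symmetry of the triangle carries its results to the
-- other two.
rotate : ∀ {c ℓ c′ ℓ′} {F : CommutativeRing c ℓ} {R : CommutativeRing c′ ℓ′} {E : Set} →
         Triangle F R E → Triangle F R E
rotate {F = F} {R} T = record
  { x           = λ p → x p ∘ next
  ; X           = λ p → X p ∘ next
  ; zero-X      = zero-X
  ; inverse-X   = inverse-X
  ; collinear   = λ p q r e → R.trans (det-rotate R (X p) (X q) (X r))
                    (collinear p q r (F.trans (F.sym (det-rotate F (x p) (x q) (x r))) e))
  ; vertex      = vertex ∘ next
  ; vertex-zero = λ j≢k → vertex-zero (j≢k ∘ next-injective)
  ; vertex-one  = vertex-one ∘ next
  ; e           = e
  ; x-e         = x-e ∘ next
  ; X-e         = X-e ∘ next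
  ; side        = side ∘ next
  ; nonzero     = λ p z → nonzero p λ { 0F → z 2F ; 1F → z 0F ; 2F → z 1F }
  ; off-sides   = λ n → off-sides λ { 0F → n 2F ; 1F → n 0F ; 2F → n 1F }
  }
  where
  open Triangle T
  module F = CommutativeRing F
  module R = CommutativeRing R

-- Each determinant is a product of coordinates, which are units in the applications, and one
-- difference; its vanishing thus becomes an equation.
module SideDeterminants {c ℓ} (R : CommutativeRing c ℓ) where
  open CommutativeRing R
  open IntegerSolver R
  open Determinant R

  det-same-side : ∀ p p′ q q′ r →
    det (p ∷ᶠ p′ ∷ᶠ 0# ∷ᶠ []ᶠ) (q ∷ᶠ q′ ∷ᶠ 0# ∷ᶠ []ᶠ) (0# ∷ᶠ 0# ∷ᶠ r ∷ᶠ []ᶠ) ≈ r * (p * q′ - q * p′)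
  det-same-side = solve 5 (λ p p′ q q′ r →
    detₚ p p′ (con (+ 0)) q q′ (con (+ 0)) (con (+ 0)) (con (+ 0)) r := r :* (p :* q′ :- q :* p′)) refl

  det-side-unit : ∀ p r s →
    det (p ∷ᶠ s * p ∷ᶠ 0# ∷ᶠ []ᶠ) (0# ∷ᶠ 0# ∷ᶠ r ∷ᶠ []ᶠ) (1# ∷ᶠ 1# ∷ᶠ 1# ∷ᶠ []ᶠ) ≈ p * r * (s - 1#)
  det-side-unit = solve 3 (λ p r s →
    detₚ p (s :* p) (con (+ 0)) (con (+ 0)) (con (+ 0)) r (con (+ 1)) (con (+ 1)) (con (+ 1))
    := p :* r :* (s :- con (+ 1))) refl

  det-sides-unit : ∀ p q s t →
    det (p ∷ᶠ s * p ∷ᶠ 0# ∷ᶠ []ᶠ) (0# ∷ᶠ q ∷ᶠ t * q ∷ᶠ []ᶠ) (1# ∷ᶠ 1# ∷ᶠ 1# ∷ᶠ []ᶠ) ≈ p * q * (s * t - (t - 1#))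
  det-sides-unit = solve 4 (λ p q s t →
    detₚ p (s :* p) (con (+ 0)) (con (+ 0)) q (t :* q) (con (+ 1)) (con (+ 1)) (con (+ 1))
    := p :* q :* (s :* t :- (t :- con (+ 1)))) refl

  -- The last factor contains `- - 1#` instead of `+ 1#`, so that its vanishing reads as s t u = -1.
  det-three-sides : ∀ p q r s t u →
    det (p ∷ᶠ s * p ∷ᶠ 0# ∷ᶠ []ᶠ) (0# ∷ᶠ q ∷ᶠ t * q ∷ᶠ []ᶠ) (u * r ∷ᶠ 0# ∷ᶠ r ∷ᶠ []ᶠ) ≈ p * q * r * (s * t * u - - 1#)
  det-three-sides = solve 6 (λ p q r s t u →
    detₚ p (s :* p) (con (+ 0)) (con (+ 0)) q (t :* q) (u :* r) (con (+ 0)) r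
    := p :* q :* r :* (s :* t :* u :- (:- con (+ 1)))) refl

module SideRatio {c ℓ c′ ℓ′} {F : CommutativeRing c ℓ} (isField : IsDecidableField F)
                 {R : CommutativeRing c′ ℓ′} {E : Set} (T : Triangle F R E) where
  private
    module F where
      open CommutativeRing F public
      open IsDecidableField isField public
      open FieldProperties isField public
      open Determinant F public
      open SideDeterminants F public
    open CommutativeRing R
    open IntegerSolver R
    open Determinant R
    open SideDeterminants R
    open RingProperties ring using (x∙y⁻¹≈ε⇒x≈y)
    open Triangle T
    open SetoidReasoning setoid

  OnSide : F.Carrier → E → Set ℓ
  OnSide t p = ¬ x p 0F F.≈ F.0# × x p 1F F.≈ t F.* x p 0F × x p 2F F.≈ F.0#

  sidePoint : F.Carrier → E
  sidePoint t = proj₁ (side 0F t)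

  sidePoint-onSide : ∀ t → OnSide t (sidePoint t)
  sidePoint-onSide t = proj₂ (side 0F t)

  -- Taken at the point that `side` happens to choose; `ratio-unique` shows that every other point
  -- with the same ratio over F gives the same value.
  ratio : F.Carrier → Carrier
  ratio t = X (sidePoint t) 1F * proj₁ (inverse-X (proj₁ (sidePoint-onSide t)))

  ratio-sidePoint : ∀ t → X (sidePoint t) 1F ≈ ratio t * X (sidePoint t) 0F
  ratio-sidePoint t = begin
    q₁               ≈⟨ *-identityʳ _ ⟨
    q₁ * 1#          ≈⟨ *-congˡ qi ⟨
    q₁ * (q₀ * i)    ≈⟨ solve 3 (λ a b c → a :* (b :* c) := a :* c :* b) refl _ _ _ ⟩
    q₁ * i * q₀      ∎
    where
    q₀ = X (sidePoint t) 0F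
    q₁ = X (sidePoint t) 1F
    i = proj₁ (inverse-X (proj₁ (sidePoint-onSide t)))
    qi : q₀ * i ≈ 1#
    qi = proj₂ (inverse-X (proj₁ (sidePoint-onSide t)))

  sides-F : ∀ {t p} → OnSide t p → ∀ k → x p k F.≈ (x p 0F ∷ᶠ t F.* x p 0F ∷ᶠ F.0# ∷ᶠ []ᶠ) k
  sides-F _             0F = F.refl
  sides-F (_ , p₁ , _)  1F = p₁
  sides-F (_ , _  , p₂) 2F = p₂

  v : E
  v = vertex 2F

  vertex-F : ∀ k → x v k F.≈ (F.0# ∷ᶠ F.0# ∷ᶠ x v 2F ∷ᶠ []ᶠ) k
  vertex-F 0F = vertex-zero λ ()
  vertex-F 1F = vertex-zero λ ()
  vertex-F 2F = F.refl

  vertex-R : ∀ k → X v k ≈ (0# ∷ᶠ 0# ∷ᶠ X v 2F ∷ᶠ []ᶠ) k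
  vertex-R 0F = zero-X (vertex-F 0F)
  vertex-R 1F = zero-X (vertex-F 1F)
  vertex-R 2F = refl

  unit-F : ∀ k → x e k F.≈ (F.1# ∷ᶠ F.1# ∷ᶠ F.1# ∷ᶠ []ᶠ) k
  unit-F 0F = x-e 0F
  unit-F 1F = x-e 1F
  unit-F 2F = x-e 2F

  unit-R : ∀ k → X e k ≈ (1# ∷ᶠ 1# ∷ᶠ 1# ∷ᶠ []ᶠ) k
  unit-R 0F = X-e 0F
  unit-R 1F = X-e 1F
  unit-R 2F = X-e 2F

  -- Points of a side with the same ratio are equal, hence collinear with the opposite vertex.
  ratio-unique : ∀ {t p} → OnSide t p → X p 1F ≈ ratio t * X p 0F
  ratio-unique {t} {p} on =
    sym (*-cancelˡ-inverse (HasInverse-* (inverse-X (vertex-one 2F)) (inverse-X (proj₁ on′)))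
      (x∙y⁻¹≈ε⇒x≈y _ _ (begin
        r * q₀ * (ratio t * X p 0F) - r * q₀ * X p 1F
          ≈⟨ solve 5 (λ r q a p p′ → r :* q :* (a :* p) :- r :* q :* p′ := r :* (p :* (a :* q) :- q :* p′))
               refl _ _ _ _ _ ⟩
        r * (X p 0F * (ratio t * q₀) - q₀ * X p 1F)
          ≈⟨ det-same-side (X p 0F) (X p 1F) q₀ (ratio t * q₀) r ⟨
        det (X p 0F ∷ᶠ X p 1F ∷ᶠ 0# ∷ᶠ []ᶠ) (q₀ ∷ᶠ ratio t * q₀ ∷ᶠ 0# ∷ᶠ []ᶠ) (0# ∷ᶠ 0# ∷ᶠ r ∷ᶠ []ᶠ)
          ≈⟨ det-cong p-R q-R vertex-R ⟨
        det (X p) (X q) (X v)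
          ≈⟨ collinear p q v (F.trans (F.det-cong (sides-F on) (sides-F on′) vertex-F)
               (F.trans (F.det-same-side _ _ _ _ _) zero-F)) ⟩
        0# ∎)))
    where
    q = sidePoint t
    on′ = sidePoint-onSide t
    q₀ = X q 0F
    r = X v 2F

    p-R : ∀ k → X p k ≈ (X p 0F ∷ᶠ X p 1F ∷ᶠ 0# ∷ᶠ []ᶠ) k
    p-R 0F = refl
    p-R 1F = refl
    p-R 2F = zero-X (proj₂ (proj₂ on))

    q-R : ∀ k → X q k ≈ (q₀ ∷ᶠ ratio t * q₀ ∷ᶠ 0# ∷ᶠ []ᶠ) k
    q-R 0F = refl
    q-R 1F = ratio-sidePoint t
    q-R 2F = zero-X (proj₂ (proj₂ on′))

    zero-F : x v 2F F.* (x p 0F F.* (t F.* x q 0F) F.- x q 0F F.* (t F.* x p 0F)) F.≈ F.0#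
    zero-F = SF.solve 4 (λ p q r t → r SF.:* (p SF.:* (t SF.:* q) SF.:- q SF.:* (t SF.:* p)) SF.:= SF.con (+ 0))
      F.refl _ _ _ _
      where module SF = IntegerSolver F

  sides-R : ∀ {t p} → OnSide t p → ∀ k → X p k ≈ (X p 0F ∷ᶠ ratio t * X p 0F ∷ᶠ 0# ∷ᶠ []ᶠ) k
  sides-R _              0F = refl
  sides-R on             1F = ratio-unique on
  sides-R (_ , _  , p₂)  2F = zero-X p₂

  -- `side` may choose different points for equal parameters; but the point chosen for s also has
  -- ratio t over F, and `ratio-unique` applies to it.
  ratio-cong : ∀ {s t} → s F.≈ t → ratio s ≈ ratio t
  ratio-cong {s} {t} s≈t = *-cancelˡ-inverse (inverse-X p₀≉0) (begin
    X p 0F * ratio s  ≈⟨ *-comm _ _ ⟩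
    ratio s * X p 0F  ≈⟨ ratio-sidePoint s ⟨
    X p 1F            ≈⟨ ratio-unique (p₀≉0 , F.trans (proj₁ (proj₂ on)) (F.*-congʳ s≈t) , proj₂ (proj₂ on)) ⟩
    ratio t * X p 0F  ≈⟨ *-comm _ _ ⟩
    X p 0F * ratio t  ∎)
    where
    p = sidePoint s
    on = sidePoint-onSide s
    p₀≉0 = proj₁ on

  ratio-0 : ratio F.0# ≈ 0#
  ratio-0 = trans (*-congʳ (zero-X (F.trans (proj₁ (proj₂ (sidePoint-onSide F.0#))) (F.zeroˡ _)))) (zeroˡ _)

  -- The points (1,1,0), (0,0,1) and (1,1,1) are collinear: the line joining the unit point to the
  -- opposite vertex meets the side at ratio 1.
  ratio-1 : ratio F.1# ≈ 1#
  ratio-1 = x∙y⁻¹≈ε⇒x≈y _ _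
    (*-cancelˡ-inverse (HasInverse-* (inverse-X (proj₁ on)) (inverse-X (vertex-one 2F))) (begin
      X p 0F * X v 2F * (ratio F.1# - 1#)  ≈⟨ det-side-unit (X p 0F) (X v 2F) (ratio F.1#) ⟨
      det (X p 0F ∷ᶠ ratio F.1# * X p 0F ∷ᶠ 0# ∷ᶠ []ᶠ) (0# ∷ᶠ 0# ∷ᶠ X v 2F ∷ᶠ []ᶠ) (1# ∷ᶠ 1# ∷ᶠ 1# ∷ᶠ []ᶠ)
        ≈⟨ det-cong (sides-R on) vertex-R unit-R ⟨
      det (X p) (X v) (X e)
        ≈⟨ collinear p v e (F.trans (F.det-cong (sides-F on) vertex-F unit-F)
             (F.trans (F.det-side-unit _ _ _) (F.trans (F.*-congˡ (F.-‿inverseʳ F.1#)) (F.zeroʳ _)))) ⟩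
      0#                    ≈⟨ zeroʳ _ ⟨
      X p 0F * X v 2F * 0#  ∎))
    where
    p = sidePoint F.1#
    on = sidePoint-onSide F.1#

  ProportionalTo : (F.Carrier → Carrier) → E → Set (c′ ⊔ ℓ′)
  ProportionalTo θ p = ∃[ s ] HasInverse s × (∀ k → X p k ≈ s * θ (x p k))

  -- θ is a parameter because the lemma is also applied to the rotated triangles, whose ratio
  -- functions agree with θ without being defined as θ.
  side-proportional : ∀ {θ} → IsFieldEmbedding F R θ → (∀ t → ratio t ≈ θ t) →
                      ∀ {p} → ¬ x p 0F F.≈ F.0# → x p 2F F.≈ F.0# → ProportionalTo θ p
  side-proportional {θ} θ-embedding ratio≈θ {p} p₀≉0 p₂ =
    s , HasInverse-* (inverse-X p₀≉0) (θ (x p 0F) , θ-inverse ip₀) , entry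
    where
    open IsFieldEmbedding θ-embedding
    i = proj₁ (F.inverse p₀≉0)
    -- Chosen so that the coordinate at 0 matches; the ratio then settles the coordinate at 1.
    s = X p 0F * θ i

    ip₀ : i F.* x p 0F F.≈ F.1#
    ip₀ = F.trans (F.*-comm _ _) (proj₂ (F.inverse p₀≉0))

    on : OnSide (x p 1F F.* i) p
    on = p₀≉0 , F.sym (F.trans (F.*-assoc _ _ _) (F.trans (F.*-congˡ ip₀) (F.*-identityʳ _))) , p₂

    entry : ∀ k → X p k ≈ s * θ (x p k)
    entry 0F = begin
      X p 0F                     ≈⟨ *-identityʳ _ ⟨
      X p 0F * 1#                ≈⟨ *-congˡ (θ-inverse ip₀) ⟨
      X p 0F * (θ i * θ (x p 0F))  ≈⟨ *-assoc _ _ _ ⟨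
      s * θ (x p 0F)             ∎
    entry 1F = begin
      X p 1F                         ≈⟨ ratio-unique on ⟩
      ratio (x p 1F F.* i) * X p 0F  ≈⟨ *-congʳ (trans (ratio≈θ _) (θ-* _ _)) ⟩
      θ (x p 1F) * θ i * X p 0F      ≈⟨ solve 3 (λ a b c → a :* b :* c := c :* b :* a) refl _ _ _ ⟩
      s * θ (x p 1F)                 ∎
    entry 2F = begin
      X p 2F          ≈⟨ zero-X p₂ ⟩
      0#              ≈⟨ zeroʳ s ⟨
      s * 0#          ≈⟨ *-congˡ (trans (θ-cong p₂) θ-0) ⟨
      s * θ (x p 2F)  ∎

-- α, β, γ are the coordinates over R of the points (1,t,0), (0,1,t), (t,0,1).
record SideCoordinates {c ℓ c′ ℓ′} (F : CommutativeRing c ℓ) (R : CommutativeRing c′ ℓ′)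
    (α β γ : CommutativeRing.Carrier F → CommutativeRing.Carrier R) : Set (c ⊔ ℓ ⊔ ℓ′) where
  private
    module F = CommutativeRing F
    open CommutativeRing R
  field
    α-cong       : ∀ {s t} → s F.≈ t → α s ≈ α t
    β-cong       : ∀ {s t} → s F.≈ t → β s ≈ β t
    α-0          : α F.0# ≈ 0#
    β-0          : β F.0# ≈ 0#
    α-1          : α F.1# ≈ 1#
    β-1          : β F.1# ≈ 1#
    γ-1          : γ F.1# ≈ 1#
    menelaus     : ∀ s t u → s F.* t F.* u F.≈ F.- F.1# → α s * β t * γ u ≈ - 1#
    through-unit : ∀ s t → s F.* t F.≈ t F.- F.1# → α s * β t ≈ β t - 1#

-- The ratio function as a ring homomorphism

module RatioArithmetic {c ℓ c′ ℓ′} {F : CommutativeRing c ℓ} (isField : IsDecidableField F)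
    {R : CommutativeRing c′ ℓ′} {α β γ : CommutativeRing.Carrier F → CommutativeRing.Carrier R}
    (sideCoordinates : SideCoordinates F R α β γ) where
  private
    module F = CommutativeRing F
    open CommutativeRing R
    open SideCoordinates sideCoordinates
    open IsDecidableField isField
    open FieldProperties isField
    module SF = IntegerSolver F
    open IntegerSolver R
    open Determinant R
    open SetoidReasoning setoid

  -- Menelaus with the middle point at ratio 1.
  α≈-γ⁻¹ : ∀ {s u} → s F.* u F.≈ F.- F.1# → α s * γ u ≈ - 1#
  α≈-γ⁻¹ {s} {u} su = begin
    α s * γ u              ≈⟨ *-congʳ (*-identityʳ (α s)) ⟨
    α s * 1# * γ u         ≈⟨ *-congʳ (*-congˡ β-1) ⟨
    α s * β F.1# * γ u     ≈⟨ menelaus s F.1# u (F.trans (F.*-congʳ (F.*-identityʳ s)) su) ⟩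
    - 1#                   ∎

  β≈-γ⁻¹ : ∀ {t u} → t F.* u F.≈ F.- F.1# → β t * γ u ≈ - 1#
  β≈-γ⁻¹ {t} {u} tu = begin
    β t * γ u              ≈⟨ *-congʳ (*-identityˡ (β t)) ⟨
    1# * β t * γ u         ≈⟨ *-congʳ (*-congʳ α-1) ⟨
    α F.1# * β t * γ u     ≈⟨ menelaus F.1# t u (F.trans (F.*-congʳ (F.*-identityˡ t)) tu) ⟩
    - 1#                   ∎

  negative-inverse : ∀ {t} → ¬ t F.≈ F.0# → ∃[ u ] t F.* u F.≈ F.- F.1#
  negative-inverse {t} t≉0 = F.- proj₁ (inverse t≉0) ,
    F.trans (F.sym (RingProperties.-‿distribʳ-* F.ring t _)) (F.-‿cong (proj₂ (inverse t≉0)))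

  γ-inverse : ∀ {t u} → t F.* u F.≈ F.- F.1# → HasInverse (γ u)
  γ-inverse {t} {u} tu = - α t , (begin
    γ u * - α t      ≈⟨ solve 2 (λ g a → g :* (:- a) := :- (a :* g)) refl _ _ ⟩
    - (α t * γ u)    ≈⟨ -‿cong (α≈-γ⁻¹ tu) ⟩
    - - 1#           ≈⟨ solve 0 (:- (:- con (+ 1)) := con (+ 1)) refl ⟩
    1#               ∎)

  α≈0 : ∀ {t} → t F.≈ F.0# → α t ≈ 0#
  α≈0 t≈0 = trans (α-cong t≈0) α-0

  -- For nonzero t take u with t u = -1: then α t and β t are both the negative inverse of the unit
  -- γ u.
  sides-agree : ∀ t → α t ≈ β t
  sides-agree t = case (t ≈? F.0#)
    where
    case : Dec (t F.≈ F.0#) → α t ≈ β t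
    case (yes t≈0) = trans (α≈0 t≈0) (sym (trans (β-cong t≈0) β-0))
    case (no t≉0)  = *-cancelˡ-inverse (γ-inverse tu)
      (trans (*-comm _ _) (trans (trans (α≈-γ⁻¹ tu) (sym (β≈-γ⁻¹ tu))) (*-comm _ _)))
      where tu = proj₂ (negative-inverse t≉0)

  -- The triples (s, t, u) and (s t, 1, u) both satisfy the condition of Menelaus, and γ u can be
  -- cancelled.
  α-*-nonzero : ∀ {s t u} → s F.* t F.* u F.≈ F.- F.1# → α (s F.* t) ≈ α s * α t
  α-*-nonzero {s} {t} {u} stu = *-cancelˡ-inverse (γ-inverse stu) (begin
    γ u * α (s F.* t)    ≈⟨ *-comm _ _ ⟩
    α (s F.* t) * γ u    ≈⟨ α≈-γ⁻¹ stu ⟩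
    - 1#                 ≈⟨ menelaus s t u stu ⟨
    α s * β t * γ u      ≈⟨ *-congʳ (*-congˡ (sides-agree t)) ⟨
    α s * α t * γ u      ≈⟨ *-comm _ _ ⟩
    γ u * (α s * α t)    ∎)

  α-* : ∀ s t → α (s F.* t) ≈ α s * α t
  α-* s t = case (s ≈? F.0#) (t ≈? F.0#)
    where
    case : Dec (s F.≈ F.0#) → Dec (t F.≈ F.0#) → α (s F.* t) ≈ α s * α t
    case (yes s≈0) _ = trans (α≈0 (F.trans (F.*-congʳ s≈0) (F.zeroˡ t)))
                             (sym (trans (*-congʳ (α≈0 s≈0)) (zeroˡ (α t))))
    case (no _) (yes t≈0) = trans (α≈0 (F.trans (F.*-congˡ t≈0) (F.zeroʳ s)))
                                  (sym (trans (*-congˡ (α≈0 t≈0)) (zeroʳ (α s))))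
    case (no s≉0) (no t≉0) = α-*-nonzero (proj₂ (negative-inverse (*-nonzero s≉0 t≉0)))

  -- The parameter s = (t - 1)/t meets the condition of `through-unit`, and multiplicativity turns
  -- the left side of that relation into α (t - 1). At t = 0 there is no such s, and α (-1) = -1
  -- comes from Menelaus with γ 1 = 1.
  α-pred : ∀ t → α (t F.- F.1#) ≈ α t - 1#
  α-pred t = case (t ≈? F.0#)
    where
    case : Dec (t F.≈ F.0#) → α (t F.- F.1#) ≈ α t - 1#
    case (yes t≈0) = begin
      α (t F.- F.1#)         ≈⟨ α-cong (F.trans (F.+-congʳ t≈0) (F.+-identityˡ _)) ⟩
      α (F.- F.1#)           ≈⟨ *-identityʳ _ ⟨
      α (F.- F.1#) * 1#      ≈⟨ *-congˡ γ-1 ⟨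
      α (F.- F.1#) * γ F.1#  ≈⟨ α≈-γ⁻¹ (F.*-identityʳ _) ⟩
      - 1#                   ≈⟨ +-identityˡ _ ⟨
      0# - 1#                ≈⟨ +-congʳ (α≈0 t≈0) ⟨
      α t - 1#               ∎
    case (no t≉0) = begin
      α (t F.- F.1#)       ≈⟨ α-cong st ⟨
      α (s F.* t)          ≈⟨ α-* s t ⟩
      α s * α t            ≈⟨ *-congˡ (sides-agree t) ⟩
      α s * β t            ≈⟨ through-unit s t st ⟩
      β t - 1#             ≈⟨ +-congʳ (sides-agree t) ⟨
      α t - 1#             ∎
      where
      i = proj₁ (inverse t≉0)
      s = (t F.- F.1#) F.* i
      st : s F.* t F.≈ t F.- F.1#
      st = F.trans (F.*-assoc _ i t)
             (F.trans (F.*-congˡ (F.trans (F.*-comm i t) (proj₂ (inverse t≉0)))) (F.*-identityʳ _))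

  α-neg : ∀ t → α (F.- t) ≈ - α t
  α-neg t = begin
    α (F.- t)                  ≈⟨ α-cong -t ⟩
    α ((F.0# F.- F.1#) F.* t)  ≈⟨ α-* _ t ⟩
    α (F.0# F.- F.1#) * α t    ≈⟨ *-congʳ (trans (α-pred F.0#) (+-congʳ α-0)) ⟩
    (0# - 1#) * α t            ≈⟨ solve 1 (λ a → (con (+ 0) :- con (+ 1)) :* a := :- a) refl _ ⟩
    - α t                      ∎
    where
    -t : F.- t F.≈ (F.0# F.- F.1#) F.* t
    -t = SF.solve 1 (λ t → SF.:- t SF.:= (SF.con (+ 0) SF.:- SF.con (+ 1)) SF.:* t) F.refl t

  -- s + t = −t (−s/t − 1) reduces sums to α-pred.
  α-+ : ∀ s t → α (s F.+ t) ≈ α s + α t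
  α-+ s t = case (t ≈? F.0#)
    where
    case : Dec (t F.≈ F.0#) → α (s F.+ t) ≈ α s + α t
    case (yes t≈0) = begin
      α (s F.+ t)    ≈⟨ α-cong (F.trans (F.+-congˡ t≈0) (F.+-identityʳ s)) ⟩
      α s            ≈⟨ +-identityʳ _ ⟨
      α s + 0#       ≈⟨ +-congˡ (α≈0 t≈0) ⟨
      α s + α t      ∎
    case (no t≉0) = begin
      α (s F.+ t)                          ≈⟨ α-cong s+t ⟩
      α (F.- t F.* (u F.- F.1#))           ≈⟨ α-* _ _ ⟩
      α (F.- t) * α (u F.- F.1#)           ≈⟨ *-congˡ (α-pred u) ⟩
      α (F.- t) * (α u - 1#)               ≈⟨ solve 2 (λ m u → m :* (u :- con (+ 1)) := m :* u :+ :- m) refl _ _ ⟩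
      α (F.- t) * α u + - α (F.- t)        ≈⟨ +-cong (sym (α-* _ _)) (sym (α-neg (F.- t))) ⟩
      α (F.- t F.* u) + α (F.- (F.- t))    ≈⟨ +-cong (α-cong -tu) (α-cong (RingProperties.-‿involutive F.ring t)) ⟩
      α s + α t                            ∎
      where
      i = proj₁ (inverse t≉0)
      u = F.- (s F.* i)

      -tu : F.- t F.* u F.≈ s
      -tu = F.trans (SF.solve 3 (λ s t i → SF.:- t SF.:* (SF.:- (s SF.:* i)) SF.:= s SF.:* (t SF.:* i)) F.refl s t i)
                    (F.trans (F.*-congˡ (proj₂ (inverse t≉0))) (F.*-identityʳ s))

      s+t : s F.+ t F.≈ F.- t F.* (u F.- F.1#)
      s+t = F.sym (F.trans
        (SF.solve 2 (λ t u → SF.:- t SF.:* (u SF.:- SF.con (+ 1)) SF.:= SF.:- t SF.:* u SF.:+ t) F.refl t u)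
        (F.+-congʳ -tu))

  isFieldEmbedding : IsFieldEmbedding F R α
  isFieldEmbedding = record
    { θ-cong = α-cong
    ; θ-0    = α-0
    ; θ-1    = α-1
    ; θ-+    = α-+
    ; θ-*    = α-*
    }

module RatiosOfSides {c ℓ c′ ℓ′} {F : CommutativeRing c ℓ} (isField : IsDecidableField F)
                        {R : CommutativeRing c′ ℓ′} {E : Set} (T : Triangle F R E) where
  private
    module F where
      open CommutativeRing F public
      open IsDecidableField isField public
      open FieldProperties isField public
      open Determinant F public
      open SideDeterminants F public
      open RingProperties ring public using (x≈y⇒x∙y⁻¹≈ε)
    open CommutativeRing R
    open IntegerSolver R
    open Determinant R
    open SideDeterminants R
    open RingProperties ring using (x∙y⁻¹≈ε⇒x≈y)
    open Triangle T
    open SetoidReasoning setoid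

    module A = SideRatio isField T
    module B = SideRatio isField (rotate T)
    module C = SideRatio isField (rotate (rotate T))

    α = A.ratio
    β = B.ratio
    γ = C.ratio

    module _ {t q} (on : B.OnSide t q) where
      B-F : ∀ k → x q k F.≈ (F.0# ∷ᶠ x q 1F ∷ᶠ t F.* x q 1F ∷ᶠ []ᶠ) k
      B-F 0F = proj₂ (proj₂ on)
      B-F 1F = F.refl
      B-F 2F = proj₁ (proj₂ on)

      B-R : ∀ k → X q k ≈ (0# ∷ᶠ X q 1F ∷ᶠ β t * X q 1F ∷ᶠ []ᶠ) k
      B-R 0F = zero-X (proj₂ (proj₂ on))
      B-R 1F = refl
      B-R 2F = B.ratio-unique on

    module _ {u r} (on : C.OnSide u r) where
      C-F : ∀ k → x r k F.≈ (u F.* x r 2F ∷ᶠ F.0# ∷ᶠ x r 2F ∷ᶠ []ᶠ) k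
      C-F 0F = proj₁ (proj₂ on)
      C-F 1F = proj₂ (proj₂ on)
      C-F 2F = F.refl

      C-R : ∀ k → X r k ≈ (γ u * X r 2F ∷ᶠ 0# ∷ᶠ X r 2F ∷ᶠ []ᶠ) k
      C-R 0F = C.ratio-unique on
      C-R 1F = zero-X (proj₂ (proj₂ on))
      C-R 2F = refl

  -- Over F the condition says that the three points are collinear; over R the vanishing determinant
  -- is a unit times the required difference.
  menelaus : ∀ s t u → s F.* t F.* u F.≈ F.- F.1# → α s * β t * γ u ≈ - 1#
  menelaus s t u stu = x∙y⁻¹≈ε⇒x≈y _ _
    (*-cancelˡ-inverse (HasInverse-* (HasInverse-* (inverse-X (proj₁ p-on)) (inverse-X (proj₁ q-on))) (inverse-X (proj₁ r-on))) (begin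
      X p 0F * X q 1F * X r 2F * (α s * β t * γ u - - 1#)
        ≈⟨ det-three-sides (X p 0F) (X q 1F) (X r 2F) (α s) (β t) (γ u) ⟨
      det (X p 0F ∷ᶠ α s * X p 0F ∷ᶠ 0# ∷ᶠ []ᶠ) (0# ∷ᶠ X q 1F ∷ᶠ β t * X q 1F ∷ᶠ []ᶠ) (γ u * X r 2F ∷ᶠ 0# ∷ᶠ X r 2F ∷ᶠ []ᶠ)
        ≈⟨ det-cong (A.sides-R p-on) (B-R q-on) (C-R r-on) ⟨
      det (X p) (X q) (X r)
        ≈⟨ collinear p q r (F.trans (F.det-cong (A.sides-F p-on) (B-F q-on) (C-F r-on))
             (F.trans (F.det-three-sides _ _ _ _ _ _)
               (F.trans (F.*-congˡ (F.x≈y⇒x∙y⁻¹≈ε stu)) (F.zeroʳ _)))) ⟩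
      0#                               ≈⟨ zeroʳ _ ⟨
      X p 0F * X q 1F * X r 2F * 0#    ∎))
    where
    p = A.sidePoint s
    q = B.sidePoint t
    r = C.sidePoint u
    p-on = A.sidePoint-onSide s
    q-on = B.sidePoint-onSide t
    r-on = C.sidePoint-onSide u

  through-unit : ∀ s t → s F.* t F.≈ t F.- F.1# → α s * β t ≈ β t - 1#
  through-unit s t st = x∙y⁻¹≈ε⇒x≈y _ _
    (*-cancelˡ-inverse (HasInverse-* (inverse-X (proj₁ p-on)) (inverse-X (proj₁ q-on))) (begin
      X p 0F * X q 1F * (α s * β t - (β t - 1#))
        ≈⟨ det-sides-unit (X p 0F) (X q 1F) (α s) (β t) ⟨
      det (X p 0F ∷ᶠ α s * X p 0F ∷ᶠ 0# ∷ᶠ []ᶠ) (0# ∷ᶠ X q 1F ∷ᶠ β t * X q 1F ∷ᶠ []ᶠ) (1# ∷ᶠ 1# ∷ᶠ 1# ∷ᶠ []ᶠ)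
        ≈⟨ det-cong (A.sides-R p-on) (B-R q-on) A.unit-R ⟨
      det (X p) (X q) (X e)
        ≈⟨ collinear p q e (F.trans (F.det-cong (A.sides-F p-on) (B-F q-on) A.unit-F)
             (F.trans (F.det-sides-unit _ _ _ _)
               (F.trans (F.*-congˡ (F.x≈y⇒x∙y⁻¹≈ε st)) (F.zeroʳ _)))) ⟩
      0#                    ≈⟨ zeroʳ _ ⟨
      X p 0F * X q 1F * 0#  ∎))
    where
    p = A.sidePoint s
    q = B.sidePoint t
    p-on = A.sidePoint-onSide s
    q-on = B.sidePoint-onSide t


  θ : F.Carrier → Carrier
  θ = α

  private
    sideCoordinates : SideCoordinates F R α β γ
    sideCoordinates = record
      { α-cong = A.ratio-cong ; β-cong = B.ratio-cong
      ; α-0 = A.ratio-0 ; β-0 = B.ratio-0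
      ; α-1 = A.ratio-1 ; β-1 = B.ratio-1 ; γ-1 = C.ratio-1
      ; menelaus = menelaus ; through-unit = through-unit
      }

  open RatioArithmetic isField sideCoordinates public using (isFieldEmbedding; sides-agree)

-- Coordinates of all elements over R

module Coordinatisation {c ℓ c′ ℓ′} {F : CommutativeRing c ℓ} (isField : IsDecidableField F)
                        {R : CommutativeRing c′ ℓ′} {E : Set} (T : Triangle F R E) where
  private
    module F where
      open CommutativeRing F public
      open IsDecidableField isField public
    open CommutativeRing R
    open Determinant R using (HasInverse)
    open Triangle T

    module A = SideRatio isField T
    module B = SideRatio isField (rotate T)
    module C = SideRatio isField (rotate (rotate T))

  open RatiosOfSides isField T public using (θ; isFieldEmbedding)

  private
    B≈θ : ∀ t → B.ratio t ≈ θ t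
    B≈θ t = sym (RatiosOfSides.sides-agree isField T t)

    -- `sides-agree` compares the first side with the second; in the rotated triangle these are the
    -- second and the third.
    C≈θ : ∀ t → C.ratio t ≈ θ t
    C≈θ t = trans (sym (RatiosOfSides.sides-agree isField (rotate T) t)) (B≈θ t)

    fromB : ∀ {p} → B.ProportionalTo θ p → A.ProportionalTo θ p
    fromB (s , i , e) = s , i , λ { 0F → e 2F ; 1F → e 0F ; 2F → e 1F }

    fromC : ∀ {p} → C.ProportionalTo θ p → A.ProportionalTo θ p
    fromC (s , i , e) = s , i , λ { 0F → e 1F ; 1F → e 2F ; 2F → e 0F }

  -- An element with some but not all coordinates zero has, in cyclic order, a zero coordinate
  -- followed by a nonzero one, and this is the shape that `side-proportional` asks for on one of
  -- the sides.
  proportional : ∀ p → ∃[ s ] HasInverse s × (∀ k → X p k ≈ s * θ (x p k))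
  proportional p = case (x p 0F F.≈? F.0#) (x p 1F F.≈? F.0#) (x p 2F F.≈? F.0#)
    where
    open IsFieldEmbedding isFieldEmbedding

    onA : ¬ x p 0F F.≈ F.0# → x p 2F F.≈ F.0# → A.ProportionalTo θ p
    onA = A.side-proportional isFieldEmbedding λ _ → refl

    onB : ¬ x p 1F F.≈ F.0# → x p 0F F.≈ F.0# → A.ProportionalTo θ p
    onB p₁ p₀ = fromB (B.side-proportional isFieldEmbedding B≈θ p₁ p₀)

    onC : ¬ x p 2F F.≈ F.0# → x p 1F F.≈ F.0# → A.ProportionalTo θ p
    onC p₂ p₁ = fromC (C.side-proportional isFieldEmbedding C≈θ p₂ p₁)

    isE : p ≡ e → A.ProportionalTo θ p
    isE ≡.refl = 1# , (1# , *-identityˡ 1#) , λ k →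
      trans (X-e k) (sym (trans (*-identityˡ _) (trans (θ-cong (x-e k)) θ-1)))

    case : Dec (x p 0F F.≈ F.0#) → Dec (x p 1F F.≈ F.0#) → Dec (x p 2F F.≈ F.0#) → A.ProportionalTo θ p
    case (yes p₀) (yes p₁) (yes p₂) = contradiction (λ { 0F → p₀ ; 1F → p₁ ; 2F → p₂ }) (nonzero p)
    case (yes p₀) (yes p₁) (no p₂)  = onC p₂ p₁
    case (yes p₀) (no p₁)  _        = onB p₁ p₀
    case (no p₀)  _        (yes p₂) = onA p₀ p₂
    case (no p₀)  (yes p₁) (no p₂)  = onC p₂ p₁
    case (no p₀)  (no p₁)  (no p₂)  = isE (off-sides λ { 0F → p₀ ; 1F → p₁ ; 2F → p₂ })

-- Comparison of brackets over F and over R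

module _ {c ℓ c′ ℓ′} {F : CommutativeRing c ℓ} {R : CommutativeRing c′ ℓ′} {θ}
         (θ-embedding : IsFieldEmbedding F R θ) where
  private
    module F where
      open CommutativeRing F public
      open Determinant F public
  open CommutativeRing R
  open Determinant R
  open IsFieldEmbedding θ-embedding

  θ-sub : ∀ s t → θ (s F.- t) ≈ θ s - θ t
  θ-sub s t = trans (θ-+ s (F.- t)) (+-congˡ (θ-neg t))

  θ-det : ∀ u v w → θ (F.det u v w) ≈ det (θ ∘ u) (θ ∘ v) (θ ∘ w)
  θ-det u v w =
    trans (θ-+ _ _) (+-cong
      (trans (θ-sub _ _) (+-cong (term (u 0F) (v 1F) (w 2F) (v 2F) (w 1F))
                                 (-‿cong (term (u 1F) (v 0F) (w 2F) (v 2F) (w 0F)))))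
      (term (u 2F) (v 0F) (w 1F) (v 1F) (w 0F)))
    where
    term : ∀ u a b c d → θ (u F.* (a F.* b F.- c F.* d)) ≈ θ u * (θ a * θ b - θ c * θ d)
    term u a b c d = trans (θ-* _ _) (*-congˡ (trans (θ-sub _ _) (+-cong (θ-* a b) (-‿cong (θ-* c d)))))

-- The triangle in coordinates taken directly from the brackets, before division by those of e: the
-- form in which the plane supplies it.
record Configuration {f ℓ r ℓ′} {F : CommutativeRing f ℓ} {R : CommutativeRing r ℓ′} {E : Set}
                     (bF : Brackets F E) (bR : Brackets R E) : Set (f ⊔ ℓ ⊔ r ⊔ ℓ′) where
  private
    module F = CommutativeRing F
    module R = CommutativeRing R
    module BF = Brackets bF
    module BR = Brackets bR
  field
    repeated  : ∀ x y → BF.⟦ x , x , y ⟧ F.≈ F.0#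
    zero-R    : ∀ {x y z} → BF.⟦ x , y , z ⟧ F.≈ F.0# → BR.⟦ x , y , z ⟧ R.≈ R.0#
    inverse-R : ∀ {x y z} → ¬ BF.⟦ x , y , z ⟧ F.≈ F.0# → Determinant.HasInverse R BR.⟦ x , y , z ⟧
    a b c e   : E

  ξ : E → Vector F.Carrier 3
  ξ = BracketExpansion.coordinates bF a b c

  field
    abc       : ¬ BF.⟦ a , b , c ⟧ F.≈ F.0#
    e-nonzero : ∀ k → ¬ ξ e k F.≈ F.0#
    side      : ∀ k t → ∃[ p ] ¬ ξ p k F.≈ F.0# × ξ p (next k) F.≈ t F.* ξ p k ×
                ξ p (next (next k)) F.≈ F.0#
    nonzero   : ∀ p → ¬ (∀ k → ξ p k F.≈ F.0#)
    off-sides : ∀ {p} → (∀ k → ¬ ξ p k F.≈ F.0#) → p ≡ e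

-- The brackets over R are the images under θ of those over F, up to the freedom of homogeneous
-- coordinates: one scalar for each element, and a change of basis, which brackets see only as the
-- factor `constant`.
record ProjectivelyEquivalent {f ℓ r ℓ′} {F : CommutativeRing f ℓ} {R : CommutativeRing r ℓ′} {E : Set}
                              (bF : Brackets F E) (bR : Brackets R E) : Set (f ⊔ ℓ ⊔ r ⊔ ℓ′) where
  private
    module F = CommutativeRing F
    module BF = Brackets bF
  open CommutativeRing R
  open Brackets bR
  open Determinant R using (HasInverse)
  field
    θ                    : F.Carrier → Carrier
    θ-embedding          : IsFieldEmbedding F R θ
    weight               : E → Carrier
    weight-inverse       : ∀ p → HasInverse (weight p)
    constant             : Carrier
    constant-inverse     : HasInverse constant
    bracket-proportional : ∀ p q r → ⟦ p , q , r ⟧ ≈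
                           constant * (weight p * weight q * weight r) * θ BF.⟦ p , q , r ⟧

module ProjectiveUniqueness {f ℓ r ℓ′} {F : CommutativeRing f ℓ} (isField : IsDecidableField F)
    {R : CommutativeRing r ℓ′} {E : Set} {bF : Brackets F E} {bR : Brackets R E}
    (configuration : Configuration bF bR) where
  private
    module F where
      open CommutativeRing F public
      open IsDecidableField isField public
      open FieldProperties isField public
      open Brackets bF public
      open BracketExpansion bF public
      open Determinant F public
      open IntegerSolver F public
    open CommutativeRing R
    open Brackets bR
    open BracketExpansion bR
    open IntegerSolver R
    open Determinant R
    open Configuration configuration
    open SetoidReasoning setoid

    Ξ : E → Vector Carrier 3
    Ξ = coordinates a b c

    zero-Ξ : ∀ {p} k → ξ p k F.≈ F.0# → Ξ p k ≈ 0#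
    zero-Ξ 0F = zero-R
    zero-Ξ 1F = zero-R
    zero-Ξ 2F = zero-R

    inverse-Ξ : ∀ {p} k → ¬ ξ p k F.≈ F.0# → HasInverse (Ξ p k)
    inverse-Ξ 0F = inverse-R
    inverse-Ξ 1F = inverse-R
    inverse-Ξ 2F = inverse-R

    module 𝔽 = F.Frame a b c e (F.inverse abc) (λ k → F.inverse (e-nonzero k))
    module ℝ = Frame a b c e (inverse-R abc) (λ k → inverse-Ξ k (e-nonzero k))

    ε ι : Vector F.Carrier 3
    ε = ξ e
    ι k = proj₁ (F.inverse (e-nonzero k))

    ει : ∀ k → ε k F.* ι k F.≈ F.1#
    ει k = proj₂ (F.inverse (e-nonzero k))

    x≈0⇒ξ≈0 : ∀ p k → 𝔽.normalised p k F.≈ F.0# → ξ p k F.≈ F.0#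
    x≈0⇒ξ≈0 p k x≈0 = F.trans (F.sym (𝔽.normalised-* p k)) (F.trans (F.*-congʳ x≈0) (F.zeroˡ _))

    ξ≈0⇒x≈0 : ∀ p k → ξ p k F.≈ F.0# → 𝔽.normalised p k F.≈ F.0#
    ξ≈0⇒x≈0 p k ξ≈0 = F.trans (F.*-congʳ ξ≈0) (F.zeroˡ _)

  -- Selects the coordinate that `bracket-normalised` cancels.
  some-coordinate : ∀ p → ∃[ k ] ¬ ξ p k F.≈ F.0#
  some-coordinate p = case (ξ p 0F F.≈? F.0#) (ξ p 1F F.≈? F.0#) (ξ p 2F F.≈? F.0#)
    where
    case : Dec (ξ p 0F F.≈ F.0#) → Dec (ξ p 1F F.≈ F.0#) → Dec (ξ p 2F F.≈ F.0#) → ∃[ k ] ¬ ξ p k F.≈ F.0#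
    case (no p₀) _ _ = 0F , p₀
    case _ (no p₁) _ = 1F , p₁
    case _ _ (no p₂) = 2F , p₂
    case (yes p₀) (yes p₁) (yes p₂) = contradiction (λ { 0F → p₀ ; 1F → p₁ ; 2F → p₂ }) (nonzero p)

  bracket-F : ∀ p q r → F.⟦ p , q , r ⟧ F.≈ 𝔽.scale F.* F.det (𝔽.normalised p) (𝔽.normalised q) (𝔽.normalised r)
  bracket-F p q r = 𝔽.bracket-normalised p q r (proj₁ (some-coordinate r)) (F.inverse (proj₂ (some-coordinate r)))

  bracket-R : ∀ p q r → ⟦ p , q , r ⟧ ≈ ℝ.scale * det (ℝ.normalised p) (ℝ.normalised q) (ℝ.normalised r)
  bracket-R p q r = ℝ.bracket-normalised p q r (proj₁ (some-coordinate r)) (inverse-Ξ (proj₁ (some-coordinate r)) (proj₂ (some-coordinate r)))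

  private
    vertex : Fin 3 → E
    vertex 0F = a
    vertex 1F = b
    vertex 2F = c

    repeated₂₃ : ∀ x y → F.⟦ y , x , x ⟧ F.≈ F.0#
    repeated₂₃ x y = F.trans (F.sym (F.cycle y x x)) (repeated x y)

    repeated₁₃ : ∀ x y → F.⟦ x , y , x ⟧ F.≈ F.0#
    repeated₁₃ x y = F.trans (F.cycle x x y) (repeated x y)

    vertex-zero : ∀ j k → j ≢ k → ξ (vertex j) k F.≈ F.0#
    vertex-zero 0F 0F j≢k = contradiction ≡.refl j≢k
    vertex-zero 0F 1F _   = repeated a c
    vertex-zero 0F 2F _   = repeated₁₃ a b
    vertex-zero 1F 0F _   = repeated b c
    vertex-zero 1F 1F j≢k = contradiction ≡.refl j≢k
    vertex-zero 1F 2F _   = repeated₂₃ b a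
    vertex-zero 2F 0F _   = repeated₁₃ c b
    vertex-zero 2F 1F _   = repeated₂₃ c a
    vertex-zero 2F 2F j≢k = contradiction ≡.refl j≢k

    vertex-one : ∀ j → ¬ ξ (vertex j) j F.≈ F.0#
    vertex-one 0F = abc
    vertex-one 1F = abc
    vertex-one 2F = abc

    side-normalised : ∀ k t → ∃[ p ] ¬ 𝔽.normalised p k F.≈ F.0# ×
      𝔽.normalised p (next k) F.≈ t F.* 𝔽.normalised p k × 𝔽.normalised p (next (next k)) F.≈ F.0#
    side-normalised k t =
      -- Division by the coordinates of e multiplies the ratio at k by ε k / ε (next k); the
      -- parameter handed to `side` undoes this.
      let p , p₀≉0 , p₁ , p₂ = side k (t F.* ι k F.* ε (next k)) in
      p , (λ x≈0 → p₀≉0 (x≈0⇒ξ≈0 p k x≈0)) ,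
      F.trans (F.*-congʳ p₁) (F.trans
        (F.solve 5 (λ t i e x j → t F.:* i F.:* e F.:* x F.:* j F.:= t F.:* (x F.:* i) F.:* (e F.:* j))
          F.refl t (ι k) (ε (next k)) (ξ p k) (ι (next k)))
        (F.trans (F.*-congˡ (ει (next k))) (F.*-identityʳ _))) ,
      ξ≈0⇒x≈0 p (next (next k)) p₂

    triangle : Triangle F R E
    triangle = record
      { x           = 𝔽.normalised
      ; X           = ℝ.normalised
      ; zero-X      = λ {p} {k} x≈0 → trans (*-congʳ (zero-Ξ k (x≈0⇒ξ≈0 p k x≈0))) (zeroˡ _)
      ; inverse-X   = λ {p} {k} x≉0 → HasInverse-* (inverse-Ξ k (λ ξ≈0 → x≉0 (ξ≈0⇒x≈0 p k ξ≈0)))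
                        (HasInverse-sym (proj₂ (inverse-Ξ k (e-nonzero k))))
      -- Over F and over R the brackets are unit multiples of determinants, so a vanishing
      -- determinant passes from F to R through the brackets.
      ; collinear   = λ p q r det≈0 → *-cancelˡ-inverse ℝ.scale-inverse
                        (trans (sym (bracket-R p q r)) (trans
                          (zero-R (F.trans (bracket-F p q r) (F.trans (F.*-congˡ det≈0) (F.zeroʳ _))))
                          (sym (zeroʳ _))))
      ; vertex      = vertex
      ; vertex-zero = λ {j} {k} j≢k → ξ≈0⇒x≈0 (vertex j) k (vertex-zero j k j≢k)
      ; vertex-one  = λ j x≈0 → vertex-one j (x≈0⇒ξ≈0 (vertex j) j x≈0)
      ; e           = e
      ; x-e         = ει
      ; X-e         = λ k → proj₂ (inverse-Ξ k (e-nonzero k))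
      ; side        = side-normalised
      ; nonzero     = λ p z → nonzero p (λ k → x≈0⇒ξ≈0 p k (z k))
      ; off-sides   = λ {p} n → off-sides (λ k ξ≈0 → n k (ξ≈0⇒x≈0 p k ξ≈0))
      }

  module C = Coordinatisation isField triangle

  open C public using (θ) renaming (isFieldEmbedding to θ-embedding)
  open IsFieldEmbedding θ-embedding

  weight : E → Carrier
  weight p = proj₁ (C.proportional p)

  weight-inverse : ∀ p → HasInverse (weight p)
  weight-inverse p = proj₁ (proj₂ (C.proportional p))

  private
    scaleF⁻¹ = proj₁ 𝔽.scale-inverse

  -- Over R a bracket is `ℝ.scale` times a determinant, while over F the determinant is `scaleF⁻¹`
  -- times the bracket.
  constant : Carrier
  constant = ℝ.scale * θ scaleF⁻¹

  constant-inverse : HasInverse constant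
  constant-inverse = HasInverse-* ℝ.scale-inverse
    (θ 𝔽.scale , θ-inverse (F.trans (F.*-comm _ _) (proj₂ 𝔽.scale-inverse)))

  bracket-proportional : ∀ p q r →
    ⟦ p , q , r ⟧ ≈ constant * (weight p * weight q * weight r) * θ F.⟦ p , q , r ⟧
  bracket-proportional p q r = begin
    ⟦ p , q , r ⟧                                                     ≈⟨ bracket-R p q r ⟩
    ℝ.scale * det (ℝ.normalised p) (ℝ.normalised q) (ℝ.normalised r)
      ≈⟨ *-congˡ (det-cong (scaled p) (scaled q) (scaled r)) ⟩
    ℝ.scale * det (λ k → weight p * θ (x p k)) (λ k → weight q * θ (x q k)) (λ k → weight r * θ (x r k))
      ≈⟨ *-congˡ (solve 12 (λ x₀ x₁ x₂ y₀ y₁ y₂ z₀ z₁ z₂ s t u →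
           detₚ (s :* x₀) (s :* x₁) (s :* x₂) (t :* y₀) (t :* y₁) (t :* y₂) (u :* z₀) (u :* z₁) (u :* z₂)
           := s :* t :* u :* detₚ x₀ x₁ x₂ y₀ y₁ y₂ z₀ z₁ z₂) refl _ _ _ _ _ _ _ _ _ _ _ _) ⟩
    ℝ.scale * (weight p * weight q * weight r * det (θ ∘ x p) (θ ∘ x q) (θ ∘ x r))
      ≈⟨ *-congˡ (*-congˡ (trans (sym (θ-det θ-embedding (x p) (x q) (x r))) (trans (θ-cong detF) (θ-* _ _)))) ⟩
    ℝ.scale * (weight p * weight q * weight r * (θ scaleF⁻¹ * θ F.⟦ p , q , r ⟧))
      ≈⟨ solve 4 (λ a b c d → a :* (b :* (c :* d)) := a :* c :* b :* d) refl _ _ _ _ ⟩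
    constant * (weight p * weight q * weight r) * θ F.⟦ p , q , r ⟧    ∎
    where
    x = 𝔽.normalised
    Δ = F.det (x p) (x q) (x r)

    scaled : ∀ p k → ℝ.normalised p k ≈ weight p * θ (x p k)
    scaled p = proj₂ (proj₂ (C.proportional p))

    detF : Δ F.≈ scaleF⁻¹ F.* F.⟦ p , q , r ⟧
    detF = F.sym (F.trans (F.*-congˡ (bracket-F p q r)) (F.trans (F.sym (F.*-assoc _ _ _))
      (F.trans (F.*-congʳ (F.trans (F.*-comm _ _) (proj₂ 𝔽.scale-inverse))) (F.*-identityˡ Δ))))

  projectivelyEquivalent : ProjectivelyEquivalent bF bR
  projectivelyEquivalent = record
    { θ                    = θ
    ; θ-embedding          = θ-embedding
    ; weight               = weight
    ; weight-inverse       = weight-inverse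
    ; constant             = constant
    ; constant-inverse     = constant-inverse
    ; bracket-proportional = bracket-proportional
    }

-- Linear algebra in F³

module CrossProduct {c ℓ} (F : CommutativeRing c ℓ) where
  open CommutativeRing F
  open SemiringSum semiring using (sum)
  open IntegerSolver F
  open Determinant F
  open SetoidReasoning setoid

  -- In this form `p on L` is by computation `dot (coord L) (coord p) ≈ 0#`.
  dot : Vector Carrier 3 → Vector Carrier 3 → Carrier
  dot u v = sum (λ k → u k * v k)

  -- The final zero is the empty sum in which `sum` ends; with it the expression evaluates exactly
  -- to `dot`.
  dotₚ : ∀ {n} (u₀ u₁ u₂ v₀ v₁ v₂ : Polynomial n) → Polynomial n
  dotₚ u₀ u₁ u₂ v₀ v₁ v₂ = u₀ :* v₀ :+ (u₁ :* v₁ :+ (u₂ :* v₂ :+ con (+ 0)))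

  cross : Vector Carrier 3 → Vector Carrier 3 → Vector Carrier 3
  cross u v 0F = u 1F * v 2F - u 2F * v 1F
  cross u v 1F = u 2F * v 0F - u 0F * v 2F
  cross u v 2F = u 0F * v 1F - u 1F * v 0F

  dot-congʳ : ∀ u {v v′} → (∀ k → v k ≈ v′ k) → dot u v ≈ dot u v′
  dot-congʳ u e = +-cong (*-congˡ (e 0F)) (+-cong (*-congˡ (e 1F)) (+-congʳ (*-congˡ (e 2F))))

  dot-linear : ∀ u s v t w → dot u (λ k → s * (v k + t * w k)) ≈ s * (dot u v + t * dot u w)
  dot-linear u s v t w = solve 11 (λ u₀ u₁ u₂ v₀ v₁ v₂ w₀ w₁ w₂ s t →
    dotₚ u₀ u₁ u₂ (s :* (v₀ :+ t :* w₀)) (s :* (v₁ :+ t :* w₁)) (s :* (v₂ :+ t :* w₂))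
    := s :* (dotₚ u₀ u₁ u₂ v₀ v₁ v₂ :+ t :* dotₚ u₀ u₁ u₂ w₀ w₁ w₂)) refl _ _ _ _ _ _ _ _ _ s t

  dot-scale : ∀ u s v → dot u (λ k → s * v k) ≈ s * dot u v
  dot-scale u s v = solve 7 (λ u₀ u₁ u₂ v₀ v₁ v₂ s →
    dotₚ u₀ u₁ u₂ (s :* v₀) (s :* v₁) (s :* v₂) := s :* dotₚ u₀ u₁ u₂ v₀ v₁ v₂) refl _ _ _ _ _ _ s

  dot-pencil : ∀ u t w v → dot (λ k → u k - t * w k) v ≈ dot u v - t * dot w v
  dot-pencil u t w v = solve 10 (λ u₀ u₁ u₂ v₀ v₁ v₂ w₀ w₁ w₂ t →
    dotₚ (u₀ :- t :* w₀) (u₁ :- t :* w₁) (u₂ :- t :* w₂) v₀ v₁ v₂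
    := dotₚ u₀ u₁ u₂ v₀ v₁ v₂ :- t :* dotₚ w₀ w₁ w₂ v₀ v₁ v₂) refl _ _ _ _ _ _ _ _ _ t

  det-dot₀ : ∀ u v w → det u v w ≈ dot (cross v w) u
  det-dot₀ u v w = solve 9 (λ u₀ u₁ u₂ v₀ v₁ v₂ w₀ w₁ w₂ →
    detₚ u₀ u₁ u₂ v₀ v₁ v₂ w₀ w₁ w₂
    := dotₚ (v₁ :* w₂ :- v₂ :* w₁) (v₂ :* w₀ :- v₀ :* w₂) (v₀ :* w₁ :- v₁ :* w₀) u₀ u₁ u₂)
    refl _ _ _ _ _ _ _ _ _

  det-dot₁ : ∀ u v w → det u v w ≈ dot (cross w u) v
  det-dot₁ u v w = solve 9 (λ u₀ u₁ u₂ v₀ v₁ v₂ w₀ w₁ w₂ →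
    detₚ u₀ u₁ u₂ v₀ v₁ v₂ w₀ w₁ w₂
    := dotₚ (w₁ :* u₂ :- w₂ :* u₁) (w₂ :* u₀ :- w₀ :* u₂) (w₀ :* u₁ :- w₁ :* u₀) v₀ v₁ v₂)
    refl _ _ _ _ _ _ _ _ _

  det-dot₂ : ∀ u v w → det u v w ≈ dot (cross u v) w
  det-dot₂ u v w = solve 9 (λ u₀ u₁ u₂ v₀ v₁ v₂ w₀ w₁ w₂ →
    detₚ u₀ u₁ u₂ v₀ v₁ v₂ w₀ w₁ w₂
    := dotₚ (u₁ :* v₂ :- u₂ :* v₁) (u₂ :* v₀ :- u₀ :* v₂) (u₀ :* v₁ :- u₁ :* v₀) w₀ w₁ w₂)
    refl _ _ _ _ _ _ _ _ _

  cross-orthogonalˡ : ∀ u v → dot u (cross u v) ≈ 0#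
  cross-orthogonalˡ u v = solve 6 (λ u₀ u₁ u₂ v₀ v₁ v₂ →
    dotₚ u₀ u₁ u₂ (u₁ :* v₂ :- u₂ :* v₁) (u₂ :* v₀ :- u₀ :* v₂) (u₀ :* v₁ :- u₁ :* v₀) := con (+ 0))
    refl _ _ _ _ _ _

  cross-orthogonalʳ : ∀ u v → dot v (cross u v) ≈ 0#
  cross-orthogonalʳ u v = solve 6 (λ u₀ u₁ u₂ v₀ v₁ v₂ →
    dotₚ v₀ v₁ v₂ (u₁ :* v₂ :- u₂ :* v₁) (u₂ :* v₀ :- u₀ :* v₂) (u₀ :* v₁ :- u₁ :* v₀) := con (+ 0))
    refl _ _ _ _ _ _

  dot-comm : ∀ u v → dot u v ≈ dot v u
  dot-comm u v = +-cong (*-comm _ _) (+-cong (*-comm _ _) (+-congʳ (*-comm _ _)))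

  cross-vanishesˡ : ∀ u v → dot (cross u v) u ≈ 0#
  cross-vanishesˡ u v = trans (dot-comm (cross u v) u) (cross-orthogonalˡ u v)

  cross-vanishesʳ : ∀ u v → dot (cross u v) v ≈ 0#
  cross-vanishesʳ u v = trans (dot-comm (cross u v) v) (cross-orthogonalʳ u v)

  private
    flip-zero : ∀ {a b c d} → a * b - c * d ≈ 0# → a * b ≈ c * d
    flip-zero {a} {b} {c} {d} e = begin
      a * b                    ≈⟨ solve 4 (λ a b c d → a :* b := (a :* b :- c :* d) :+ c :* d) refl a b c d ⟩
      (a * b - c * d) + c * d  ≈⟨ +-congʳ e ⟩
      0# + c * d               ≈⟨ +-identityˡ _ ⟩
      c * d                    ∎

  parallel : ∀ u v → (∀ k → cross u v k ≈ 0#) → ∀ j k → u j * v k ≈ u k * v j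
  parallel u v e 0F 0F = refl
  parallel u v e 0F 1F = flip-zero (e 2F)
  parallel u v e 0F 2F = sym (flip-zero (e 1F))
  parallel u v e 1F 0F = sym (flip-zero (e 2F))
  parallel u v e 1F 1F = refl
  parallel u v e 1F 2F = flip-zero (e 0F)
  parallel u v e 2F 0F = flip-zero (e 1F)
  parallel u v e 2F 1F = sym (flip-zero (e 0F))
  parallel u v e 2F 2F = refl

  -- Proportionality of u and v without division: if u k is nonzero, every zero of the form u is a
  -- zero of v.
  parallel-dot : ∀ u v → (∀ k → cross u v k ≈ 0#) → ∀ k w → u k * dot v w ≈ v k * dot u w
  parallel-dot u v e k w = begin
    u k * dot v w     ≈⟨ pull (u k) v ⟨
    dot (λ j → u k * v j) w
      ≈⟨ +-cong (*-congʳ (turn 0F)) (+-cong (*-congʳ (turn 1F)) (+-congʳ (*-congʳ (turn 2F)))) ⟩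
    dot (λ j → v k * u j) w  ≈⟨ pull (v k) u ⟩
    v k * dot u w     ∎
    where
    pull : ∀ s u → dot (λ j → s * u j) w ≈ s * dot u w
    pull s u = solve 7 (λ u₀ u₁ u₂ v₀ v₁ v₂ s →
      dotₚ (s :* u₀) (s :* u₁) (s :* u₂) v₀ v₁ v₂ := s :* dotₚ u₀ u₁ u₂ v₀ v₁ v₂) refl _ _ _ _ _ _ s

    turn : ∀ j → u k * v j ≈ v k * u j
    turn j = trans (parallel u v e k j) (*-comm _ _)

  basisVector : Fin 3 → Vector Carrier 3
  basisVector 0F = 1# ∷ᶠ 0# ∷ᶠ 0# ∷ᶠ []ᶠ
  basisVector 1F = 0# ∷ᶠ 1# ∷ᶠ 0# ∷ᶠ []ᶠ
  basisVector 2F = 0# ∷ᶠ 0# ∷ᶠ 1# ∷ᶠ []ᶠ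

  dot-basisVector : ∀ u k → dot u (basisVector k) ≈ u k
  dot-basisVector u 0F = solve 3 (λ a b c → dotₚ a b c (con (+ 1)) (con (+ 0)) (con (+ 0)) := a) refl _ _ _
  dot-basisVector u 1F = solve 3 (λ a b c → dotₚ a b c (con (+ 0)) (con (+ 1)) (con (+ 0)) := b) refl _ _ _
  dot-basisVector u 2F = solve 3 (λ a b c → dotₚ a b c (con (+ 0)) (con (+ 0)) (con (+ 1)) := c) refl _ _ _

  cross-zero : ∀ u v → (∀ w → det u v w ≈ 0#) → ∀ k → cross u v k ≈ 0#
  cross-zero u v e k = trans (sym (dot-basisVector (cross u v) k))
    (trans (sym (det-dot₂ u v (basisVector k))) (e (basisVector k)))

  -- Cramer's rule in the basis a, b, c under a linear form L; for a line L through two of the three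
  -- points a single term survives.
  cramer-dot : ∀ L a b c u → det a b c * dot L u ≈
               dot L a * det u b c + dot L b * det a u c + dot L c * det a b u
  cramer-dot L a b c u = solve 15 (λ L₀ L₁ L₂ a₀ a₁ a₂ b₀ b₁ b₂ c₀ c₁ c₂ u₀ u₁ u₂ →
      detₚ a₀ a₁ a₂ b₀ b₁ b₂ c₀ c₁ c₂ :* dotₚ L₀ L₁ L₂ u₀ u₁ u₂ :=
      dotₚ L₀ L₁ L₂ a₀ a₁ a₂ :* detₚ u₀ u₁ u₂ b₀ b₁ b₂ c₀ c₁ c₂
        :+ dotₚ L₀ L₁ L₂ b₀ b₁ b₂ :* detₚ a₀ a₁ a₂ u₀ u₁ u₂ c₀ c₁ c₂
        :+ dotₚ L₀ L₁ L₂ c₀ c₁ c₂ :* detₚ a₀ a₁ a₂ b₀ b₁ b₂ u₀ u₁ u₂)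
    refl _ _ _ _ _ _ _ _ _ _ _ _ _ _ _

  cramer : ∀ a b c u k → det u b c * a k + (det a u c * b k + det a b u * c k) ≈ det a b c * u k
  cramer a b c u k = begin
    det u b c * a k + (det a u c * b k + det a b u * c k)
      ≈⟨ +-cong (*-congˡ (entry a)) (+-cong (*-congˡ (entry b)) (*-congˡ (entry c))) ⟨
    det u b c * dot L a + (det a u c * dot L b + det a b u * dot L c)
      ≈⟨ solve 6 (λ p q r a b c → p :* a :+ (q :* b :+ r :* c) := a :* p :+ b :* q :+ c :* r) refl _ _ _ _ _ _ ⟩
    dot L a * det u b c + dot L b * det a u c + dot L c * det a b u  ≈⟨ cramer-dot L a b c u ⟨
    det a b c * dot L u  ≈⟨ *-congˡ (entry u) ⟩
    det a b c * u k      ∎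
    where
    L = basisVector k
    entry : ∀ v → dot L v ≈ v k
    entry v = trans (dot-comm L v) (dot-basisVector v k)

  det-repeated : ∀ u v → det u u v ≈ 0#
  det-repeated u v = solve 6 (λ u₀ u₁ u₂ v₀ v₁ v₂ → detₚ u₀ u₁ u₂ u₀ u₁ u₂ v₀ v₁ v₂ := con (+ 0))
    refl _ _ _ _ _ _

  opaque
    det-swap₁₂ : ∀ u v w → det v u w ≈ - det u v w
    det-swap₁₂ u v w = solve 9 (λ u₀ u₁ u₂ v₀ v₁ v₂ w₀ w₁ w₂ →
      detₚ v₀ v₁ v₂ u₀ u₁ u₂ w₀ w₁ w₂ := :- detₚ u₀ u₁ u₂ v₀ v₁ v₂ w₀ w₁ w₂) refl _ _ _ _ _ _ _ _ _

    det-swap₂₃ : ∀ u v w → det u w v ≈ - det u v w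
    det-swap₂₃ u v w = solve 9 (λ u₀ u₁ u₂ v₀ v₁ v₂ w₀ w₁ w₂ →
      detₚ u₀ u₁ u₂ w₀ w₁ w₂ v₀ v₁ v₂ := :- detₚ u₀ u₁ u₂ v₀ v₁ v₂ w₀ w₁ w₂) refl _ _ _ _ _ _ _ _ _

    det-plücker : ∀ x₁ x₂ y₁ y₂ w → det x₁ x₂ w * det y₁ y₂ w ≈
                  det y₁ x₂ w * det x₁ y₂ w + det y₂ x₂ w * det y₁ x₁ w
    det-plücker x₁ x₂ y₁ y₂ w = solve 15 (λ L₀ L₁ L₂ a₀ a₁ a₂ b₀ b₁ b₂ c₀ c₁ c₂ u₀ u₁ u₂ →
        detₚ L₀ L₁ L₂ a₀ a₁ a₂ u₀ u₁ u₂ :* detₚ b₀ b₁ b₂ c₀ c₁ c₂ u₀ u₁ u₂ :=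
        detₚ b₀ b₁ b₂ a₀ a₁ a₂ u₀ u₁ u₂ :* detₚ L₀ L₁ L₂ c₀ c₁ c₂ u₀ u₁ u₂
         :+ detₚ c₀ c₁ c₂ a₀ a₁ a₂ u₀ u₁ u₂ :* detₚ b₀ b₁ b₂ L₀ L₁ L₂ u₀ u₁ u₂)
      refl _ _ _ _ _ _ _ _ _ _ _ _ _ _ _

  determinantBrackets : ∀ {E : Set} → (E → Vector Carrier 3) → Brackets F E
  determinantBrackets v = record
    { ⟦_,_,_⟧ = λ x y z → det (v x) (v y) (v z)
    ; swap₁₂  = λ x y z → det-swap₁₂ (v x) (v y) (v z)
    ; swap₂₃  = λ x y z → det-swap₂₃ (v x) (v y) (v z)
    ; plücker = λ x₁ x₂ y₁ y₂ w → det-plücker (v x₁) (v x₂) (v y₁) (v y₂) (v w)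
    }

module Meet {c ℓ} {F : CommutativeRing c ℓ} (isField : IsDecidableField F) where
  open CommutativeRing F
  open IsDecidableField isField
  open FieldProperties isField
  open CrossProduct F
  open IntegerSolver F
  open SetoidReasoning setoid

  IsZero : Vector Carrier 3 → Set ℓ
  IsZero v = ∀ k → v k ≈ 0#

  isZero? : ∀ v → Dec (IsZero v)
  isZero? v = case (v 0F ≈? 0#) (v 1F ≈? 0#) (v 2F ≈? 0#)
    where
    case : Dec (v 0F ≈ 0#) → Dec (v 1F ≈ 0#) → Dec (v 2F ≈ 0#) → Dec (IsZero v)
    case (yes p) (yes q) (yes r) = yes λ { 0F → p ; 1F → q ; 2F → r }
    case (no p)  _       _       = no λ z → p (z 0F)
    case _       (no q)  _       = no λ z → q (z 1F)
    case _       _       (no r)  = no λ z → r (z 2F)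

  nonzero-coordinate : ∀ {v} → ¬ IsZero v → ∃[ k ] ¬ v k ≈ 0#
  nonzero-coordinate {v} v≉0 = case (v 0F ≈? 0#) (v 1F ≈? 0#) (v 2F ≈? 0#)
    where
    case : Dec (v 0F ≈ 0#) → Dec (v 1F ≈ 0#) → Dec (v 2F ≈ 0#) → ∃[ k ] ¬ v k ≈ 0#
    case (no p)  _       _       = 0F , p
    case _       (no q)  _       = 1F , q
    case _       _       (no r)  = 2F , r
    case (yes p) (yes q) (yes r) = contradiction (λ { 0F → p ; 1F → q ; 2F → r }) v≉0

  somePoint : ∀ L → ∃[ p ] ¬ IsZero p × dot L p ≈ 0#
  somePoint L = case (L 0F ≈? 0#)
    where
    case : Dec (L 0F ≈ 0#) → ∃[ p ] ¬ IsZero p × dot L p ≈ 0#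
    case (yes L₀) = basisVector 0F , (λ z → 1≉0 (z 0F)) , trans (dot-basisVector L 0F) L₀
    case (no L₀)  = (L 1F ∷ᶠ - L 0F ∷ᶠ 0# ∷ᶠ []ᶠ) ,
      (λ z → L₀ (trans (solve 1 (λ x → x := :- (:- x)) refl _)
               (trans (-‿cong (z 1F)) (solve 0 (:- con (+ 0) := con (+ 0)) refl)))) ,
      solve 3 (λ a b c → dotₚ a b c b (:- a) (con (+ 0)) := con (+ 0)) refl (L 0F) (L 1F) (L 2F)

  -- The cross product is a common point unless it vanishes; then L′ is a multiple of L, possibly
  -- zero, and every point of L will do.
  meet : ∀ {L} → ¬ IsZero L → ∀ L′ → ∃[ p ] ¬ IsZero p × dot L p ≈ 0# × dot L′ p ≈ 0#
  meet {L} L≉0 L′ = case (isZero? (cross L L′))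
    where
    case : Dec (IsZero (cross L L′)) → ∃[ p ] ¬ IsZero p × dot L p ≈ 0# × dot L′ p ≈ 0#
    case (no n)  = cross L L′ , n , cross-orthogonalˡ L L′ , cross-orthogonalʳ L L′
    case (yes z) =
      let p , p≉0 , Lp = somePoint L ; k , Lₖ = nonzero-coordinate L≉0 in
      p , p≉0 , Lp ,
      *-zero-factor Lₖ (trans (parallel-dot L L′ z k p) (trans (*-congˡ Lp) (zeroʳ _)))

-- Bases of a restriction of PG(2,F)

⊆∧∣∣≥⇒≡ : ∀ {n} {p q : Subset n} → p ⊆ q → ∣ q ∣ ≤ ∣ p ∣ → p ≡ q
⊆∧∣∣≥⇒≡ {p = p} {q} p⊆q ∣q∣≤∣p∣ = ⊆-antisym p⊆q q⊆p
  where
  q⊆p : q ⊆ p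
  q⊆p {x} x∈q = case (x ∈? p)
    where
    case : Dec (x ∈ p) → x ∈ p
    case (yes x∈p) = x∈p
    case (no x∉p)  = contradiction (p⊂q⇒∣p∣<∣q∣ (p⊆q , x , x∈q , x∉p)) (ℕₚ.≤⇒≯ ∣q∣≤∣p∣)

∣⁅x⁆∪p∣ : ∀ {n} (x : Fin n) p → x ∉ p → ∣ ⁅ x ⁆ ∪ p ∣ ≡ suc ∣ p ∣
∣⁅x⁆∪p∣ zero    (outside ∷ p) _   = ≡.cong (λ p → suc ∣ p ∣) (∪-identityˡ p)
∣⁅x⁆∪p∣ zero    (inside ∷ p)  x∉p = contradiction here x∉p
∣⁅x⁆∪p∣ (suc x) (outside ∷ p) x∉p = ∣⁅x⁆∪p∣ x p (x∉p ∘ there)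
∣⁅x⁆∪p∣ (suc x) (inside ∷ p)  x∉p = ≡.cong suc (∣⁅x⁆∪p∣ x p (x∉p ∘ there))

x∈p⇒⁅x⁆∪p≡p : ∀ {n} {x : Fin n} {p} → x ∈ p → ⁅ x ⁆ ∪ p ≡ p
x∈p⇒⁅x⁆∪p≡p {x = x} {p} x∈p = ⊆-antisym
  (λ y∈ → [ (λ y∈⁅x⁆ → ≡.subst (_∈ p) (≡.sym (x∈⁅y⁆⇒x≡y x y∈⁅x⁆)) x∈p) , id ]′ (x∈p∪q⁻ ⁅ x ⁆ p y∈))
  (λ y∈p → x∈p∪q⁺ (inj₂ y∈p))

∣entries∣≤ : ∀ {n k} (Z : Vec (Fin n) k) → ∣ entries Z ∣ ≤ k
∣entries∣≤ {n} []  = ℕₚ.≤-reflexive (∣⊥∣≡0 n)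
∣entries∣≤ (x ∷ Z) = case (x ∈? entries Z)
  where
  case : Dec (x ∈ entries Z) → ∣ ⁅ x ⁆ ∪ entries Z ∣ ≤ suc _
  case (yes x∈Z) = ≡.subst (λ p → ∣ p ∣ ≤ _) (≡.sym (x∈p⇒⁅x⁆∪p≡p x∈Z)) (ℕₚ.m≤n⇒m≤1+n (∣entries∣≤ Z))
  case (no x∉Z)  = ≡.subst (_≤ _) (≡.sym (∣⁅x⁆∪p∣ x (entries Z) x∉Z)) (s≤s (∣entries∣≤ Z))

-- A repeated entry would leave at most k elements.
∣entries∣-head : ∀ {n k} (x : Fin n) (Z : Vec (Fin n) k) → ∣ entries (x ∷ Z) ∣ ≡ suc k → x ∉ entries Z
∣entries∣-head x Z size x∈Z = ℕₚ.1+n≰n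
  (ℕₚ.≤-trans (ℕₚ.≤-reflexive (≡.trans (≡.sym size) (≡.cong ∣_∣ (x∈p⇒⁅x⁆∪p≡p x∈Z)))) (∣entries∣≤ Z))

∣entries∣-tail : ∀ {n k} (x : Fin n) (Z : Vec (Fin n) k) → ∣ entries (x ∷ Z) ∣ ≡ suc k → ∣ entries Z ∣ ≡ k
∣entries∣-tail x Z size = ℕₚ.suc-injective
  (≡.trans (≡.sym (∣⁅x⁆∪p∣ x (entries Z) (∣entries∣-head x Z size))) size)

module _ {n} (x y z : Fin n) where
  private
    Z = x ∷ y ∷ z ∷ []

  x∈entries : x ∈ entries Z
  x∈entries = x∈p∪q⁺ (inj₁ (x∈⁅x⁆ x))

  y∈entries : y ∈ entries Z
  y∈entries = x∈p∪q⁺ (inj₂ (x∈p∪q⁺ (inj₁ (x∈⁅x⁆ y))))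

  z∈entries : z ∈ entries Z
  z∈entries = x∈p∪q⁺ (inj₂ (x∈p∪q⁺ (inj₂ (x∈p∪q⁺ (inj₁ (x∈⁅x⁆ z))))))

  ∈entries⁻ : ∀ {i} → i ∈ entries Z → i ≡ x ⊎ i ≡ y ⊎ i ≡ z
  ∈entries⁻ {i} i∈ = [ inj₁ ∘ x∈⁅y⁆⇒x≡y x , inj₂ ∘ tail ]′ (x∈p∪q⁻ ⁅ x ⁆ _ i∈)
    where
    last : i ∈ ⁅ z ⁆ ∪ ⊥ → i ≡ z
    last i∈ = [ x∈⁅y⁆⇒x≡y z , (λ i∈⊥ → contradiction i∈⊥ ∉⊥) ]′ (x∈p∪q⁻ ⁅ z ⁆ ⊥ i∈)

    tail : i ∈ ⁅ y ⁆ ∪ (⁅ z ⁆ ∪ ⊥) → i ≡ y ⊎ i ≡ z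
    tail i∈ = [ inj₁ ∘ x∈⁅y⁆⇒x≡y y , inj₂ ∘ last ]′ (x∈p∪q⁻ ⁅ y ⁆ _ i∈)

  distinct⇒∣entries∣ : x ≢ y → x ≢ z → y ≢ z → ∣ entries Z ∣ ≡ 3
  distinct⇒∣entries∣ x≢y x≢z y≢z =
    ≡.trans (∣⁅x⁆∪p∣ x _ x∉) (≡.cong suc (≡.trans (∣⁅x⁆∪p∣ y _ y∉) (≡.cong suc
      (≡.trans (∣⁅x⁆∪p∣ z ⊥ ∉⊥) (≡.cong suc (∣⊥∣≡0 n))))))
    where
    ∉⁅z⁆ : ∀ {i} → i ≢ z → i ∉ ⁅ z ⁆ ∪ ⊥
    ∉⁅z⁆ i≢z i∈ = [ i≢z ∘ x∈⁅y⁆⇒x≡y z , ∉⊥ ]′ (x∈p∪q⁻ ⁅ z ⁆ ⊥ i∈)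

    y∉ : y ∉ ⁅ z ⁆ ∪ ⊥
    y∉ = ∉⁅z⁆ y≢z

    x∉ : x ∉ ⁅ y ⁆ ∪ (⁅ z ⁆ ∪ ⊥)
    x∉ x∈ = [ x≢y ∘ x∈⁅y⁆⇒x≡y y , ∉⁅z⁆ x≢z ]′ (x∈p∪q⁻ ⁅ y ⁆ _ x∈)

  ∣entries∣⇒distinct : ∣ entries Z ∣ ≡ 3 → x ≢ y × x ≢ z × y ≢ z
  ∣entries∣⇒distinct size =
    (λ { ≡.refl → x∉ (x∈p∪q⁺ (inj₁ (x∈⁅x⁆ x))) }) ,
    (λ { ≡.refl → x∉ (x∈p∪q⁺ (inj₂ (x∈p∪q⁺ (inj₁ (x∈⁅x⁆ x))))) }) ,
    (λ { ≡.refl → y∉ (x∈p∪q⁺ (inj₁ (x∈⁅x⁆ y))) })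
    where
    x∉ = ∣entries∣-head x (y ∷ z ∷ []) size
    y∉ = ∣entries∣-head y (z ∷ []) (∣entries∣-tail x (y ∷ z ∷ []) size)

-- Linear independence and determinants

module FiniteSums {c ℓ} (F : CommutativeRing c ℓ) where
  open CommutativeRing F hiding (zero)
  open SemiringSum semiring
  open CrossProduct F using (dot)
  open IntegerSolver F
  open SetoidReasoning setoid

  sum-zero : ∀ {n} (f : Vector Carrier n) → (∀ i → f i ≈ 0#) → sum f ≈ 0#
  sum-zero {n} f e = trans (sum-cong-≋ e) (sum-replicate-zero n)

  sum-single : ∀ {n} (f : Vector Carrier n) x → (∀ {i} → i ≢ x → f i ≈ 0#) → sum f ≈ f x
  sum-single {suc n} f x e = begin
    sum f                      ≈⟨ sum-remove {i = x} f ⟩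
    f x + sum (removeAt f x)   ≈⟨ +-congˡ (sum-zero _ (λ i → e (punchInᵢ≢i x i))) ⟩
    f x + 0#                   ≈⟨ +-identityʳ _ ⟩
    f x                        ∎

  -- A linear form turns a dependency of vectors into one of scalars; the two summations are
  -- exchanged.
  sum-dot : ∀ {n} (a : Vector Carrier n) (v : Fin n → Vector Carrier 3) (L : Vector Carrier 3) →
            (∀ k → sum (λ i → a i * v i k) ≈ 0#) → sum (λ i → a i * dot L (v i)) ≈ 0#
  sum-dot a v L e = begin
    sum (λ i → a i * dot L (v i))
      ≈⟨ sum-cong-≋ (λ i → trans (*-distribˡ-sum (a i) (λ k → L k * v i k))
           (sum-cong-≋ {3} (λ k → solve 3 (λ a l v → a :* (l :* v) := l :* (a :* v)) refl (a i) (L k) (v i k)))) ⟩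
    sum (λ i → sum (λ k → L k * (a i * v i k)))   ≈⟨ ∑-comm (λ i k → L k * (a i * v i k)) ⟩
    sum (λ k → sum (λ i → L k * (a i * v i k)))
      ≈⟨ sum-zero {3} _ (λ k → trans (sym (*-distribˡ-sum (L k) (λ i → a i * v i k)))
           (trans (*-congˡ (e k)) (zeroʳ _))) ⟩
    0#                                            ∎

  indicator : ∀ {n} → Fin n → Carrier → Vector Carrier n
  indicator x s i = if does (i ≟ x) then s else 0#

  indicator-≡ : ∀ {n} (x : Fin n) s → indicator x s x ≡ s
  indicator-≡ x s = ≡.cong (if_then s else 0#) (dec-true (x ≟ x) ≡.refl)

  indicator-≢ : ∀ {n} (x : Fin n) s {i} → i ≢ x → indicator x s i ≡ 0#
  indicator-≢ x s {i} i≢x = ≡.cong (if_then s else 0#) (dec-false (i ≟ x) i≢x)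

  sum-indicator : ∀ {n} (x : Fin n) s (f : Vector Carrier n) → sum (λ i → indicator x s i * f i) ≈ s * f x
  sum-indicator x s f = trans
    (sum-single _ x (λ i≢x → trans (*-congʳ (reflexive (indicator-≢ x s i≢x))) (zeroˡ _)))
    (*-congʳ (reflexive (indicator-≡ x s)))

-- Inverses are found by search; tightness of the apartness relation excludes that the search fails at a
-- nonzero element.
module _ {c ℓ₁ ℓ₂} (F : HeytingField c ℓ₁ ℓ₂) {q : ℕ} (order : HasOrder F q) where
  private
    module H = HeytingField F
    open CommutativeRing (fieldRing F)
    open Determinant (fieldRing F) using (HasInverse)
    open Inverse order using (to; from; to-cong; from-cong; strictlyInverseʳ)

    to-injective : ∀ {x y} → to x ≡ to y → x ≈ y
    to-injective {x} {y} e = trans (sym (strictlyInverseʳ x)) (trans (from-cong e) (strictlyInverseʳ y))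

    _≈?_ : ∀ x y → Dec (x ≈ y)
    x ≈? y = Dec.map′ to-injective to-cong (to x ≟ to y)

    inverse : ∀ {x} → ¬ x ≈ 0# → HasInverse x
    inverse {x} x≉0 = case (any? (λ i → (x * from i) ≈? 1#))
      where
      case : Dec (∃[ i ] x * from i ≈ 1#) → HasInverse x
      case (yes (i , xi)) = from i , xi
      case (no none)      = contradiction (proj₁ (H.tight x 0#) ¬x#0) x≉0
        where
        ¬x#0 : ¬ (x H.# 0#)
        ¬x#0 x#0 with H.#⇒invertible x#0
        ... | t , _ , xt = none (to t , (begin
          x * from (to t)  ≈⟨ *-congˡ (strictlyInverseʳ t) ⟩
          x * t            ≈⟨ *-congʳ (trans (+-congˡ (RingProperties.-0#≈0# ring)) (+-identityʳ x)) ⟨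
          (x - 0#) * t     ≈⟨ xt ⟩
          1#               ∎))
          where open SetoidReasoning setoid

    -- The difference 1 - 0 is invertible, so 1 is apart from 0, whereas equal elements are never
    -- apart.
    1≉0 : ¬ 1# ≈ 0#
    1≉0 1≈0 = proj₂ (H.tight 1# 0#) 1≈0 (H.invertible⇒# {1#} {0#} (1# , invˡ , inv))
      where
      inv : (1# - 0#) * 1# ≈ 1#
      inv = trans (*-identityʳ _) (trans (+-congˡ (RingProperties.-0#≈0# ring)) (+-identityʳ 1#))

      invˡ : 1# * (1# - 0#) ≈ 1#
      invˡ = trans (*-comm _ _) inv

  finiteField-isDecidableField : IsDecidableField (fieldRing F)
  finiteField-isDecidableField = record { _≈?_ = _≈?_ ; inverse = inverse ; 1≉0 = 1≉0 }

module Independence {c ℓ₁ ℓ₂} (F : HeytingField c ℓ₁ ℓ₂) (isField : IsDecidableField (fieldRing F)) where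
  open CommutativeRing (fieldRing F)
  open ProjectivePlane F
  open IsDecidableField isField
  open FieldProperties isField
  open Determinant (fieldRing F)
  open CrossProduct (fieldRing F)
  open FiniteSums (fieldRing F)
  open SemiringSum semiring using (sum; sum-cong-≋; ∑-distrib-+)
  open IntegerSolver (fieldRing F)
  open Meet isField
  open SetoidReasoning setoid

  module _ {n} (v : Fin n → Point) where
    private
      w : Fin n → Vector Carrier 3
      w = coord ∘ v

    private
      det-turn : ∀ u v w → ¬ det u v w ≈ 0# → ¬ det v w u ≈ 0#
      det-turn u v w n e = n (trans (det-dot₀ u v w) (trans (sym (det-dot₂ v w u)) e))

      det-turn′ : ∀ u v w → ¬ det u v w ≈ 0# → ¬ det w u v ≈ 0#
      det-turn′ u v w n = det-turn v w u (det-turn u v w n)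

    -- The form `cross (w y) (w z)` kills w y and w z, so applied to a dependency it leaves a x
    -- times the determinant; cyclic rotation of the triple treats y and z.
    det≉0⇒independent : ∀ x y z → ¬ det (w x) (w y) (w z) ≈ 0# →
                        LinearlyIndependent v (entries (x ∷ y ∷ z ∷ []))
    det≉0⇒independent x y z det≉0 a a-supported dependent i = case (supported i)
      where
      Supported : Fin n → Fin n → Fin n → Set _
      Supported x y z = ∀ j → a j ≈ 0# ⊎ j ≡ x ⊎ j ≡ y ⊎ j ≡ z

      supported : Supported x y z
      supported j = test (j ∈? entries (x ∷ y ∷ z ∷ []))
        where
        test : Dec (j ∈ entries (x ∷ y ∷ z ∷ [])) → a j ≈ 0# ⊎ j ≡ x ⊎ j ≡ y ⊎ j ≡ z
        test (yes j∈) = inj₂ (∈entries⁻ x y z j∈)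
        test (no j∉)  = inj₁ (a-supported j j∉)

      supported-turn : ∀ {x y z} → Supported x y z → Supported y z x
      supported-turn s j = [ inj₁ , inj₂ ∘ [ inj₂ ∘ inj₂ , [ inj₁ , inj₂ ∘ inj₁ ]′ ]′ ]′ (s j)

      coefficient : ∀ x y z → Supported x y z → ¬ det (w x) (w y) (w z) ≈ 0# → a x ≈ 0#
      coefficient x y z s det≉0 = *-zero-factor (det≉0 ∘ trans (det-dot₀ (w x) (w y) (w z))) (trans (*-comm _ _) (begin
        a x * dot L (w x)              ≈⟨ sum-single _ x (λ {j} j≢x → vanish j≢x (s j)) ⟨
        sum (λ i → a i * dot L (w i))  ≈⟨ sum-dot a w L dependent ⟩
        0#                             ∎))
        where
        L = cross (w y) (w z)
        vanish : ∀ {j} → j ≢ x → a j ≈ 0# ⊎ j ≡ x ⊎ j ≡ y ⊎ j ≡ z → a j * dot L (w j) ≈ 0#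
        vanish _   (inj₁ aj≈0)                    = trans (*-congʳ aj≈0) (zeroˡ _)
        vanish j≢x (inj₂ (inj₁ j≡x))              = contradiction j≡x j≢x
        vanish _   (inj₂ (inj₂ (inj₁ ≡.refl)))    = trans (*-congˡ (cross-vanishesˡ (w y) (w z))) (zeroʳ _)
        vanish _   (inj₂ (inj₂ (inj₂ ≡.refl)))    = trans (*-congˡ (cross-vanishesʳ (w y) (w z))) (zeroʳ _)

      case : a i ≈ 0# ⊎ i ≡ x ⊎ i ≡ y ⊎ i ≡ z → a i ≈ 0#
      case (inj₁ e)                      = e
      case (inj₂ (inj₁ ≡.refl))          = coefficient x y z supported det≉0
      case (inj₂ (inj₂ (inj₁ ≡.refl)))   = coefficient y z x (supported-turn supported) (det-turn (w x) (w y) (w z) det≉0)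
      case (inj₂ (inj₂ (inj₂ ≡.refl)))   =
        coefficient z x y (supported-turn (supported-turn supported)) (det-turn′ (w x) (w y) (w z) det≉0)

    -- The three coefficients are extended by zero to all elements as a sum of indicators, which do
    -- not overlap because x, y, z are distinct.
    independent⇒trivial : ∀ {x y z} → x ≢ y → x ≢ z → y ≢ z →
      LinearlyIndependent v (entries (x ∷ y ∷ z ∷ [])) →
      ∀ α β γ → (∀ k → α * w x k + (β * w y k + γ * w z k) ≈ 0#) → α ≈ 0# × β ≈ 0# × γ ≈ 0#
    independent⇒trivial {x} {y} {z} x≢y x≢z y≢z independent α β γ e =
      trans (sym at-x) (vanish x) , trans (sym at-y) (vanish y) , trans (sym at-z) (vanish z)
      where
      a : Vector Carrier n
      a i = indicator x α i + (indicator y β i + indicator z γ i)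

      ≢ : ∀ {i j} → i ∉ entries (x ∷ y ∷ z ∷ []) → j ∈ entries (x ∷ y ∷ z ∷ []) → i ≢ j
      ≢ i∉ j∈ ≡.refl = i∉ j∈

      supported : ∀ i → i ∉ entries (x ∷ y ∷ z ∷ []) → a i ≈ 0#
      supported i i∉ = trans
        (+-cong (reflexive (indicator-≢ x α (≢ i∉ (x∈entries x y z))))
          (+-cong (reflexive (indicator-≢ y β (≢ i∉ (y∈entries x y z))))
                  (reflexive (indicator-≢ z γ (≢ i∉ (z∈entries x y z))))))
        (trans (+-identityˡ _) (+-identityˡ _))

      dependent : ∀ k → sum (λ i → a i * w i k) ≈ 0#
      dependent k = begin
        sum (λ i → a i * w i k)
          ≈⟨ sum-cong-≋ (λ i → trans (distribʳ (w i k) (indicator x α i) _)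
               (+-congˡ (distribʳ (w i k) (indicator y β i) (indicator z γ i)))) ⟩
        sum (λ i → indicator x α i * w i k + (indicator y β i * w i k + indicator z γ i * w i k))
          ≈⟨ trans (∑-distrib-+ (λ i → indicator x α i * w i k) (λ i → indicator y β i * w i k + indicator z γ i * w i k))
                   (+-congˡ (∑-distrib-+ (λ i → indicator y β i * w i k) (λ i → indicator z γ i * w i k))) ⟩
        sum (λ i → indicator x α i * w i k)
          + (sum (λ i → indicator y β i * w i k) + sum (λ i → indicator z γ i * w i k))
          ≈⟨ +-cong (sum-indicator x α (λ i → w i k))
               (+-cong (sum-indicator y β (λ i → w i k)) (sum-indicator z γ (λ i → w i k))) ⟩
        α * w x k + (β * w y k + γ * w z k)  ≈⟨ e k ⟩
        0#                                   ∎

      vanish : ∀ i → a i ≈ 0#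
      vanish = independent a supported dependent

      at-x : a x ≈ α
      at-x = trans (+-cong (reflexive (indicator-≡ x α))
        (trans (+-cong (reflexive (indicator-≢ y β x≢y)) (reflexive (indicator-≢ z γ x≢z))) (+-identityˡ 0#))) (+-identityʳ α)

      at-y : a y ≈ β
      at-y = trans (+-cong (reflexive (indicator-≢ x α (x≢y ∘ ≡.sym)))
        (+-cong (reflexive (indicator-≡ y β)) (reflexive (indicator-≢ z γ y≢z)))) (trans (+-identityˡ _) (+-identityʳ β))

      at-z : a z ≈ γ
      at-z = trans (+-cong (reflexive (indicator-≢ x α (x≢z ∘ ≡.sym)))
        (+-cong (reflexive (indicator-≢ y β (y≢z ∘ ≡.sym))) (reflexive (indicator-≡ z γ)))) (trans (+-identityˡ _) (+-identityˡ γ))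

    -- If det (x, y, z) = 0, then Cramer's rule gives dependencies, so all cofactors vanish; but then already
    -- x and y are dependent.
    det≈0⇒dependent : ∀ {x y z} → x ≢ y → x ≢ z → y ≢ z → det (w x) (w y) (w z) ≈ 0# →
                      ¬ LinearlyIndependent v (entries (x ∷ y ∷ z ∷ []))
    det≈0⇒dependent {x} {y} {z} x≢y x≢z y≢z det≈0 independent =
      nonzero (v y) λ j → proj₁ (independent⇒trivial x≢y x≢z y≢z independent (w y j) (- w x j) 0# (relation j))
      where
      cofactor : ∀ u → det (w x) (w y) u ≈ 0#
      cofactor u = proj₂ (proj₂ (independent⇒trivial x≢y x≢z y≢z independent
        (det u (w y) (w z)) (det (w x) u (w z)) (det (w x) (w y) u)
        λ k → trans (cramer (w x) (w y) (w z) u k) (trans (*-congʳ det≈0) (zeroˡ _))))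

      relation : ∀ j k → w y j * w x k + (- w x j * w y k + 0# * w z k) ≈ 0#
      relation j k = begin
        w y j * w x k + (- w x j * w y k + 0# * w z k)
          ≈⟨ solve 5 (λ yj xk xj yk zk → yj :* xk :+ (:- xj :* yk :+ con (+ 0) :* zk) := xk :* yj :- xj :* yk) refl _ _ _ _ _ ⟩
        w x k * w y j - w x j * w y k
          ≈⟨ +-congʳ (parallel (w x) (w y) (cross-zero (w x) (w y) cofactor) k j) ⟩
        w x j * w y k - w x j * w y k  ≈⟨ -‿inverseʳ _ ⟩
        0#  ∎

    module _ (M : Matroid n 3) (independent : ∀ S → Matroid.Independent M S ⇔ LinearlyIndependent v S) where
      open Matroid M

      -- An independent triple of distinct elements lies in a basis, and bases have three elements
      -- too.
      det≉0⇒basis : ∀ x y z → ¬ det (w x) (w y) (w z) ≈ 0# → IsBasis (entries (x ∷ y ∷ z ∷ []))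
      det≉0⇒basis x y z det≉0 =
        let B , B-basis , Z⊆B = Equivalence.from (independent _) (det≉0⇒independent x y z det≉0) in
        ≡.subst IsBasis (≡.sym (⊆∧∣∣≥⇒≡ Z⊆B (ℕₚ.≤-reflexive (≡.trans (size B-basis) (≡.sym ∣Z∣))))) B-basis
        where
        ∣Z∣ : ∣ entries (x ∷ y ∷ z ∷ []) ∣ ≡ 3
        ∣Z∣ = distinct⇒∣entries∣ x y z
          (λ { ≡.refl → det≉0 (det-repeated (w x) (w z)) })
          (λ { ≡.refl → det≉0 (trans (det-dot₂ (w x) (w y) (w x)) (cross-vanishesˡ (w x) (w y))) })
          (λ { ≡.refl → det≉0 (trans (det-dot₂ (w x) (w y) (w y)) (cross-vanishesʳ (w x) (w y))) })

      basis⇒det≉0 : ∀ x y z → IsBasis (entries (x ∷ y ∷ z ∷ [])) → ¬ det (w x) (w y) (w z) ≈ 0#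
      basis⇒det≉0 x y z basis det≈0 =
        let x≢y , x≢z , y≢z = ∣entries∣⇒distinct x y z (size basis) in
        det≈0⇒dependent x≢y x≢z y≢z det≈0 (Equivalence.to (independent _) (_ , basis , ⊆-refl))

record Representation {c ℓ} (F : CommutativeRing c ℓ) {n} (M : Matroid n 3) : Set (c ⊔ ℓ) where
  open CommutativeRing F
  open Matroid M
  field
    w : Fin n → Vector Carrier 3

  brackets : Brackets F (Fin n)
  brackets = CrossProduct.determinantBrackets F w

  open Brackets brackets using (⟦_,_,_⟧)

  field
    det≉0⇒basis : ∀ x y z → ¬ ⟦ x , y , z ⟧ ≈ 0# → IsBasis (entries (x ∷ y ∷ z ∷ []))
    basis⇒det≉0 : ∀ x y z → IsBasis (entries (x ∷ y ∷ z ∷ [])) → ¬ ⟦ x , y , z ⟧ ≈ 0#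

-- The triangle of Q_q⁺

next≢ : ∀ k → next k ≢ k
next≢ 0F ()
next≢ 1F ()
next≢ 2F ()

next²≢ : ∀ k → next (next k) ≢ k
next²≢ 0F ()
next²≢ 1F ()
next²≢ 2F ()

module Plane {c ℓ₁ ℓ₂} (F : HeytingField c ℓ₁ ℓ₂) (isField : IsDecidableField (fieldRing F))
             {n : ℕ} {M : Matroid n 3} (Q : ProjectivePlane.IsQ⁺ F M) where
  open CommutativeRing (fieldRing F) hiding (zero)
  open ProjectivePlane F
  open IsDecidableField isField
  open FieldProperties isField
  open Determinant (fieldRing F)
  open CrossProduct (fieldRing F)
  open IntegerSolver (fieldRing F)
  open Meet isField
  open IsQ⁺ Q using (L₁; L₂; L₃; nonConcurrent; e∉; restriction) renaming (e to ê)
  open IsRestriction restriction using (point; injective; member; exhaustive; independent)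
  open SetoidReasoning setoid

  representation : Representation (fieldRing F) M
  representation = record
    { w           = coord ∘ point
    ; det≉0⇒basis = Independence.det≉0⇒basis F isField point M independent
    ; basis⇒det≉0 = Independence.basis⇒det≉0 F isField point M independent
    }

  open Representation representation using (w; brackets; det≉0⇒basis; basis⇒det≉0)
  open Brackets brackets using (⟦_,_,_⟧)

  -- Numbered like the opposite vertices.
  line : Fin 3 → Line
  line 0F = L₂
  line 1F = L₃
  line 2F = L₁

  onQ : ∀ k {p} → p on line k → OnQ L₁ L₂ L₃ p
  onQ 0F = inj₂ ∘ inj₁
  onQ 1F = inj₂ ∘ inj₂
  onQ 2F = inj₁

  not-on-all : ∀ p → ¬ (∀ k → p on line k)
  not-on-all p on = nonConcurrent p (on 2F , on 0F , on 1F)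

  private
    toPoint : ∀ {u} → ¬ IsZero u → Point
    toPoint {u} u≉0 = record { coord = u ; nonzero = u≉0 }

  proportionalIndex : ∀ {u} → ¬ IsZero u → ∀ k → dot (coord (line k)) u ≈ 0# →
                      ∃[ i ] ∃[ s ] ¬ s ≈ 0# × (∀ j → w i j ≈ s * u j)
  proportionalIndex u≉0 k on = exhaustive (toPoint u≉0) (inj₁ (onQ k {toPoint u≉0} on))

  dot-index : ∀ L {i s u} → (∀ j → w i j ≈ s * u j) → dot L (w i) ≈ s * dot L u
  dot-index L {s = s} {u} e = trans (dot-congʳ L e) (dot-scale L s u)

  dot-index-zero : ∀ L {i s u} → (∀ j → w i j ≈ s * u j) → dot L u ≈ 0# → dot L (w i) ≈ 0#
  dot-index-zero L e z = trans (dot-index L e) (trans (*-congˡ z) (zeroʳ _))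

  -- All points of the sides are elements, so the common point of a line with a side has a number in
  -- the ground set.
  lineMeet : ∀ k L → ∃[ i ] point i on line k × dot L (w i) ≈ 0#
  lineMeet k L =
    let p , p≉0 , on-line , on-L = meet (nonzero (line k)) L
        i , s , _ , e = proportionalIndex p≉0 k on-line
    in i , dot-index-zero (coord (line k)) e on-line , dot-index-zero L e on-L

  vertex : Fin 3 → Fin n
  vertex 0F = proj₁ (lineMeet 1F (coord L₁))
  vertex 1F = proj₁ (lineMeet 2F (coord L₂))
  vertex 2F = proj₁ (lineMeet 0F (coord L₃))

  vertex-on : ∀ j k → j ≢ k → point (vertex j) on line k
  vertex-on 0F 0F j≢k = contradiction ≡.refl j≢k
  vertex-on 0F 1F _   = proj₁ (proj₂ (lineMeet 1F (coord L₁)))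
  vertex-on 0F 2F _   = proj₂ (proj₂ (lineMeet 1F (coord L₁)))
  vertex-on 1F 0F _   = proj₂ (proj₂ (lineMeet 2F (coord L₂)))
  vertex-on 1F 1F j≢k = contradiction ≡.refl j≢k
  vertex-on 1F 2F _   = proj₁ (proj₂ (lineMeet 2F (coord L₂)))
  vertex-on 2F 0F _   = proj₁ (proj₂ (lineMeet 0F (coord L₃)))
  vertex-on 2F 1F _   = proj₂ (proj₂ (lineMeet 0F (coord L₃)))
  vertex-on 2F 2F j≢k = contradiction ≡.refl j≢k

  vertex-off : ∀ j → ¬ point (vertex j) on line j
  vertex-off 0F on = not-on-all (point (vertex 0F)) λ { 0F → on ; 1F → vertex-on 0F 1F λ () ; 2F → vertex-on 0F 2F λ () }
  vertex-off 1F on = not-on-all (point (vertex 1F)) λ { 0F → vertex-on 1F 0F λ () ; 1F → on ; 2F → vertex-on 1F 2F λ () }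
  vertex-off 2F on = not-on-all (point (vertex 2F)) λ { 0F → vertex-on 2F 0F λ () ; 1F → vertex-on 2F 1F λ () ; 2F → on }

  a b c′ : Fin n
  a  = vertex 0F
  b  = vertex 1F
  c′ = vertex 2F

  D : Carrier
  D = ⟦ a , b , c′ ⟧

  -- Up to the factor D, the basis of linear forms dual to the vertices.
  normal : Fin 3 → Vector Carrier 3
  normal 0F = cross (w b) (w c′)
  normal 1F = cross (w c′) (w a)
  normal 2F = cross (w a) (w b)

  normal-vertex : ∀ k → dot (normal k) (w (vertex k)) ≈ D
  normal-vertex 0F = sym (det-dot₀ (w a) (w b) (w c′))
  normal-vertex 1F = sym (det-dot₁ (w a) (w b) (w c′))
  normal-vertex 2F = sym (det-dot₂ (w a) (w b) (w c′))

  normal-other : ∀ j k → j ≢ k → dot (normal k) (w (vertex j)) ≈ 0#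
  normal-other 0F 0F j≢k = contradiction ≡.refl j≢k
  normal-other 0F 1F _   = cross-vanishesʳ (w c′) (w a)
  normal-other 0F 2F _   = cross-vanishesˡ (w a) (w b)
  normal-other 1F 0F _   = cross-vanishesˡ (w b) (w c′)
  normal-other 1F 1F j≢k = contradiction ≡.refl j≢k
  normal-other 1F 2F _   = cross-vanishesʳ (w a) (w b)
  normal-other 2F 0F _   = cross-vanishesʳ (w b) (w c′)
  normal-other 2F 1F _   = cross-vanishesˡ (w c′) (w a)
  normal-other 2F 2F j≢k = contradiction ≡.refl j≢k

  private
    L = coord ∘ line

  -- In Cramer's rule for the form L k two terms vanish, because the other two vertices lie on
  -- `line k`. Once D is known to be nonzero, `normal k` and `line k` therefore have the same zeros.
  line-normal : ∀ k u → D * dot (L k) u ≈ dot (L k) (w (vertex k)) * dot (normal k) u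
  line-normal 0F u = begin
    D * dot (L 0F) u  ≈⟨ cramer-dot (L 0F) (w a) (w b) (w c′) u ⟩
    _                 ≈⟨ +-cong (+-congˡ (trans (*-congʳ (vertex-on 1F 0F λ ())) (zeroˡ _)))
                                (trans (*-congʳ (vertex-on 2F 0F λ ())) (zeroˡ _)) ⟩
    _ + 0# + 0#       ≈⟨ trans (+-identityʳ _) (+-identityʳ _) ⟩
    _                 ≈⟨ *-congˡ (det-dot₀ u (w b) (w c′)) ⟩
    dot (L 0F) (w a) * dot (normal 0F) u ∎
  line-normal 1F u = begin
    D * dot (L 1F) u  ≈⟨ cramer-dot (L 1F) (w a) (w b) (w c′) u ⟩
    _                 ≈⟨ +-cong (+-congʳ (trans (*-congʳ (vertex-on 0F 1F λ ())) (zeroˡ _)))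
                                (trans (*-congʳ (vertex-on 2F 1F λ ())) (zeroˡ _)) ⟩
    0# + _ + 0#       ≈⟨ trans (+-identityʳ _) (+-identityˡ _) ⟩
    _                 ≈⟨ *-congˡ (det-dot₁ (w a) u (w c′)) ⟩
    dot (L 1F) (w b) * dot (normal 1F) u ∎
  line-normal 2F u = begin
    D * dot (L 2F) u  ≈⟨ cramer-dot (L 2F) (w a) (w b) (w c′) u ⟩
    _                 ≈⟨ +-congʳ (trans (+-cong (trans (*-congʳ (vertex-on 0F 2F λ ())) (zeroˡ _))
                                                (trans (*-congʳ (vertex-on 1F 2F λ ())) (zeroˡ _))) (+-identityˡ 0#)) ⟩
    0# + _            ≈⟨ +-identityˡ _ ⟩
    _                 ≈⟨ *-congˡ (det-dot₂ (w a) (w b) u) ⟩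
    dot (L 2F) (w c′) * dot (normal 2F) u ∎

  -- If D = 0 then c ∉ L₁ forces a × b = 0, so a and b coincide and a lies on all three lines.
  D≉0 : ¬ D ≈ 0#
  D≉0 D≈0 = vertex-off 0F (*-zero-factor (proj₂ bₖ)
    (trans (sym (parallel-b (proj₁ bₖ))) (trans (*-congˡ (vertex-on 1F 0F λ ())) (zeroʳ _))))
    where
    normal-zero : ∀ u → dot (normal 2F) u ≈ 0#
    normal-zero u = *-zero-factor (vertex-off 2F)
      (trans (sym (line-normal 2F u)) (trans (*-congʳ D≈0) (zeroˡ _)))

    cross≈0 : ∀ k → cross (w a) (w b) k ≈ 0#
    cross≈0 k = trans (sym (dot-basisVector (normal 2F) k)) (normal-zero (basisVector k))

    bₖ : ∃[ k ] ¬ w b k ≈ 0#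
    bₖ = nonzero-coordinate (nonzero (point b))

    parallel-b : ∀ k → w a k * dot (L 0F) (w b) ≈ w b k * dot (L 0F) (w a)
    parallel-b k = begin
      w a k * dot (L 0F) (w b)  ≈⟨ *-congˡ (dot-comm (L 0F) (w b)) ⟩
      w a k * dot (w b) (L 0F)  ≈⟨ parallel-dot (w a) (w b) cross≈0 k (L 0F) ⟩
      w b k * dot (w a) (L 0F)  ≈⟨ *-congˡ (dot-comm (L 0F) (w a)) ⟨
      w b k * dot (L 0F) (w a)  ∎

  on⇒normal : ∀ k u → dot (L k) u ≈ 0# → dot (normal k) u ≈ 0#
  on⇒normal k u e = *-zero-factor (vertex-off k) (trans (sym (line-normal k u)) (trans (*-congˡ e) (zeroʳ _)))

  normal⇒on : ∀ k u → dot (normal k) u ≈ 0# → dot (L k) u ≈ 0#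
  normal⇒on k u e = *-zero-factor D≉0 (trans (line-normal k u) (trans (*-congˡ e) (zeroʳ _)))

  ξ : Fin n → Vector Carrier 3
  ξ = BracketExpansion.coordinates brackets a b c′

  ξ-normal : ∀ p k → ξ p k ≈ dot (normal k) (w p)
  ξ-normal p 0F = det-dot₀ (w p) (w b) (w c′)
  ξ-normal p 1F = det-dot₁ (w a) (w p) (w c′)
  ξ-normal p 2F = det-dot₂ (w a) (w b) (w p)

  ξ-on : ∀ p k → ξ p k ≈ 0# → point p on line k
  ξ-on p k e = normal⇒on k (w p) (trans (sym (ξ-normal p k)) e)

  e : Fin n
  e = proj₁ (exhaustive ê (inj₂ (1# , 1≉0 , λ k → sym (*-identityˡ _))))

  e-≈ : point e ≈ₚ ê
  e-≈ = proj₂ (exhaustive ê (inj₂ (1# , 1≉0 , λ k → sym (*-identityˡ _))))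

  e-nonzero : ∀ k → ¬ ξ e k ≈ 0#
  e-nonzero k ξ≈0 = e∉ (onQ k {ê} (*-zero-factor (proj₁ (proj₂ e-≈))
    (trans (sym (dot-index (L k) (proj₂ (proj₂ e-≈)))) (ξ-on e k ξ≈0))))

  ξ-nonzero : ∀ p → ¬ (∀ k → ξ p k ≈ 0#)
  ξ-nonzero p z = not-on-all (point p) (λ k → ξ-on p k (z k))

  on-ξ : ∀ p k → point p on line k → ξ p k ≈ 0#
  on-ξ p k on = trans (ξ-normal p k) (on⇒normal k (w p) on)

  off-sides : ∀ {p} → (∀ k → ¬ ξ p k ≈ 0#) → p ≡ e
  off-sides {p} off = [ (λ p∈ → contradiction p∈ not-onQ) , isE ]′ (member p)
    where
    not-onQ : ¬ OnQ L₁ L₂ L₃ (point p)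
    not-onQ = [ (λ p∈ → off 2F (on-ξ p 2F p∈)) , [ off 0F ∘ on-ξ p 0F , off 1F ∘ on-ξ p 1F ]′ ]′

    isE : point p ≈ₚ ê → p ≡ e
    isE (s , s≉0 , p≈) =
      let t , t≉0 , e≈ = e-≈
          i , ti = inverse t≉0
      -- From p = s ê and e = t ê follows p = (s/t) e.
      in injective (s * i , *-nonzero s≉0 (HasInverse⇒≉0 (HasInverse-sym ti)) , λ k → begin
        w p k                  ≈⟨ p≈ k ⟩
        s * coord ê k          ≈⟨ *-congˡ (*-identityˡ _) ⟨
        s * (1# * coord ê k)   ≈⟨ *-congˡ (*-congʳ ti) ⟨
        s * (t * i * coord ê k)  ≈⟨ solve 4 (λ s t i x → s :* (t :* i :* x) := s :* i :* (t :* x)) refl _ _ _ _ ⟩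
        s * i * (t * coord ê k)  ≈⟨ *-congˡ (e≈ k) ⟨
        s * i * w e k          ∎)

  side : ∀ k t → ∃[ p ] ¬ ξ p k ≈ 0# × ξ p (next k) ≈ t * ξ p k × ξ p (next (next k)) ≈ 0#
  side k t = p , p₀≉0 , p₁ , p₂
    where
    v v′ u : Vector Carrier 3
    v = w (vertex k)
    v′ = w (vertex (next k))
    -- The point of ratio t on the line joining the vertices k and `next k`; the factor 1# gives it
    -- the shape of `dot-linear`.
    u j = 1# * (v j + t * v′ j)

    dot-u : ∀ N → dot N u ≈ dot N v + t * dot N v′
    dot-u N = trans (dot-linear N 1# v t v′) (*-identityˡ _)

    normal-u : dot (normal k) u ≈ D
    normal-u = begin
      dot (normal k) u                             ≈⟨ dot-u (normal k) ⟩
      dot (normal k) v + t * dot (normal k) v′     ≈⟨ +-cong (normal-vertex k) (*-congˡ (normal-other (next k) k (next≢ k))) ⟩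
      D + t * 0#                                   ≈⟨ trans (+-congˡ (zeroʳ t)) (+-identityʳ D) ⟩
      D                                            ∎

    u≉0 : ¬ IsZero u
    u≉0 z = D≉0 (trans (sym normal-u) (trans (dot-congʳ (normal k) {v′ = λ _ → 0#} z)
      (solve 3 (λ a b c → dotₚ a b c (con (+ 0)) (con (+ 0)) (con (+ 0)) := con (+ 0)) refl _ _ _)))

    on : dot (L (next (next k))) u ≈ 0#
    on = trans (dot-u (L (next (next k)))) (trans (+-cong (vertex-on k (next (next k)) (next²≢ k ∘ ≡.sym))
      (trans (*-congˡ (vertex-on (next k) (next (next k)) (next≢ (next k) ∘ ≡.sym))) (zeroʳ t))) (+-identityˡ 0#))

    index = proportionalIndex u≉0 (next (next k)) on
    p = proj₁ index
    s = proj₁ (proj₂ index)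
    s≉0 = proj₁ (proj₂ (proj₂ index))
    p≈ = proj₂ (proj₂ (proj₂ index))

    ξ-u : ∀ j → ξ p j ≈ s * dot (normal j) u
    ξ-u j = trans (ξ-normal p j) (dot-index (normal j) p≈)

    ξ₀ : ξ p k ≈ s * D
    ξ₀ = trans (ξ-u k) (*-congˡ normal-u)

    p₀≉0 : ¬ ξ p k ≈ 0#
    p₀≉0 z = *-nonzero s≉0 D≉0 (trans (sym ξ₀) z)

    p₁ : ξ p (next k) ≈ t * ξ p k
    p₁ = begin
      ξ p (next k)                 ≈⟨ ξ-u (next k) ⟩
      s * dot (normal (next k)) u  ≈⟨ *-congˡ (trans (dot-u (normal (next k)))
        (+-cong (normal-other k (next k) (next≢ k ∘ ≡.sym)) (*-congˡ (normal-vertex (next k))))) ⟩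
      s * (0# + t * D)             ≈⟨ solve 3 (λ s t d → s :* (con (+ 0) :+ t :* d) := t :* (s :* d)) refl _ _ _ ⟩
      t * (s * D)                  ≈⟨ *-congˡ ξ₀ ⟨
      t * ξ p k                    ∎

    p₂ : ξ p (next (next k)) ≈ 0#
    p₂ = trans (ξ-normal p (next (next k)))
      (on⇒normal (next (next k)) (w p) (dot-index-zero (L (next (next k))) p≈ on))

  -- A line through b₃ meets L₁, L₂ and L₃ in elements that cannot all be b₃.
  transversal : ∀ b₁ b₂ b₃ → ¬ ⟦ b₁ , b₂ , b₃ ⟧ ≈ 0# → ∀ t →
                ∃[ u ] ¬ ⟦ u , b₂ , b₃ ⟧ ≈ 0# × ⟦ b₁ , u , b₃ ⟧ ≈ t * ⟦ u , b₂ , b₃ ⟧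
  transversal b₁ b₂ b₃ Δ≉0 t = case (f 0F ≈? 0#) (f 1F ≈? 0#) (f 2F ≈? 0#)
    where
    N₁ N₂ N : Vector Carrier 3
    N₁ = cross (w b₂) (w b₃)
    N₂ = cross (w b₃) (w b₁)
    -- N₁ and N₂ both vanish at b₃, and the elements u on N are those with ⟦b₁,u,b₃⟧ = t ⟦u,b₂,b₃⟧.
    N k = N₂ k - t * N₁ k

    u : Fin 3 → Fin n
    u k = proj₁ (lineMeet k N)

    f : Fin 3 → Carrier
    f k = ⟦ u k , b₂ , b₃ ⟧

    u-second : ∀ k → ⟦ b₁ , u k , b₃ ⟧ ≈ t * f k
    u-second k = begin
      ⟦ b₁ , u k , b₃ ⟧     ≈⟨ det-dot₁ (w b₁) (w (u k)) (w b₃) ⟩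
      dot N₂ (w (u k))      ≈⟨ RingProperties.x∙y⁻¹≈ε⇒x≈y ring _ _
                                 (trans (sym (dot-pencil N₂ t N₁ (w (u k)))) (proj₂ (proj₂ (lineMeet k N)))) ⟩
      t * dot N₁ (w (u k))  ≈⟨ *-congˡ (det-dot₀ (w (u k)) (w b₂) (w b₃)) ⟨
      t * f k               ∎

    Found = ∃[ u ] ¬ ⟦ u , b₂ , b₃ ⟧ ≈ 0# × ⟦ b₁ , u , b₃ ⟧ ≈ t * ⟦ u , b₂ , b₃ ⟧

    -- If f k = 0, then ⟦b₁,u k,b₃⟧ = 0 as well, and Cramer's rule makes u k a multiple of b₃; since
    -- u k lies on `line k`, so does b₃.
    b₃-on : ∀ k → f k ≈ 0# → point b₃ on line k
    b₃-on k fk≈0 = *-zero-factor third≉0 (trans (*-comm _ _) (trans (sym (expand (L k)))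
      (trans (*-congˡ (proj₁ (proj₂ (lineMeet k N)))) (zeroʳ _))))
      where
      expand : ∀ L → ⟦ b₁ , b₂ , b₃ ⟧ * dot L (w (u k)) ≈ dot L (w b₃) * ⟦ b₁ , b₂ , u k ⟧
      expand L = trans (cramer-dot L (w b₁) (w b₂) (w b₃) (w (u k))) (trans (+-congʳ (trans
        (+-cong (trans (*-congˡ fk≈0) (zeroʳ _))
                (trans (*-congˡ (trans (u-second k) (trans (*-congˡ fk≈0) (zeroʳ t)))) (zeroʳ _)))
        (+-identityˡ 0#))) (+-identityˡ _))

      third≉0 : ¬ ⟦ b₁ , b₂ , u k ⟧ ≈ 0#
      third≉0 z = not-on-all (point (u k)) λ j →
        *-zero-factor Δ≉0 (trans (expand (L j)) (trans (*-congˡ z) (zeroʳ _)))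

    case : Dec (f 0F ≈ 0#) → Dec (f 1F ≈ 0#) → Dec (f 2F ≈ 0#) → Found
    case (no f₀)  _        _        = u 0F , f₀ , u-second 0F
    case (yes _)  (no f₁)  _        = u 1F , f₁ , u-second 1F
    case (yes _)  (yes _)  (no f₂)  = u 2F , f₂ , u-second 2F
    case (yes f₀) (yes f₁) (yes f₂) =
      contradiction (λ { 0F → b₃-on 0F f₀ ; 1F → b₃-on 1F f₁ ; 2F → b₃-on 2F f₂ }) (not-on-all (point b₃))

  configuration : ∀ {r ℓ′} {R : CommutativeRing r ℓ′} (bR : Brackets R (Fin n)) →
    let open Brackets bR renaming (⟦_,_,_⟧ to bracket-R) in
    (∀ {x y z} → ¬ Matroid.IsBasis M (entries (x ∷ y ∷ z ∷ [])) →
                 CommutativeRing._≈_ R (bracket-R x y z) (CommutativeRing.0# R)) →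
    (∀ {x y z} → Matroid.IsBasis M (entries (x ∷ y ∷ z ∷ [])) → Determinant.HasInverse R (bracket-R x y z)) →
    Configuration brackets bR
  configuration bR zero-R inverse-R = record
    { repeated  = λ x y → det-repeated (w x) (w y)
    ; zero-R    = λ {x} {y} {z} z≈0 → zero-R (λ basis → basis⇒det≉0 x y z basis z≈0)
    ; inverse-R = λ {x} {y} {z} z≉0 → inverse-R (det≉0⇒basis x y z z≉0)
    ; a = a ; b = b ; c = c′ ; e = e
    ; abc       = D≉0
    ; e-nonzero = e-nonzero
    ; side      = side
    ; nonzero   = ξ-nonzero
    ; off-sides = off-sides
    }

-- Cross ratios

module CrossRatiosOfRepresented {ℓ₁ ℓ₂ ℓ₃ ℓ₄} {F : CommutativeRing ℓ₁ ℓ₂} (isField : IsDecidableField F)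
    {R : CommutativeRing ℓ₃ ℓ₄} {θ} (θ-embedding : IsFieldEmbedding F R θ)
    (1≉0 : ¬ CommutativeRing._≈_ R (CommutativeRing.1# R) (CommutativeRing.0# R)) where
  private
    module F where
      open CommutativeRing F public
      open IsDecidableField isField public
      open FieldProperties isField public
    open CommutativeRing R hiding (zero)
    open Determinant R
    open IntegerSolver R
    open Matrices R
    module MF = Matrices F
    open IsFieldEmbedding θ-embedding
    open SetoidReasoning setoid

  -- A is θ(D) between two invertible diagonal matrices, which the cross ratios do not see.
  record Represented {m n} (A : Matrix m n) : Set (ℓ₁ ⊔ ℓ₃ ⊔ ℓ₄) where
    field
      rows            : Fin m → Carrier
      columns         : Fin n → Carrier
      D               : MF.Matrix m n
      rows-inverse    : ∀ i → HasInverse (rows i)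
      columns-inverse : ∀ j → HasInverse (columns j)
      entry           : ∀ i j → A i j ≈ rows i * columns j * θ (D i j)

  replace : ∀ {m} → Fin m → Carrier → (Fin m → Carrier) → Fin m → Carrier
  replace x u r i = if does (i ≟ x) then u else r i

  replace-inverse : ∀ {m} {x : Fin m} {u r} → HasInverse u → (∀ i → HasInverse (r i)) →
                    ∀ i → HasInverse (replace x u r i)
  replace-inverse {x = x} u⁻¹ r⁻¹ i with does (i ≟ x)
  ... | true  = u⁻¹
  ... | false = r⁻¹ i

  scale-inverse : ∀ {m} {x : Fin m} {u r} → HasInverse u → (∀ i → HasInverse (r i)) →
                  ∀ i → HasInverse (replace x (u * r x) r i)
  scale-inverse {x = x} u⁻¹ r⁻¹ = replace-inverse (HasInverse-* u⁻¹ (r⁻¹ x)) r⁻¹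

  represented-row : ∀ {m n} {A : Matrix m n} → Represented A → ∀ x u → HasInverse u →
                    Represented (scaleRow x u A)
  represented-row {A = A} rep x u u⁻¹ = record
    { rows = replace x (u * rows x) rows ; columns = columns ; D = D
    ; rows-inverse = scale-inverse u⁻¹ rows-inverse ; columns-inverse = columns-inverse
    ; entry = scaled }
    where
    open Represented rep
    scaled : ∀ i j → scaleRow x u A i j ≈ replace x (u * rows x) rows i * columns j * θ (D i j)
    scaled i j with i ≟ x
    ... | yes ≡.refl = trans (*-congˡ (entry x j))
      (solve 4 (λ u r c d → u :* (r :* c :* d) := u :* r :* c :* d) refl _ _ _ _)
    ... | no _ = entry i j

  represented-column : ∀ {m n} {A : Matrix m n} → Represented A → ∀ y u → HasInverse u →
                       Represented (scaleColumn y u A)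
  represented-column {A = A} rep y u u⁻¹ = record
    { rows = rows ; columns = replace y (u * columns y) columns ; D = D
    ; rows-inverse = rows-inverse ; columns-inverse = scale-inverse u⁻¹ columns-inverse
    ; entry = scaled }
    where
    open Represented rep
    scaled : ∀ i j → scaleColumn y u A i j ≈ rows i * replace y (u * columns y) columns j * θ (D i j)
    scaled i j with j ≟ y
    ... | yes ≡.refl = trans (*-congˡ (entry i y))
      (solve 4 (λ u r c d → u :* (r :* c :* d) := r :* (u :* c) :* d) refl _ _ _ _)
    ... | no _ = entry i j

  -- Pivoting exchanges the labels x and y, so the new row takes the inverse of the old column
  -- scalar and the new column the inverse of the old row scalar. With this choice D undergoes the
  -- same pivot over F.
  represented-pivot : ∀ {m n} {A : Matrix m n} → Represented A → ∀ x y a → A x y * a ≈ 1# →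
                      Represented (pivot A x y a)
  represented-pivot {A = A} rep x y a Aa = record
    { rows = replace x σ rows ; columns = replace y ρ columns ; D = MF.pivot D x y d
    ; rows-inverse = replace-inverse (HasInverse-sym cσ) rows-inverse
    ; columns-inverse = replace-inverse (HasInverse-sym rρ) columns-inverse
    ; entry = pivoted }
    where
    open Represented rep
    r = rows x
    c = columns y
    ρ = proj₁ (rows-inverse x)
    σ = proj₁ (columns-inverse y)

    rρ : r * ρ ≈ 1#
    rρ = proj₂ (rows-inverse x)

    cσ : c * σ ≈ 1#
    cσ = proj₂ (columns-inverse y)

    -- A zero entry of D would make the pivot zero, and zero is invertible only in a trivial ring.
    Dxy≉0 : ¬ D x y F.≈ F.0#
    Dxy≉0 z = 1≉0 (begin
      1#                       ≈⟨ Aa ⟨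
      A x y * a                ≈⟨ *-congʳ (trans (entry x y) (*-congˡ (trans (θ-cong z) θ-0))) ⟩
      r * c * 0# * a           ≈⟨ solve 3 (λ r c a → r :* c :* con (+ 0) :* a := con (+ 0)) refl _ _ _ ⟩
      0#                       ∎)

    d = proj₁ (F.inverse Dxy≉0)

    a≈ : a ≈ σ * ρ * θ d
    a≈ = *-cancelˡ-inverse (a , Aa) (trans Aa (sym (begin
      A x y * (σ * ρ * θ d)    ≈⟨ *-congʳ (entry x y) ⟩
      r * c * θ (D x y) * (σ * ρ * θ d)
        ≈⟨ solve 6 (λ r c D σ ρ d → r :* c :* D :* (σ :* ρ :* d) := (r :* ρ) :* (c :* σ) :* (D :* d)) refl _ _ _ _ _ _ ⟩
      (r * ρ) * (c * σ) * (θ (D x y) * θ d)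
        ≈⟨ *-cong (*-cong rρ cσ) (θ-inverse (proj₂ (F.inverse Dxy≉0))) ⟩
      1# * 1# * 1#             ≈⟨ solve 0 (con (+ 1) :* con (+ 1) :* con (+ 1) := con (+ 1)) refl ⟩
      1#                       ∎)))

    drop : ∀ {u v} → u ≈ 1# → u * v ≈ v
    drop e = trans (*-congʳ e) (*-identityˡ _)

    pivoted : ∀ i j → pivot A x y a i j ≈ replace x σ rows i * replace y ρ columns j * θ (MF.pivot D x y d i j)
    pivoted i j with i ≟ x | j ≟ y
    ... | yes ≡.refl | yes ≡.refl = a≈
    ... | yes ≡.refl | no _ = begin
      a * A x j                                       ≈⟨ *-cong a≈ (entry x j) ⟩
      σ * ρ * θ d * (r * columns j * θ (D x j))
        ≈⟨ solve 6 (λ r c D σ ρ d → σ :* ρ :* d :* (r :* c :* D) := (r :* ρ) :* (σ :* c :* (d :* D))) refl _ _ _ _ _ _ ⟩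
      (r * ρ) * (σ * columns j * (θ d * θ (D x j)))   ≈⟨ drop rρ ⟩
      σ * columns j * (θ d * θ (D x j))               ≈⟨ *-congˡ (θ-* _ _) ⟨
      σ * columns j * θ (d F.* D x j)                 ∎
    ... | no _ | yes ≡.refl = begin
      - (a * A i y)                                   ≈⟨ -‿cong (*-cong a≈ (entry i y)) ⟩
      - (σ * ρ * θ d * (rows i * c * θ (D i y)))
        ≈⟨ solve 6 (λ r c D σ ρ d → :- (σ :* ρ :* d :* (r :* c :* D)) := (c :* σ) :* (r :* ρ :* (:- (d :* D)))) refl _ _ _ _ _ _ ⟩
      (c * σ) * (rows i * ρ * - (θ d * θ (D i y)))    ≈⟨ drop cσ ⟩
      rows i * ρ * - (θ d * θ (D i y))                ≈⟨ *-congˡ (trans (θ-neg _) (-‿cong (θ-* _ _))) ⟨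
      rows i * ρ * θ (F.- (d F.* D i y))              ∎
    ... | no _ | no _ = begin
      A i j - a * A i y * A x j
        ≈⟨ +-cong (entry i j) (-‿cong (*-cong (*-cong a≈ (entry i y)) (entry x j))) ⟩
      rows i * columns j * θ (D i j) - σ * ρ * θ d * (rows i * c * θ (D i y)) * (r * columns j * θ (D x j))
        ≈⟨ +-congˡ (-‿cong (solve 9 (λ σ ρ d ri c D r cj D′ →
             σ :* ρ :* d :* (ri :* c :* D) :* (r :* cj :* D′) := (r :* ρ) :* (c :* σ) :* (ri :* cj :* (d :* D :* D′)))
             refl _ _ _ _ _ _ _ _ _)) ⟩
      rows i * columns j * θ (D i j) - (r * ρ) * (c * σ) * (rows i * columns j * (θ d * θ (D i y) * θ (D x j)))
        ≈⟨ +-congˡ (-‿cong (drop (trans (*-cong rρ cσ) (*-identityˡ 1#)))) ⟩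
      rows i * columns j * θ (D i j) - rows i * columns j * (θ d * θ (D i y) * θ (D x j))
        ≈⟨ solve 4 (λ r c D E → r :* c :* D :- r :* c :* E := r :* c :* (D :- E)) refl _ _ _ _ ⟩
      rows i * columns j * (θ (D i j) - θ d * θ (D i y) * θ (D x j))
        ≈⟨ *-congˡ (trans (θ-+ _ _) (+-congˡ (trans (θ-neg _) (-‿cong (trans (θ-* _ _) (*-congʳ (θ-* _ _))))))) ⟨
      rows i * columns j * θ (D i j F.- d F.* D i y F.* D x j)  ∎

  represented-resp : ∀ {m n} {A B : Matrix m n} → B ≋ A → Represented A → Represented B
  represented-resp e rep = record
    { rows = rows ; columns = columns ; D = D
    ; rows-inverse = rows-inverse ; columns-inverse = columns-inverse
    ; entry = λ i j → trans (e i j) (entry i j) }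
    where open Represented rep

  represented-select : ∀ {m n m′ n′} {A : Matrix m n} → Represented A → (f : Fin m′ → Fin m) (g : Fin n′ → Fin n) →
                       Represented (λ i j → A (f i) (g j))
  represented-select rep f g = record
    { rows = rows ∘ f ; columns = columns ∘ g ; D = λ i j → D (f i) (g j)
    ; rows-inverse = rows-inverse ∘ f ; columns-inverse = columns-inverse ∘ g
    ; entry = λ i j → entry (f i) (g j) }
    where open Represented rep

  represented-⪯ : ∀ {m n m′ n′} {A : Matrix m n} {B : Matrix m′ n′} → Represented A → B ⪯ A → Represented B
  represented-⪯ rep (done e)                     = represented-resp e rep
  represented-⪯ rep (row A′⪯ x u (t , _ , ut) e)    = represented-resp e (represented-row (represented-⪯ rep A′⪯) x u (t , ut))
  represented-⪯ rep (column A′⪯ y u (t , _ , ut) e) = represented-resp e (represented-column (represented-⪯ rep A′⪯) y u (t , ut))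
  represented-⪯ rep (select A′⪯ f g _ _ e)       = represented-resp e (represented-select (represented-⪯ rep A′⪯) f g)
  represented-⪯ rep (pivoting A′⪯ x y a _ Aa e)  = represented-resp e (represented-pivot (represented-⪯ rep A′⪯) x y a Aa)

  -- Since three of the entries are 1, p is the product of the off-diagonal entries divided by that
  -- of the diagonal ones. Each row and column scalar occurs once in both products and cancels.
  represented-crossMatrix : ∀ {p} → Represented (crossMatrix p) → ∃[ t ] p ≈ θ t
  represented-crossMatrix {p} rep = t , (begin
    p                                        ≈⟨ *-identityʳ p ⟨
    p * 1#                                   ≈⟨ *-congˡ (entry 0F 1F) ⟩
    p * (r₀ * c₁ * θ D₀₁)                    ≈⟨ *-congʳ (entry 1F 0F) ⟩
    r₁ * c₀ * θ D₁₀ * (r₀ * c₁ * θ D₀₁)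
      ≈⟨ solve 6 (λ r₀ r₁ c₀ c₁ D D′ → r₁ :* c₀ :* D :* (r₀ :* c₁ :* D′) := r₀ :* c₀ :* (r₁ :* c₁) :* (D :* D′))
           refl _ _ _ _ _ _ ⟩
    r₀ * c₀ * (r₁ * c₁) * (θ D₁₀ * θ D₀₁)    ≈⟨ *-cong scalars (sym (θ-* _ _)) ⟩
    θ d * θ (D₁₀ F.* D₀₁)                    ≈⟨ θ-* _ _ ⟨
    θ t                                      ∎)
    where
    open Represented rep
    r₀ = rows 0F
    r₁ = rows 1F
    c₀ = columns 0F
    c₁ = columns 1F
    D₀₀ = D 0F 0F
    D₀₁ = D 0F 1F
    D₁₀ = D 1F 0F
    D₁₁ = D 1F 1F

    diagonal : r₀ * c₀ * (r₁ * c₁) * θ (D₀₀ F.* D₁₁) ≈ 1#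
    diagonal = begin
      r₀ * c₀ * (r₁ * c₁) * θ (D₀₀ F.* D₁₁)      ≈⟨ *-congˡ (θ-* _ _) ⟩
      r₀ * c₀ * (r₁ * c₁) * (θ D₀₀ * θ D₁₁)
        ≈⟨ solve 4 (λ a b D D′ → a :* b :* (D :* D′) := a :* D :* (b :* D′)) refl _ _ _ _ ⟩
      r₀ * c₀ * θ D₀₀ * (r₁ * c₁ * θ D₁₁)        ≈⟨ *-cong (sym (entry 0F 0F)) (sym (entry 1F 1F)) ⟩
      1# * 1#                                    ≈⟨ *-identityˡ 1# ⟩
      1#                                         ∎

    nonzero : ¬ D₀₀ F.* D₁₁ F.≈ F.0#
    nonzero z = 1≉0 (trans (sym diagonal) (trans (*-congˡ (trans (θ-cong z) θ-0)) (zeroʳ _)))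

    d = proj₁ (F.inverse nonzero)
    t = d F.* (D₁₀ F.* D₀₁)

    scalars : r₀ * c₀ * (r₁ * c₁) ≈ θ d
    scalars = begin
      r₀ * c₀ * (r₁ * c₁)                                  ≈⟨ *-identityʳ _ ⟨
      r₀ * c₀ * (r₁ * c₁) * 1#                             ≈⟨ *-congˡ (θ-inverse (proj₂ (F.inverse nonzero))) ⟨
      r₀ * c₀ * (r₁ * c₁) * (θ (D₀₀ F.* D₁₁) * θ d)        ≈⟨ *-assoc _ _ _ ⟨
      r₀ * c₀ * (r₁ * c₁) * θ (D₀₀ F.* D₁₁) * θ d          ≈⟨ drop diagonal ⟩
      θ d                                                  ∎
      where
      drop : ∀ {u v} → u ≈ 1# → u * v ≈ v
      drop e = trans (*-congʳ e) (*-identityˡ _)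

  crossRatio-image : ∀ {m n} {A : Matrix m n} → Represented A → ∀ {p} → Cr A p → ∃[ t ] p ≈ θ t
  crossRatio-image rep p∈ = represented-crossMatrix (represented-⪯ rep p∈)

module CrossRatioOfMinor {c ℓ} (R : CommutativeRing c ℓ) where
  open CommutativeRing R hiding (zero)
  open Determinant R
  open IntegerSolver R
  open Matrices R
  open Units R using (Unit)
  open SetoidReasoning setoid

  pair : ∀ {n} → Fin n → Fin n → Fin 2 → Fin n
  pair i j 0F = i
  pair i j 1F = j

  pair-injective : ∀ {n} {i j : Fin n} → i ≢ j → Injective _≡_ _≡_ (pair i j)
  pair-injective i≢j {0F} {0F} _ = ≡.refl
  pair-injective i≢j {0F} {1F} e = contradiction e i≢j
  pair-injective i≢j {1F} {0F} e = contradiction (≡.sym e) i≢j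
  pair-injective i≢j {1F} {1F} _ = ≡.refl

  -- Scaling the two columns makes the first row (1, 1), and scaling the second row makes its last
  -- entry 1; what remains in the corner is y v / (u x).
  crossRatio : ∀ {m n} (A : Matrix m n) {i i′ j j′ p} → i ≢ i′ → j ≢ j′ →
               HasInverse (A i j) → HasInverse (A i j′) → HasInverse (A i′ j′) →
               p * (A i j * A i′ j′) ≈ A i′ j * A i j′ → Cr A p
  crossRatio A {i} {i′} {j} {j′} {p} i≢i′ j≢j′ (s , us) (t , vt) (k , xk) e =
    row (column (column (select (done (λ _ _ → refl)) (pair i i′) (pair j j′)
                                (pair-injective i≢i′) (pair-injective j≢j′) (λ _ _ → refl))
                        0F s (unit (trans (*-comm s u) us)) (λ _ _ → refl))
                1F t (unit (trans (*-comm t v) vt)) (λ _ _ → refl))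
        1F (k * v) (unit kvxt) entry
    where
    u = A i j
    v = A i j′
    x = A i′ j′
    y = A i′ j

    unit : ∀ {a b} → a * b ≈ 1# → Unit a
    unit {a} {b} ab = b , trans (*-comm b a) ab , ab

    kvxt : k * v * (x * t) ≈ 1#
    kvxt = begin
      k * v * (x * t)    ≈⟨ solve 4 (λ k v x t → k :* v :* (x :* t) := x :* k :* (v :* t)) refl _ _ _ _ ⟩
      x * k * (v * t)    ≈⟨ *-cong xk vt ⟩
      1# * 1#            ≈⟨ *-identityˡ 1# ⟩
      1#                 ∎

    corner : p ≈ k * v * (s * y)
    corner = sym (begin
      k * v * (s * y)          ≈⟨ solve 4 (λ k v s y → k :* v :* (s :* y) := k :* s :* (y :* v)) refl _ _ _ _ ⟩
      k * s * (y * v)          ≈⟨ *-congˡ e ⟨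
      k * s * (p * (u * x))    ≈⟨ solve 5 (λ k s p u x → k :* s :* (p :* (u :* x)) := p :* ((u :* s) :* (x :* k))) refl _ _ _ _ _ ⟩
      p * ((u * s) * (x * k))  ≈⟨ *-congˡ (trans (*-cong us xk) (*-identityˡ 1#)) ⟩
      p * 1#                   ≈⟨ *-identityʳ p ⟩
      p                        ∎)

    entry : crossMatrix p ≋ _
    entry 0F 0F = trans (sym us) (*-comm u s)
    entry 0F 1F = trans (sym vt) (*-comm v t)
    entry 1F 0F = corner
    entry 1F 1F = trans (sym kvxt) (*-congˡ (*-comm x t))

  -- The entries of A_{M,B} are brackets times a common β, so the relation between brackets is
  -- multiplied by β² on both sides.
  crossRatio-scaled : ∀ {m n} (A : Matrix m n) {i i′ j j′ p β u v x y} → i ≢ i′ → j ≢ j′ → HasInverse β →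
                      A i j ≈ u * β → A i j′ ≈ v * β → A i′ j′ ≈ x * β → A i′ j ≈ y * β →
                      HasInverse u → HasInverse v → HasInverse x → p * (u * x) ≈ y * v → Cr A p
  crossRatio-scaled A {i} {i′} {j} {j′} {p} {β} {u} {v} {x} {y} i≢i′ j≢j′ β⁻¹ eu ev ex ey u⁻¹ v⁻¹ x⁻¹ e =
    crossRatio A i≢i′ j≢j′ (scaled eu u⁻¹) (scaled ev v⁻¹) (scaled ex x⁻¹) (begin
      p * (A i j * A i′ j′)        ≈⟨ *-congˡ (*-cong eu ex) ⟩
      p * ((u * β) * (x * β))      ≈⟨ solve 4 (λ p u x β → p :* ((u :* β) :* (x :* β)) := p :* (u :* x) :* (β :* β)) refl _ _ _ _ ⟩
      p * (u * x) * (β * β)        ≈⟨ *-congʳ e ⟩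
      y * v * (β * β)              ≈⟨ solve 3 (λ y v β → y :* v :* (β :* β) := (y :* β) :* (v :* β)) refl _ _ _ ⟩
      (y * β) * (v * β)            ≈⟨ *-cong ey ev ⟨
      A i′ j * A i j′              ∎)
    where
    scaled : ∀ {a u} → a ≈ u * β → HasInverse u → HasInverse a
    scaled e u⁻¹ = HasInverse-resp (sym e) (HasInverse-* u⁻¹ β⁻¹)

module EquivalentBrackets {f ℓ r ℓ′} {F : CommutativeRing f ℓ} {R : CommutativeRing r ℓ′} {E : Set}
    (isField : IsDecidableField F) (1≉0 : ¬ CommutativeRing._≈_ R (CommutativeRing.1# R) (CommutativeRing.0# R))
    {bF : Brackets F E} {bR : Brackets R E} (equivalence : ProjectivelyEquivalent bF bR) where
  private
    module F = CommutativeRing F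
    module BF = Brackets bF
  open CommutativeRing R
  open Brackets bR
  open Determinant R
  open IntegerSolver R
  open ProjectivelyEquivalent equivalence
  open IsFieldEmbedding θ-embedding
  open CrossRatiosOfRepresented isField θ-embedding 1≉0
  open SetoidReasoning setoid

  module _ (b : Fin 3 → E) where
    replaced : ∀ {ℓ″} {A : Set ℓ″} → (E → E → E → A) → Fin 3 → E → A
    replaced ⟦⟧ 0F v = ⟦⟧ v (b 1F) (b 2F)
    replaced ⟦⟧ 1F v = ⟦⟧ (b 0F) v (b 2F)
    replaced ⟦⟧ 2F v = ⟦⟧ (b 0F) (b 1F) v

    -- Replacing b i by v j in the basis exchanges the weight of b i for that of v j, so the weights
    -- split into a row factor and a column factor.
    replacement-represented : ∀ {n} (v : Fin n → E) β → HasInverse β →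
                              Represented (λ i j → replaced ⟦_,_,_⟧ i (v j) * β)
    replacement-represented v β β⁻¹ = record
      { rows            = λ i → total * β * proj₁ (weight-inverse (b i))
      ; columns         = λ j → weight (v j)
      ; D               = λ i j → replaced BF.⟦_,_,_⟧ i (v j)
      ; rows-inverse    = λ i → HasInverse-* (HasInverse-* total-inverse β⁻¹)
                                             (HasInverse-sym (proj₂ (weight-inverse (b i))))
      ; columns-inverse = λ j → weight-inverse (v j)
      ; entry           = λ i j → entry i (v j)
      }
      where
      s = weight ∘ b
      total = constant * (s 0F * s 1F * s 2F)

      total-inverse : HasInverse total
      total-inverse = HasInverse-* constant-inverse
        (HasInverse-* (HasInverse-* (weight-inverse _) (weight-inverse _)) (weight-inverse _))

      -- The weight of b i and its inverse are inserted first: with their product left unreduced,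
      -- the two sides agree as polynomials.
      insert : ∀ {s t x y} → s * t ≈ 1# → (s * t) * x ≈ y → x ≈ y
      insert st e = trans (sym (trans (*-congʳ st) (*-identityˡ _))) e

      entry : ∀ i v → replaced ⟦_,_,_⟧ i v * β ≈
              total * β * proj₁ (weight-inverse (b i)) * weight v * θ (replaced BF.⟦_,_,_⟧ i v)
      entry 0F v = trans (*-congʳ (bracket-proportional v (b 1F) (b 2F)))
        (insert (proj₂ (weight-inverse (b 0F)))
          (solve 8 (λ K s₀ s₁ s₂ s t β d → s₀ :* t :* (K :* (s :* s₁ :* s₂) :* d :* β)
                                           := K :* (s₀ :* s₁ :* s₂) :* β :* t :* s :* d) refl _ _ _ _ _ _ _ _))
      entry 1F v = trans (*-congʳ (bracket-proportional (b 0F) v (b 2F)))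
        (insert (proj₂ (weight-inverse (b 1F)))
          (solve 8 (λ K s₀ s₁ s₂ s t β d → s₁ :* t :* (K :* (s₀ :* s :* s₂) :* d :* β)
                                           := K :* (s₀ :* s₁ :* s₂) :* β :* t :* s :* d) refl _ _ _ _ _ _ _ _))
      entry 2F v = trans (*-congʳ (bracket-proportional (b 0F) (b 1F) v))
        (insert (proj₂ (weight-inverse (b 2F)))
          (solve 8 (λ K s₀ s₁ s₂ s t β d → s₂ :* t :* (K :* (s₀ :* s₁ :* s) :* d :* β)
                                           := K :* (s₀ :* s₁ :* s₂) :* β :* t :* s :* d) refl _ _ _ _ _ _ _ _))

  -- t is the cross ratio of the columns u and v in the rows b₁ and b₂ of A_{M,B}.
  crossRatio-identity : ∀ b₁ b₂ b₃ u v t →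
    BF.⟦ b₁ , u , b₃ ⟧ F.≈ t F.* BF.⟦ u , b₂ , b₃ ⟧ → BF.⟦ b₁ , v , b₃ ⟧ F.≈ BF.⟦ v , b₂ , b₃ ⟧ →
    θ t * (⟦ u , b₂ , b₃ ⟧ * ⟦ b₁ , v , b₃ ⟧) ≈ ⟦ b₁ , u , b₃ ⟧ * ⟦ v , b₂ , b₃ ⟧
  crossRatio-identity b₁ b₂ b₃ u v t e e′ = begin
    θ t * (⟦ u , b₂ , b₃ ⟧ * ⟦ b₁ , v , b₃ ⟧)
      ≈⟨ *-congˡ (*-cong (bracket-proportional u b₂ b₃)
           (trans (bracket-proportional b₁ v b₃) (*-congˡ (θ-cong e′)))) ⟩
    _ ≈⟨ solve 9 (λ t K s₁ s₂ s₃ u v f f′ →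
           t :* ((K :* (u :* s₂ :* s₃) :* f) :* (K :* (s₁ :* v :* s₃) :* f′))
           := (K :* (s₁ :* u :* s₃) :* (t :* f)) :* (K :* (v :* s₂ :* s₃) :* f′)) refl
           (θ t) constant (weight b₁) (weight b₂) (weight b₃) (weight u) (weight v)
           (θ BF.⟦ u , b₂ , b₃ ⟧) (θ BF.⟦ v , b₂ , b₃ ⟧) ⟩
    _ ≈⟨ *-cong (trans (bracket-proportional b₁ u b₃)
                   (*-congˡ (trans (θ-cong e) (θ-* _ _))))
                (bracket-proportional v b₂ b₃) ⟨
    ⟦ b₁ , u , b₃ ⟧ * ⟦ v , b₂ , b₃ ⟧ ∎

-- The ring 𝔹 and its evaluation in F

module UniversalBrackets {n} (M : Matroid n 3) where
  open Universal M
  open Matroid M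
  private
    module ℤX = CommutativeRing ℤ[X]
    module 𝔹 = CommutativeRing 𝔹
    open IntegerSolver ℤ[X]
    module SB = IntegerSolver 𝔹
  open Quotient ℤ[X] Generator using (gen; resp)

  bracket-zero : ∀ {x y z} → ¬ IsBasis (entries (x ∷ y ∷ z ∷ [])) → [ x ∷ y ∷ z ∷ [] ] 𝔹.≈ 𝔹.0#
  bracket-zero ¬basis = resp (solve 1 (λ b → b := b :- con (+ 0)) ℤX.refl _) (gen (nonBasis _ ¬basis))

  bracket-inverse : ∀ {x y z} → IsBasis (entries (x ∷ y ∷ z ∷ [])) →
                    Determinant.HasInverse 𝔹 [ x ∷ y ∷ z ∷ [] ]
  bracket-inverse basis = _ , gen (inverse _ basis)

  opaque
    -- The form in which the sign of a transposition of neighbours appears: (-1)¹ unfolds to -1 · 1.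
    negated : ∀ v → (𝔹.- 𝔹.1# 𝔹.* 𝔹.1#) 𝔹.* v 𝔹.≈ 𝔹.- v
    negated = SB.solve 1 (λ v → (SB.:- SB.con (+ 1) SB.:* SB.con (+ 1)) SB.:* v SB.:= SB.:- v) 𝔹.refl

    swap₁₂ : ∀ x y z → [ y ∷ x ∷ z ∷ [] ] 𝔹.≈ 𝔹.- [ x ∷ y ∷ z ∷ [] ]
    swap₁₂ x y z = 𝔹.trans (gen (alternate (y ∷ x ∷ z ∷ []) (transpose 0F 1F))) (negated _)

    swap₂₃ : ∀ x y z → [ x ∷ z ∷ y ∷ [] ] 𝔹.≈ 𝔹.- [ x ∷ y ∷ z ∷ [] ]
    swap₂₃ x y z = 𝔹.trans (gen (alternate (x ∷ z ∷ y ∷ []) (transpose 1F 2F))) (negated _)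

    three-term : ∀ x₁ x₂ y₁ y₂ w → [ x₁ ∷ x₂ ∷ w ∷ [] ] 𝔹.* [ y₁ ∷ y₂ ∷ w ∷ [] ] 𝔹.≈
      [ y₁ ∷ x₂ ∷ w ∷ [] ] 𝔹.* [ x₁ ∷ y₂ ∷ w ∷ [] ] 𝔹.+ [ y₂ ∷ x₂ ∷ w ∷ [] ] 𝔹.* [ y₁ ∷ x₁ ∷ w ∷ [] ]
    three-term x₁ x₂ y₁ y₂ w = resp
      (solve 6 (λ a b c d e f → a :* b :- c :* d :- e :* f := a :* b :- (c :* d :+ e :* f)) ℤX.refl _ _ _ _ _ _)
      (gen (plücker ≡.refl x₁ x₂ y₁ y₂ (w ∷ [])))

  universalBrackets : Brackets 𝔹 (Fin n)
  universalBrackets = record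
    { ⟦_,_,_⟧ = λ x y z → [ x ∷ y ∷ z ∷ [] ]
    ; swap₁₂  = swap₁₂
    ; swap₂₃  = swap₂₃
    ; plücker = three-term
    }

-- The predicate counted by `inversions`, for arbitrary maps, so that a permutation can be replaced
-- by the table of its values.
Inverted : (Fin 3 → Fin 3) → Fin 3 × Fin 3 → Set
Inverted f (s , t) = s Fin.< t × f t Fin.< f s

inverted? : ∀ f st → Dec (Inverted f st)
inverted? f st = (proj₁ st <? proj₂ st) ×-dec (f (proj₂ st) <? f (proj₁ st))

inversionsOf : (Fin 3 → Fin 3) → ℕ
inversionsOf f = length (filter (inverted? f) (cartesianProduct (allFin 3) (allFin 3)))

inversionsOf-cong : ∀ f g → (∀ s → f s ≡ g s) → inversionsOf f ≡ inversionsOf g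
inversionsOf-cong f g f≗g = ≡.cong length (filter-≐ (inverted? f) (inverted? g)
  ( (λ {st} (s<t , ft<fs) → s<t , ≡.subst₂ Fin._<_ (f≗g (proj₂ st)) (f≗g (proj₁ st)) ft<fs)
  , (λ {st} (s<t , gt<gs) → s<t , ≡.subst₂ Fin._<_ (≡.sym (f≗g (proj₂ st))) (≡.sym (f≗g (proj₁ st))) gt<gs))
  (cartesianProduct (allFin 3) (allFin 3)))

-- A number computed from three values reduces once these are known, so the sign can be treated by
-- cases on them.
inversions₃ : (i j k : Fin 3) → ℕ
inversions₃ i j k = inversionsOf (Vec.lookup (i ∷ j ∷ k ∷ []))

inversions≡inversions₃ : (σ : Permutation′ 3) →
                         inversions σ ≡ inversions₃ (σ ⟨$⟩ʳ 0F) (σ ⟨$⟩ʳ 1F) (σ ⟨$⟩ʳ 2F)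
inversions≡inversions₃ σ = inversionsOf-cong (σ ⟨$⟩ʳ_) (Vec.lookup ((σ ⟨$⟩ʳ 0F) ∷ (σ ⟨$⟩ʳ 1F) ∷ (σ ⟨$⟩ʳ 2F) ∷ []))
  λ { 0F → ≡.refl ; 1F → ≡.refl ; 2F → ≡.refl }

module DeterminantSign {c ℓ} (F : CommutativeRing c ℓ) where
  open CommutativeRing F hiding (zero)
  open IntegerSolver F
  open Determinant F
  open SemiringExp semiring using (_^_)

  private
    -- Mirrors the unfolding of (-1)^k, so that the solver meets the sign in the form to which it
    -- reduces.
    signₚ : ∀ {n} → ℕ → Polynomial n
    signₚ zero    = con (+ 1)
    signₚ (suc k) = :- con (+ 1) :* signₚ k

  det-permutation : ∀ (v : Fin 3 → Vector Carrier 3) i j k → i ≢ j → i ≢ k → j ≢ k →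
                    det (v 0F) (v 1F) (v 2F) ≈ (- 1#) ^ inversions₃ i j k * det (v i) (v j) (v k)
  det-permutation v 0F 0F _ i≢j _ _ = contradiction ≡.refl i≢j
  det-permutation v 1F 1F _ i≢j _ _ = contradiction ≡.refl i≢j
  det-permutation v 2F 2F _ i≢j _ _ = contradiction ≡.refl i≢j
  det-permutation v 0F _ 0F _ i≢k _ = contradiction ≡.refl i≢k
  det-permutation v 1F _ 1F _ i≢k _ = contradiction ≡.refl i≢k
  det-permutation v 2F _ 2F _ i≢k _ = contradiction ≡.refl i≢k
  det-permutation v _ 0F 0F _ _ j≢k = contradiction ≡.refl j≢k
  det-permutation v _ 1F 1F _ _ j≢k = contradiction ≡.refl j≢k
  det-permutation v _ 2F 2F _ _ j≢k = contradiction ≡.refl j≢k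
  det-permutation v 0F 1F 2F _ _ _ = solve 9 (λ x₀ x₁ x₂ y₀ y₁ y₂ z₀ z₁ z₂ →
    detₚ x₀ x₁ x₂ y₀ y₁ y₂ z₀ z₁ z₂ := signₚ 0 :* detₚ x₀ x₁ x₂ y₀ y₁ y₂ z₀ z₁ z₂) refl _ _ _ _ _ _ _ _ _
  det-permutation v 0F 2F 1F _ _ _ = solve 9 (λ x₀ x₁ x₂ y₀ y₁ y₂ z₀ z₁ z₂ →
    detₚ x₀ x₁ x₂ y₀ y₁ y₂ z₀ z₁ z₂ := signₚ 1 :* detₚ x₀ x₁ x₂ z₀ z₁ z₂ y₀ y₁ y₂) refl _ _ _ _ _ _ _ _ _
  det-permutation v 1F 0F 2F _ _ _ = solve 9 (λ x₀ x₁ x₂ y₀ y₁ y₂ z₀ z₁ z₂ →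
    detₚ x₀ x₁ x₂ y₀ y₁ y₂ z₀ z₁ z₂ := signₚ 1 :* detₚ y₀ y₁ y₂ x₀ x₁ x₂ z₀ z₁ z₂) refl _ _ _ _ _ _ _ _ _
  det-permutation v 1F 2F 0F _ _ _ = solve 9 (λ x₀ x₁ x₂ y₀ y₁ y₂ z₀ z₁ z₂ →
    detₚ x₀ x₁ x₂ y₀ y₁ y₂ z₀ z₁ z₂ := signₚ 2 :* detₚ y₀ y₁ y₂ z₀ z₁ z₂ x₀ x₁ x₂) refl _ _ _ _ _ _ _ _ _
  det-permutation v 2F 0F 1F _ _ _ = solve 9 (λ x₀ x₁ x₂ y₀ y₁ y₂ z₀ z₁ z₂ →
    detₚ x₀ x₁ x₂ y₀ y₁ y₂ z₀ z₁ z₂ := signₚ 2 :* detₚ z₀ z₁ z₂ x₀ x₁ x₂ y₀ y₁ y₂) refl _ _ _ _ _ _ _ _ _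
  det-permutation v 2F 1F 0F _ _ _ = solve 9 (λ x₀ x₁ x₂ y₀ y₁ y₂ z₀ z₁ z₂ →
    detₚ x₀ x₁ x₂ y₀ y₁ y₂ z₀ z₁ z₂ := signₚ 3 :* detₚ z₀ z₁ z₂ y₀ y₁ y₂ x₀ x₁ x₂) refl _ _ _ _ _ _ _ _ _

module Evaluation {c ℓ} {F : CommutativeRing c ℓ} (isField : IsDecidableField F) {n} {M : Matroid n 3}
                  (R : Representation F M) where
  open CommutativeRing F
  open Determinant F
  open Representation R using (w; det≉0⇒basis; basis⇒det≉0)
  open Universal M
  open Matroid M
  open IsDecidableField isField renaming (inverse to field-inverse)
  open Polynomial Symbol using (Poly; 0ᵖ; 1ᵖ; _+ᵖ_; _*ᵖ_; -ᵖ_; _≈ᵖ_; ≈-refl; ≈-sym; ≈-trans; +-idˡ; -‿invˡ; *-idˡ; distˡ)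
  private
    module ℤX = CommutativeRing ℤ[X]
    module 𝔹 = CommutativeRing 𝔹
    module P = Polynomial Symbol
    module I = Quotient ℤ[X] Generator
    open DeterminantSign F
    open SemiringExp semiring using (_^_)
    open RingProperties ring using (x≈y⇒x∙y⁻¹≈ε; x∙y⁻¹≈ε⇒x≈y)

  determinant : Vec (Fin n) 3 → Carrier
  determinant (x ∷ y ∷ z ∷ []) = det (w x) (w y) (w z)

  -- The reciprocal of 0 is taken to be 0.
  reciprocal : Carrier → Carrier
  reciprocal x = case (x ≈? 0#)
    where
    case : Dec (x ≈ 0#) → Carrier
    case (yes _)  = 0#
    case (no x≉0) = proj₁ (field-inverse x≉0)

  reciprocal-inverse : ∀ {x} → ¬ x ≈ 0# → x * reciprocal x ≈ 1#
  reciprocal-inverse {x} x≉0 with x ≈? 0#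
  ... | yes x≈0 = contradiction x≈0 x≉0
  ... | no x≉0′ = proj₂ (field-inverse x≉0′)

  -- The basis proof in `bar` is irrelevant, so no inverse can be extracted from it; hence the total
  -- `reciprocal`, which is a true inverse wherever the generator `inverse` applies.
  eval : Poly → Carrier
  eval (P.var (bracket Z)) = determinant Z
  eval (P.var (bar Z _))   = reciprocal (determinant Z)
  eval 0ᵖ                  = 0#
  eval 1ᵖ                  = 1#
  eval (f +ᵖ g)            = eval f + eval g
  eval (f *ᵖ g)            = eval f * eval g
  eval (-ᵖ f)              = - eval f

  eval-≈ᵖ : ∀ {f g} → f ≈ᵖ g → eval f ≈ eval g
  eval-≈ᵖ ≈-refl            = refl
  eval-≈ᵖ (≈-sym p)         = sym (eval-≈ᵖ p)
  eval-≈ᵖ (≈-trans p q)     = trans (eval-≈ᵖ p) (eval-≈ᵖ q)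
  eval-≈ᵖ (P.+-cong p q)    = +-cong (eval-≈ᵖ p) (eval-≈ᵖ q)
  eval-≈ᵖ (P.*-cong p q)    = *-cong (eval-≈ᵖ p) (eval-≈ᵖ q)
  eval-≈ᵖ (P.-‿cong p)      = -‿cong (eval-≈ᵖ p)
  eval-≈ᵖ (P.+-assoc f g h) = +-assoc _ _ _
  eval-≈ᵖ (P.+-comm f g)    = +-comm _ _
  eval-≈ᵖ (+-idˡ f)         = +-identityˡ _
  eval-≈ᵖ (-‿invˡ f)        = -‿inverseˡ _
  eval-≈ᵖ (P.*-assoc f g h) = *-assoc _ _ _
  eval-≈ᵖ (P.*-comm f g)    = *-comm _ _
  eval-≈ᵖ (*-idˡ f)         = *-identityˡ _
  eval-≈ᵖ (distˡ f g h)     = distribˡ _ _ _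

  eval-sign : ∀ k → eval (SemiringExp._^_ ℤX.semiring (ℤX.- ℤX.1#) k) ≈ (- 1#) ^ k
  eval-sign zero    = refl
  eval-sign (suc k) = *-congˡ (eval-sign k)

  private
    det-zero : ∀ x y z → ¬ IsBasis (entries (x ∷ y ∷ z ∷ [])) → det (w x) (w y) (w z) ≈ 0#
    det-zero x y z ¬basis = case (det (w x) (w y) (w z) ≈? 0#)
      where
      case : Dec (det (w x) (w y) (w z) ≈ 0#) → det (w x) (w y) (w z) ≈ 0#
      case (yes e) = e
      case (no n)  = contradiction (det≉0⇒basis x y z n) ¬basis

    eval-alternate : ∀ Z σ → determinant Z ≈ eval (sgn σ) * determinant (permute σ Z)
    eval-alternate Z@(x ∷ y ∷ z ∷ []) σ = trans
      (det-permutation (w ∘ Vec.lookup Z) (σ ⟨$⟩ʳ 0F) (σ ⟨$⟩ʳ 1F) (σ ⟨$⟩ʳ 2F)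
        (λ e → contradiction (σ-injective e) λ ()) (λ e → contradiction (σ-injective e) λ ())
        (λ e → contradiction (σ-injective e) λ ()))
      (*-congʳ (sym (trans (eval-sign (inversions σ))
        (reflexive (≡.cong ((- 1#) ^_) (inversions≡inversions₃ σ))))))
      where
      σ-injective : ∀ {i j} → σ ⟨$⟩ʳ i ≡ σ ⟨$⟩ʳ j → i ≡ j
      σ-injective {i} {j} e =
        ≡.trans (≡.sym (inverseˡ σ)) (≡.trans (≡.cong (σ ⟨$⟩ˡ_) e) (inverseˡ σ))

  eval-generator : ∀ {f} → Generator f → eval f ≈ 0#
  eval-generator (nonBasis (x ∷ y ∷ z ∷ []) ¬basis) = det-zero x y z ¬basis
  eval-generator (alternate Z σ) = x≈y⇒x∙y⁻¹≈ε (eval-alternate Z σ)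
  eval-generator (plücker ≡.refl x₁ x₂ y₁ y₂ (t ∷ [])) =
    trans (S.solve 6 (λ a b c d e f → a S.:* b S.:- c S.:* d S.:- e S.:* f S.:= a S.:* b S.:- (c S.:* d S.:+ e S.:* f))
             refl _ _ _ _ _ _)
      (x≈y⇒x∙y⁻¹≈ε (CrossProduct.det-plücker F (w x₁) (w x₂) (w y₁) (w y₂) (w t)))
    where module S = IntegerSolver F
  eval-generator (inverse (x ∷ y ∷ z ∷ []) basis) =
    x≈y⇒x∙y⁻¹≈ε (reciprocal-inverse (basis⇒det≉0 x y z basis))

  eval-ideal : ∀ {f} → I.Ideal f → eval f ≈ 0#
  eval-ideal (I.gen g)    = eval-generator g
  eval-ideal I.0∈         = refl
  eval-ideal (I.+∈ p q)   = trans (+-cong (eval-ideal p) (eval-ideal q)) (+-identityˡ 0#)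
  eval-ideal (I.*∈ r p)   = trans (*-congˡ (eval-ideal p)) (zeroʳ _)
  eval-ideal (I.resp e p) = trans (sym (eval-≈ᵖ e)) (eval-ideal p)

  eval-cong : ∀ {f g} → f 𝔹.≈ g → eval f ≈ eval g
  eval-cong p = x∙y⁻¹≈ε⇒x≈y _ _ (eval-ideal p)

  -- Evaluation sends 1 and 0 to the different elements 1 and 0 of F: representability over a field
  -- keeps the ideal proper.
  𝔹-nontrivial : ¬ 𝔹.1# 𝔹.≈ 𝔹.0#
  𝔹-nontrivial e = 1≉0 (eval-cong e)

-- The isomorphism of partial fields

Transversals : ∀ {c ℓ} {F : CommutativeRing c ℓ} {E : Set} → Brackets F E → E → E → E → Set (c ⊔ ℓ)
Transversals {F = F} bF b₁ b₂ b₃ =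
  ∀ t → ∃[ u ] ¬ ⟦ u , b₂ , b₃ ⟧ ≈ 0# × ⟦ b₁ , u , b₃ ⟧ ≈ t * ⟦ u , b₂ , b₃ ⟧
  where
  open CommutativeRing F
  open Brackets bF

module Isomorphism {c ℓ₁ ℓ₂} (F : HeytingField c ℓ₁ ℓ₂) (isField : IsDecidableField (fieldRing F))
    {n} {M : Matroid n 3} (representation : Representation (fieldRing F) M)
    (equivalence : ProjectivelyEquivalent (Representation.brackets representation)
                                          (UniversalBrackets.universalBrackets M))
    (b₁ b₂ b₃ : Fin n) (b : Matroid.IsBasis M (entries (b₁ ∷ b₂ ∷ b₃ ∷ [])))
    (transversal : Transversals (Representation.brackets representation) b₁ b₂ b₃)
    where
  open CommutativeRing (fieldRing F)
  private
    open Representation representation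
    open Brackets brackets using (⟦_,_,_⟧)
    open CrossProduct (fieldRing F)
    open IsDecidableField isField
    open FieldProperties isField
    open Determinant (fieldRing F)
    open IntegerSolver (fieldRing F)
    module U = Universal M
    module 𝔹 = CommutativeRing U.𝔹
    open UniversalBrackets M
    open Evaluation isField representation
    open ProjectivelyEquivalent equivalence
    open IsFieldEmbedding θ-embedding
    open CrossRatiosOfRepresented isField θ-embedding 𝔹-nontrivial
    open EquivalentBrackets isField 𝔹-nontrivial equivalence

    B : Vec (Fin n) 3
    B = b₁ ∷ b₂ ∷ b₃ ∷ []

    β : 𝔹.Carrier
    β = U.var (U.bar B b)

    Bβ : U.[ B ] 𝔹.* β 𝔹.≈ 𝔹.1#
    Bβ = proj₂ (bracket-inverse b)

    β-inverse : Determinant.HasInverse U.𝔹 β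
    β-inverse = Determinant.HasInverse-sym U.𝔹 Bβ

    A : U.Matrix 3 (length (U.nonbasic B b))
    A = U.representation B b

    representation-represented : Represented A
    representation-represented = represented-resp
      (λ { 0F _ → 𝔹.refl ; 1F _ → 𝔹.refl ; 2F _ → 𝔹.refl })
      (replacement-represented (Vec.lookup B) (List.lookup (U.nonbasic B b)) β β-inverse)

    -- The cross ratio of the columns of Column t and Column 1# is t.
    record Column (t : Carrier) : Set (c ⊔ ℓ₁) where
      field
        u    : Fin n
        f≉0  : ¬ ⟦ u , b₂ , b₃ ⟧ ≈ 0#
        g≈tf : ⟦ b₁ , u , b₃ ⟧ ≈ t * ⟦ u , b₂ , b₃ ⟧

      g≉0 : ¬ t ≈ 0# → ¬ ⟦ b₁ , u , b₃ ⟧ ≈ 0#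
      g≉0 t≉0 g≈0 = *-nonzero t≉0 f≉0 (trans (sym g≈tf) g≈0)

    column : ∀ t → Column t
    column t = let u , f≉0 , g≈tf = transversal t in record { u = u ; f≉0 = f≉0 ; g≈tf = g≈tf }

    module _ {t} (U : Column t) (V : Column 1#) where
      open Column U
      open Column V renaming (u to v; f≉0 to f′≉0; g≈tf to g′≈f′; g≉0 to g′≉0)

      identity : θ t 𝔹.* (U.[ u ∷ b₂ ∷ b₃ ∷ [] ] 𝔹.* U.[ b₁ ∷ v ∷ b₃ ∷ [] ]) 𝔹.≈
                 U.[ b₁ ∷ u ∷ b₃ ∷ [] ] 𝔹.* U.[ v ∷ b₂ ∷ b₃ ∷ [] ]
      identity = crossRatio-identity b₁ b₂ b₃ u v t g≈tf (trans g′≈f′ (*-identityˡ _))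

      -- The value is read off from `identity`, whose brackets evaluate to determinants over F; the
      -- nonzero factor f f′ cancels.
      eval-θ-column : eval (θ t) ≈ t
      eval-θ-column = *-cancelˡ-inverse (inverse (*-nonzero f≉0 f′≉0)) (begin
        f * f′ * eval (θ t)                    ≈⟨ trans (*-comm _ _) (*-congˡ (*-congˡ (sym (trans g′≈f′ (*-identityˡ _))))) ⟩
        eval (θ t) * (f * ⟦ b₁ , v , b₃ ⟧)     ≈⟨ eval-cong identity ⟩
        ⟦ b₁ , u , b₃ ⟧ * f′                   ≈⟨ *-congʳ g≈tf ⟩
        t * f * f′                             ≈⟨ solve 3 (λ t f f′ → t :* f :* f′ := f :* f′ :* t) refl _ _ _ ⟩
        f * f′ * t                             ∎)
        where
        open SetoidReasoning setoid
        f = ⟦ u , b₂ , b₃ ⟧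
        f′ = ⟦ v , b₂ , b₃ ⟧

  eval-θ : ∀ t → eval (θ t) ≈ t
  eval-θ t = eval-θ-column (column t) (column 1#)

  private
    -- At u = b₁ the determinant ⟦b₁,u,b₃⟧ vanishes, against t ≠ 0; at u = b₂ or u = b₃ the other
    -- one does. So u labels a column of A.
    u∉B : ∀ {t} → ¬ t ≈ 0# → (U : Column t) → Column.u U ∉ entries B
    u∉B t≉0 U u∈B = [ (λ { ≡.refl → g≉0 t≉0 (det-repeated (w b₁) (w b₃)) })
                    , [ (λ { ≡.refl → f≉0 (det-repeated (w b₂) (w b₃)) })
                      , (λ { ≡.refl → f≉0 (trans (det-dot₀ (w b₃) (w b₂) (w b₃)) (cross-vanishesʳ (w b₂) (w b₃))) }) ]′
                    ]′ (∈entries⁻ b₁ b₂ b₃ u∈B)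
      where open Column U

    position : ∀ u → u ∉ entries B → ∃[ j ] List.lookup (U.nonbasic B b) j ≡ u
    position u u∉ = Any.index u∈ , ≡.sym (lookup-index u∈)
      where u∈ = ∈-filter⁺ (λ v → ¬? (v ∈? entries B)) (∈-allFin u) u∉

    bracket⁻¹ : ∀ {x y z} → ¬ ⟦ x , y , z ⟧ ≈ 0# → Determinant.HasInverse U.𝔹 U.[ x ∷ y ∷ z ∷ [] ]
    bracket⁻¹ {x} {y} {z} ne = bracket-inverse (det≉0⇒basis x y z ne)

    -- For t = 0 the element u may be b₁, which labels no column of A; for t = 1 the columns of u
    -- and v may coincide. Hence the two exceptions.
    θ-crossRatio-columns : ∀ {t} → ¬ t ≈ 0# → ¬ t ≈ 1# → (U : Column t) (V : Column 1#) → U.CrossRatio B b (θ t)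
    θ-crossRatio-columns {t} t≉0 t≉1 U V = CrossRatioOfMinor.crossRatio-scaled U.𝔹 A {0F} {1F} {j} {j′}
      (λ ()) j≢j′ β-inverse
      (𝔹.reflexive (≡.cong (λ x → U.[ x ∷ b₂ ∷ b₃ ∷ [] ] 𝔹.* β) at-j))
      (𝔹.reflexive (≡.cong (λ x → U.[ x ∷ b₂ ∷ b₃ ∷ [] ] 𝔹.* β) at-j′))
      (𝔹.reflexive (≡.cong (λ x → U.[ b₁ ∷ x ∷ b₃ ∷ [] ] 𝔹.* β) at-j′))
      (𝔹.reflexive (≡.cong (λ x → U.[ b₁ ∷ x ∷ b₃ ∷ [] ] 𝔹.* β) at-j))
      (bracket⁻¹ f≉0) (bracket⁻¹ f′≉0) (bracket⁻¹ (g′≉0 1≉0)) (identity U V)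
      where
      open Column U
      open Column V renaming (u to v; f≉0 to f′≉0; g≈tf to g′≈f′; g≉0 to g′≉0)
      j = proj₁ (position u (u∉B t≉0 U))
      j′ = proj₁ (position v (u∉B 1≉0 V))
      at-j = proj₂ (position u (u∉B t≉0 U))
      at-j′ = proj₂ (position v (u∉B 1≉0 V))

      j≢j′ : j ≢ j′
      j≢j′ e = t≉1 (*-cancelˡ-inverse (inverse f≉0)
        (trans (*-comm _ _) (trans (sym g≈tf) (trans same (*-comm _ _)))))
        where
        u≡v : u ≡ v
        u≡v = ≡.trans (≡.sym at-j) (≡.trans (≡.cong (List.lookup (U.nonbasic B b)) e) at-j′)

        same : ⟦ b₁ , u , b₃ ⟧ ≈ 1# * ⟦ u , b₂ , b₃ ⟧
        same = ≡.subst (λ x → ⟦ b₁ , x , b₃ ⟧ ≈ 1# * ⟦ x , b₂ , b₃ ⟧) (≡.sym u≡v) g′≈f′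

  θ-crossRatio : ∀ {t} → ¬ t ≈ 0# → ¬ t ≈ 1# → U.CrossRatio B b (θ t)
  θ-crossRatio {t} t≉0 t≉1 = θ-crossRatio-columns t≉0 t≉1 (column t) (column 1#)

  private
    module R = Generated U.𝔹 (U.CrossRatio B b)
    module G = Generated U.𝔹 (U.CrossRatioOr-1 B b)
    ℙ = U.universalPartialField B b
    𝔽 = fieldPartialField F
    module ℙ = PartialField ℙ
    module 𝔽 = PartialField 𝔽

  -- The image of θ is a subring that contains all cross ratios.
  subring-image : ∀ {x} → R.ℤ[_] x → ∃[ t ] x 𝔹.≈ θ t
  subring-image (R.gen x∈)    = crossRatio-image representation-represented x∈
  subring-image R.0∈          = 0# , 𝔹.sym θ-0
  subring-image R.1∈          = 1# , 𝔹.sym θ-1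
  subring-image (R.+∈ p q)    = let s , x≈ = subring-image p ; t , y≈ = subring-image q in
    s + t , 𝔹.trans (𝔹.+-cong x≈ y≈) (𝔹.sym (θ-+ s t))
  subring-image (R.*∈ p q)    = let s , x≈ = subring-image p ; t , y≈ = subring-image q in
    s * t , 𝔹.trans (𝔹.*-cong x≈ y≈) (𝔹.sym (θ-* s t))
  subring-image (R.-∈ p)      = let s , x≈ = subring-image p in
    - s , 𝔹.trans (𝔹.-‿cong x≈) (𝔹.sym (θ-neg s))
  subring-image (R.resp e p)  = let s , x≈ = subring-image p in
    s , 𝔹.trans (𝔹.sym e) x≈

  θ-subring : ∀ t → R.ℤ[_] (θ t)
  θ-subring t = case (t ≈? 0#) (t ≈? 1#)
    where
    case : Dec (t ≈ 0#) → Dec (t ≈ 1#) → R.ℤ[_] (θ t)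
    case (yes t≈0) _         = R.resp (𝔹.sym (𝔹.trans (θ-cong t≈0) θ-0)) R.0∈
    case (no _)    (yes t≈1) = R.resp (𝔹.sym (𝔹.trans (θ-cong t≈1) θ-1)) R.1∈
    case (no t≉0)  (no t≉1)  = R.gen (θ-crossRatio t≉0 t≉1)

  θ-group : ∀ {t} → ¬ t ≈ 0# → G.⟨_⟩ (θ t)
  θ-group {t} t≉0 = case (t ≈? 1#)
    where
    i = proj₁ (inverse t≉0)
    ti = proj₂ (inverse t≉0)

    case : Dec (t ≈ 1#) → G.⟨_⟩ (θ t)
    case (yes t≈1) = G.resp (𝔹.sym (𝔹.trans (θ-cong t≈1) θ-1)) G.1∈
    case (no t≉1)  = G.gen (inj₁ (θ-crossRatio t≉0 t≉1))
      (θ i , θ-inverse (trans (*-comm i t) ti) , θ-inverse ti)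

  -- Together with `subring-image` this makes every element of the ring of ℙ zero or an element of
  -- the group, so that addition in ℙ is always defined.
  θ-member : ∀ {x : ℙ.Carrier} t → proj₁ x 𝔹.≈ θ t → ℙ.Member x
  θ-member t x≈ = case (t ≈? 0#)
    where
    case : Dec (t ≈ 0#) → _
    case (yes t≈0) = inj₁ (𝔹.trans x≈ (𝔹.trans (θ-cong t≈0) θ-0))
    case (no t≉0)  = inj₂ (G.resp (𝔹.sym x≈) (θ-group t≉0))

  member-F : ∀ t → 𝔽.Member t
  member-F t = case (t ≈? 0#)
    where
    case : Dec (t ≈ 0#) → 𝔽.Member t
    case (yes t≈0) = inj₁ t≈0
    case (no t≉0)  = let i , ti = inverse t≉0 in inj₂ (i , trans (*-comm i t) ti , ti)

  φ : ℙ.Element → 𝔽.Element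
  φ ((x , _) , _) = eval x , member-F (eval x)

  eval-injective : ∀ {x y} → R.ℤ[_] x → R.ℤ[_] y → eval x ≈ eval y → x 𝔹.≈ y
  eval-injective p q e =
    let s , x≈ = subring-image p
        t , y≈ = subring-image q
        s≈t = trans (sym (trans (eval-cong x≈) (eval-θ s))) (trans e (trans (eval-cong y≈) (eval-θ t)))
    in 𝔹.trans x≈ (𝔹.trans (θ-cong s≈t) (𝔹.sym y≈))

  isomorphism : ℙ ≅ 𝔽
  isomorphism = φ , record
    { isHom = record
      { φ-cong = λ {p} {q} e → eval-cong e
      -- Evaluation is defined by recursion on polynomials, so it respects 1, products and sums by
      -- computation.
      ; φ-1    = refl
      ; φ-*    = λ _ _ _ → refl
      ; φ-+    = λ _ _ _ → refl
      }
    ; bijective = (λ {p} {q} → eval-injective (proj₂ (proj₁ p)) (proj₂ (proj₁ q))) ,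
        (λ y → let t = proj₁ y in
          ((θ t , θ-subring t) , θ-member {θ t , θ-subring t} t 𝔹.refl) ,
          (λ z≈θt → trans (eval-cong z≈θt) (eval-θ t)))
    -- Addition is total in both partial fields: a sum in ℙ is some θ t by `subring-image`.
    ; +-defined = λ p q → mk⇔
        (λ _ → let s , x≈ = subring-image (R.+∈ (proj₂ (proj₁ p)) (proj₂ (proj₁ q))) in
          θ-member {proj₁ p ℙ.+ proj₁ q} s x≈)
        (λ _ → member-F _)
    }

theorem4p19 : ∀ {c ℓ₁ ℓ₂ : Level} (q : ℕ) → IsPrimePower q →
    (F : HeytingField c ℓ₁ ℓ₂) → HasOrder F q →
    {n : ℕ} (M : Matroid n 3) → ProjectivePlane.IsQ⁺ F M →
    (B : Vec (Fin n) 3) (b : Matroid.IsBasis M (entries B)) →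
    Universal.universalPartialField M B b ≅ fieldPartialField F
theorem4p19 q _ F order {n} M Q (b₁ ∷ b₂ ∷ b₃ ∷ []) b =
  Isomorphism.isomorphism F isField representation equivalence b₁ b₂ b₃ b
    -- The basis B is arbitrary and need not be the triangle; the cross ratios are read from
    -- A_{M,B}, so the transversals are taken for B.
    (transversal b₁ b₂ b₃ (Representation.basis⇒det≉0 representation b₁ b₂ b₃ b))
  where
  isField = finiteField-isDecidableField F order
  open Plane F isField Q using (representation; transversal; configuration)
  open UniversalBrackets M

  equivalence : ProjectivelyEquivalent (Representation.brackets representation) universalBrackets
  equivalence = ProjectiveUniqueness.projectivelyEquivalent isField
    (configuration universalBrackets bracket-zero bracket-inverse)
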